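{- Let $\mathbf{k}$ be a commutative ring, $E_\bullet$ a standard quotient flag over $\mathbf{k}$, and $k\ge1$. If the diagram $D$ has a descent at $k$, then there is an isomorphism of $B$-modules $$\ker\bigl(\mathsf{R}_{k+1}E_\bullet^D\to\mathsf{R}_kE_\bullet^D\bigr)\;\cong\;K_k\otimes\mathsf{R}_{k+1}E_\bullet^{s_kD},$$ where $K_k=\ker\bigl((\mathsf{R}_{k+1}E_\bullet)_k\to(\mathsf{R}_kE_\bullet)_k\bigr)=\ker(E_k\to E_{k-1})$.
   Context: Diagrams. A diagram is a finite tuple $D=[a^{(1)},\dots,a^{(m)}]$ of finite subsets of $\mathbb{Z}_{>0}$ (its columns); a box $(i,j)$ (row $i$, column $j$) belongs to $D$ iff $i\in a^{(j)}$. Reordering columns and adding or deleting empty columns is immaterial. A column $a$ is $k$-full if $k\in a$ implies $k+1\in a$. $D$ has a descent at $k$ if, possibly after reordering columns, there is a column $a^{(j)}$ whose largest element is $k$, such that all columns $a^{(j')}$ with $j'<j$ are $k$-full, and all columns with $j'>j$ satisfy $a^{(j')}\cap\{1,\dots,k+1\}\subseteq a^{(j)}$. The witnessing column is unique up to repetition; take the leftmost one. Then $s_kD$ is the diagram obtained by deleting the box $(k,j)$ of the witnessing column and then swapping rows $k$ and $k+1$. Standard flag. Let $n$ be large enough that all boxes of $D$ and $s_kD$ are in rows $1,\dots,n$. $E$ is a free $\mathbf{k}$-module with basis $z_1,\dots,z_n$ and $E_i=E/\langle z_{i+1},\dots,z_n\rangle$ for $0\le i\le n$, so $E_\bullet$: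 $E=E_n\to\cdots\to E_1\to E_0=0$. Flagged Schur modules. Let $F_\bullet=(F_n\to\cdots\to F_1)$ be any flag of quotients of $E$. Put $TE^D=\bigwedge^{r_1}E\otimes\cdots\otimes\bigwedge^{r_m}E$ with $r_j=|a^{(j)}|$; it has basis $z_\tau=\bigotimes_j z_{b^{(j)}_1}\wedge\cdots\wedge z_{b^{(j)}_{r_j}}$, where $\tau=(b^{(1)},\dots,b^{(m)})$, $b^{(j)}=\{b^{(j)}_1<\dots<b^{(j)}_{r_j}\}\subseteq\{1,\dots,n\}$. The $D$-exchange relations are the elements of the kernel of $TE^D\to\mathbf{k}[z_{pq}]_{1\le p,q\le n}$, $z_\tau\mapsto\prod_j\Delta_{a^{(j)},b^{(j)}}$, where $\Delta_{a,b}$ is the minor of the generic matrix $(z_{pq})$ on rows $a$ and columns $b$. For $a=\{a_1<\dots<a_r\}$, let $F_\bullet^a$ be the quotient of $\bigwedge^rE$ by the sum over $0\le i<r$ of the images of $\bigwedge^iE\otimes\bigwedge^{r-i}\ker(E\to F_{a_{i+1}})$; put $TF_\bullet^D=\bigotimes_jF_\bullet^{a^{(j)}}$. The flagged Schur module $F_\bullet^D$ is the quotient of $TF_\bullet^D$ by the image of the $D$-exchange relations. It is functorial in $F_\bullet$. When $F_\bullet$ is $E_\bullet$ or one of the flags $\mathsf{R}_kE_\bullet$ below, the paper regards $F_\bullet^D$ as a submodule of a polynomial ring via $z_\tau\mapsto\prod_j\Delta_{a^{(j)},b^{(j)}}$, the minors being taken in the generic matrix in which $z_{pq}$ is set to $0$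 whenever $z_q$ maps to $0$ in $F_p$. Bergeron–Sottile operators on flags: $\mathsf{R}_kE_\bullet$ is the flag with $(\mathsf{R}_kE_\bullet)_i=E_i$ for $i<k$ and $(\mathsf{R}_kE_\bullet)_i=E_{i-1}$ for $i\ge k$. The notation $\mathsf{R}_kE_\bullet^D$ means $(\mathsf{R}_kE_\bullet)^D$. The map $\mathsf{R}_{k+1}E_\bullet^D\to\mathsf{R}_kE_\bullet^D$ is induced by the surjection of flags given by $E_k\to E_{k-1}$ in position $k$ and the identity elsewhere. $B\subset GL(E)$ is the group of lower-triangular matrices (those $g$ with $gz_j\in\langle z_j,\dots,z_n\rangle$), i.e. the subgroup preserving $E_\bullet$; it acts on all the modules above by functoriality.
   Formalization: The claim fails for general D (e.g. columns {2,3,4},{2,4}, k=4, n=5), so the formal theorem assumes that the modules R_{k+1}E^D and R_{k+1}E^{s_kD}, defined as quotients, embed in the polynomial ring via products of minors, as the paper takes for granted. -}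

module Defs where

open import Algebra.Bundles using (CommutativeRing; Group)
open import Algebra.Module.Bundles using (LeftModule)
open import Algebra.Module.Morphism.Structures using (IsLeftModuleHomomorphism; IsLeftModuleIsomorphism)
import Algebra.Properties.AbelianGroup as AbelianGroupProperties
import Algebra.Properties.Semiring.Sum as SemiringSum
open import Data.Empty.Polymorphic using (⊥)
open import Data.Fin.Base as Fin using (Fin; zero; suc; toℕ; inject₁; punchIn)
open import Data.Fin.Permutation using (transpose; _⟨$⟩ʳ_)
import Data.Fin.Properties as Fin
open import Data.Fin.Subset using (Subset; inside; outside; _∈_; _-_; ∣_∣)
open import Data.List.Base using (List; []; _∷_; _++_; map)
open import Data.List.Relation.Binary.Permutation.Propositional using (_↭_)
open import Data.List.Relation.Unary.All using (All)
open import Data.Nat.Base as ℕ using (ℕ; zero; suc; pred)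
open import Data.Nat.Induction using (<-wellFounded; Acc; acc)
import Data.Nat.Properties as ℕ
open import Data.Product.Base using (Σ; _×_; _,_; proj₁; proj₂)
open import Data.Unit.Base using (⊤)
import Data.Vec.Functional as Vector
open import Data.Vec.Base using ([]; _∷_; lookup; tabulate)
open import Function.Base using (_∘_; id)
open import Level using (Level; _⊔_) renaming (suc to lsuc)
open import Relation.Binary.PropositionalEquality as ≡ using (_≡_; _≢_)
import Relation.Binary.Reasoning.Setoid as ≈-Reasoning
open import Relation.Nullary using (yes; no; contradiction)
open import Relation.Unary using (Pred)

------------------------------------------------------------------------
-- Diagrams

-- Columns are subsets of the first N rows.  The bound N carries no
-- meaning beyond having room for row k + 1 below; it is independent of
-- the rank n of E.

row : ∀ {N} → Fin N → ℕ
row i = suc (toℕ i)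

Column : ℕ → Set
Column = Subset

Diagram : ℕ → Set
Diagram N = List (Column N)

-- The elements a₁ < a₂ < … < a_r of a column, listed from index 0.

element : ∀ {N} (a : Column N) → Fin ∣ a ∣ → Fin N
element (inside  ∷ a) zero    = zero
element (inside  ∷ a) (suc i) = suc (element a i)
element (outside ∷ a) i       = suc (element a i)

InRows : ∀ {N} → ℕ → Diagram N → Set
InRows n = All λ a → ∀ {i} → i ∈ a → row i ℕ.≤ n

-- For k : Fin m the row k is inject₁ k and the row k + 1 is suc k, both
-- in Fin (suc m); the number of the row k is row k.

module _ {m : ℕ} (k : Fin m) where

  Full : Column (suc m) → Set
  Full a = inject₁ k ∈ a → suc k ∈ a

  -- A column with largest element k is never k-full, so the witness
  -- cannot recur in `left`: it is the leftmost one of its repetitions.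

  record Descent (D : Diagram (suc m)) : Set where
    field
      left      : List (Column (suc m))
      witness   : Column (suc m)
      right     : List (Column (suc m))
      reorder   : D ↭ left ++ witness ∷ right
      member    : inject₁ k ∈ witness
      largest   : ∀ {i} → i ∈ witness → i Fin.≤ inject₁ k
      full      : All Full left
      contained : All (λ a → ∀ {i} → i ∈ a → i Fin.≤ suc k → i ∈ witness) right

  swapRows : Column (suc m) → Column (suc m)
  swapRows a = tabulate λ i → lookup a (transpose (inject₁ k) (suc k) ⟨$⟩ʳ i)

  s : {D : Diagram (suc m)} → Descent D → Diagram (suc m)
  s δ = map swapRows (left ++ (witness - inject₁ k) ∷ right)
    where open Descent δ

------------------------------------------------------------------------
-- Modules over R with a linear action of a group G

module Representations {c ℓ γ ℓγ} (R : CommutativeRing c ℓ) (G : Group γ ℓγ) where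

  private
    module R = CommutativeRing R
    module G = Group G

  record Rep m ℓm : Set (c ⊔ ℓ ⊔ γ ⊔ ℓγ ⊔ lsuc (m ⊔ ℓm)) where
    infixr 7 _•_
    field
      leftModule : LeftModule R.ring m ℓm
    open LeftModule leftModule public
    field
      _•_        : G.Carrier → Carrierᴹ → Carrierᴹ
      •-cong     : ∀ {g h x y} → g G.≈ h → x ≈ᴹ y → g • x ≈ᴹ h • y
      •-identity : ∀ x → G.ε • x ≈ᴹ x
      •-assoc    : ∀ g h x → (g G.∙ h) • x ≈ᴹ g • h • x
      •-+        : ∀ g x y → g • (x +ᴹ y) ≈ᴹ g • x +ᴹ g • y
      •-*ₗ       : ∀ g r x → g • (r *ₗ x) ≈ᴹ r *ₗ (g • x)

    private
      module A = AbelianGroupProperties +ᴹ-abelianGroup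

    •-0 : ∀ g → g • 0ᴹ ≈ᴹ 0ᴹ
    •-0 g = ≈ᴹ-trans (•-cong G.refl (≈ᴹ-sym (*ₗ-zeroˡ 0ᴹ)))
           (≈ᴹ-trans (•-*ₗ g R.0# 0ᴹ) (*ₗ-zeroˡ (g • 0ᴹ)))

    •-neg : ∀ g x → g • (-ᴹ x) ≈ᴹ -ᴹ (g • x)
    •-neg g x = A.inverseˡ-unique (g • (-ᴹ x)) (g • x)
      (≈ᴹ-trans (≈ᴹ-sym (•-+ g (-ᴹ x) x))
      (≈ᴹ-trans (•-cong G.refl (-ᴹ‿inverseˡ x)) (•-0 g)))

  private
    variable
      a b m₁ ℓ₁ m₂ ℓ₂ m₃ ℓ₃ m₄ ℓ₄ : Level

  record RepHom (M : Rep m₁ ℓ₁) (N : Rep m₂ ℓ₂) : Set (c ⊔ γ ⊔ m₁ ⊔ ℓ₁ ⊔ m₂ ⊔ ℓ₂) where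
    private
      module M = Rep M
      module N = Rep N
    field
      to          : M.Carrierᴹ → N.Carrierᴹ
      isHom       : IsLeftModuleHomomorphism M.rawLeftModule N.rawLeftModule to
      equivariant : ∀ g x → to (g M.• x) N.≈ᴹ g N.• to x
    open IsLeftModuleHomomorphism isHom public

  record _≅_ (M : Rep m₁ ℓ₁) (N : Rep m₂ ℓ₂) : Set (c ⊔ γ ⊔ m₁ ⊔ ℓ₁ ⊔ m₂ ⊔ ℓ₂) where
    private
      module M = Rep M
      module N = Rep N
    field
      to          : M.Carrierᴹ → N.Carrierᴹ
      isIso       : IsLeftModuleIsomorphism M.rawLeftModule N.rawLeftModule to
      equivariant : ∀ g x → to (g M.• x) N.≈ᴹ g N.• to x

  module _ (M : Rep m₁ ℓ₁) (N : Rep m₂ ℓ₂) where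

    private
      module M = Rep M
      module N = Rep N
      module A = AbelianGroupProperties N.+ᴹ-abelianGroup

    mkHom : (f : M.Carrierᴹ → N.Carrierᴹ) →
            (∀ {x y} → x M.≈ᴹ y → f x N.≈ᴹ f y) →
            (∀ x y → f (x M.+ᴹ y) N.≈ᴹ f x N.+ᴹ f y) →
            (∀ r x → f (r M.*ₗ x) N.≈ᴹ r N.*ₗ f x) →
            (∀ g x → f (g M.• x) N.≈ᴹ g N.• f x) →
            RepHom M N
    mkHom f f-cong f-+ f-* f-• = record
      { to = f
      ; isHom = record
        { +ᴹ-isGroupHomomorphism = record
          { isMonoidHomomorphism = record
            { isMagmaHomomorphism = record
              { isRelHomomorphism = record { cong = f-cong }
              ; homo = f-+
              }
            ; ε-homo = f-0
            }
          ; ⁻¹-homo = λ x → A.inverseˡ-unique _ _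
              (N.≈ᴹ-trans (N.≈ᴹ-sym (f-+ _ _))
              (N.≈ᴹ-trans (f-cong (M.-ᴹ‿inverseˡ x)) f-0))
          }
        ; *ₗ-homo = f-*
        }
      ; equivariant = f-•
      }
      where
      f-0 : f M.0ᴹ N.≈ᴹ N.0ᴹ
      f-0 = N.≈ᴹ-trans (f-cong (M.≈ᴹ-sym (M.*ₗ-zeroˡ M.0ᴹ)))
           (N.≈ᴹ-trans (f-* R.0# M.0ᴹ) (N.*ₗ-zeroˡ _))

  idHom : {M : Rep m₁ ℓ₁} → RepHom M M
  idHom {M = M} = mkHom M M id id (λ _ _ → ≈ᴹ-refl) (λ _ _ → ≈ᴹ-refl) (λ _ _ → ≈ᴹ-refl)
    where open Rep M

  Kernel : {M : Rep m₁ ℓ₁} {N : Rep m₂ ℓ₂} → RepHom M N → Rep (m₁ ⊔ ℓ₂) ℓ₁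
  Kernel {M = M} {N = N} f = record
    { leftModule = record
      { Carrierᴹ = Σ M.Carrierᴹ λ x → f.to x N.≈ᴹ N.0ᴹ
      ; _≈ᴹ_ = λ x y → proj₁ x M.≈ᴹ proj₁ y
      ; _+ᴹ_ = λ (x , p) (y , q) → x M.+ᴹ y ,
          N.≈ᴹ-trans (f.+ᴹ-homo x y) (N.≈ᴹ-trans (N.+ᴹ-cong p q) (N.+ᴹ-identityˡ _))
      ; _*ₗ_ = λ r (x , p) → r M.*ₗ x ,
          N.≈ᴹ-trans (f.*ₗ-homo r x) (N.≈ᴹ-trans (N.*ₗ-congˡ p) (N.*ₗ-zeroʳ r))
      ; 0ᴹ = M.0ᴹ , f.0ᴹ-homo
      ; -ᴹ_ = λ (x , p) → M.-ᴹ x ,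
          N.≈ᴹ-trans (f.-ᴹ-homo x) (N.≈ᴹ-trans (N.-ᴹ‿cong p) A.ε⁻¹≈ε)
      ; isLeftModule = record
        { isLeftSemimodule = record
          { +ᴹ-isCommutativeMonoid = record
            { isMonoid = record
              { isSemigroup = record
                { isMagma = record
                  { isEquivalence = record { refl = M.≈ᴹ-refl ; sym = M.≈ᴹ-sym ; trans = M.≈ᴹ-trans }
                  ; ∙-cong = M.+ᴹ-cong
                  }
                ; assoc = λ _ _ _ → M.+ᴹ-assoc _ _ _
                }
              ; identity = (λ _ → M.+ᴹ-identityˡ _) , (λ _ → M.+ᴹ-identityʳ _)
              }
            ; comm = λ _ _ → M.+ᴹ-comm _ _
            }
          ; isPreleftSemimodule = record
            { *ₗ-cong = M.*ₗ-cong
            ; *ₗ-zeroˡ = λ _ → M.*ₗ-zeroˡ _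
            ; *ₗ-distribʳ = λ _ _ _ → M.*ₗ-distribʳ _ _ _
            ; *ₗ-identityˡ = λ _ → M.*ₗ-identityˡ _
            ; *ₗ-assoc = λ _ _ _ → M.*ₗ-assoc _ _ _
            ; *ₗ-zeroʳ = λ _ → M.*ₗ-zeroʳ _
            ; *ₗ-distribˡ = λ _ _ _ → M.*ₗ-distribˡ _ _ _
            }
          }
        ; -ᴹ‿cong = M.-ᴹ‿cong
        ; -ᴹ‿inverse = (λ _ → M.-ᴹ‿inverseˡ _) , (λ _ → M.-ᴹ‿inverseʳ _)
        }
      }
    ; _•_ = λ g (x , p) → g M.• x ,
        N.≈ᴹ-trans (f.equivariant g x) (N.≈ᴹ-trans (N.•-cong G.refl p) (N.•-0 g))
    ; •-cong = M.•-cong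
    ; •-identity = λ _ → M.•-identity _
    ; •-assoc = λ g h _ → M.•-assoc g h _
    ; •-+ = λ g _ _ → M.•-+ g _ _
    ; •-*ₗ = λ g r _ → M.•-*ₗ g r _
    }
    where
    module M = Rep M
    module N = Rep N
    module f = RepHom f
    module A = AbelianGroupProperties N.+ᴹ-abelianGroup

  ----------------------------------------------------------------------
  -- The quotient of M by the submodule generated by S

  module _ (M : Rep m₁ ℓ₁) (S : Pred (Rep.Carrierᴹ M) a) where

    private
      module M = Rep M

    infix 4 _≈/_

    data _≈/_ : M.Carrierᴹ → M.Carrierᴹ → Set (c ⊔ ℓ ⊔ m₁ ⊔ ℓ₁ ⊔ a) where
      base   : ∀ {x y} → x M.≈ᴹ y → x ≈/ y
      kill   : ∀ {x} → S x → x ≈/ M.0ᴹ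
      ~sym   : ∀ {x y} → x ≈/ y → y ≈/ x
      ~trans : ∀ {x y z} → x ≈/ y → y ≈/ z → x ≈/ z
      ~+     : ∀ {x x′ y y′} → x ≈/ x′ → y ≈/ y′ → x M.+ᴹ y ≈/ x′ M.+ᴹ y′
      ~-     : ∀ {x y} → x ≈/ y → M.-ᴹ x ≈/ M.-ᴹ y
      ~*     : ∀ r {x y} → x ≈/ y → r M.*ₗ x ≈/ r M.*ₗ y

    Quotient : (∀ g {x} → S x → g M.• x ≈/ M.0ᴹ) → Rep m₁ (c ⊔ ℓ ⊔ m₁ ⊔ ℓ₁ ⊔ a)
    Quotient stable = record
      { leftModule = record
        { _≈ᴹ_ = _≈/_
        ; _+ᴹ_ = M._+ᴹ_
        ; _*ₗ_ = M._*ₗ_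
        ; 0ᴹ = M.0ᴹ
        ; -ᴹ_ = M.-ᴹ_
        ; isLeftModule = record
          { isLeftSemimodule = record
            { +ᴹ-isCommutativeMonoid = record
              { isMonoid = record
                { isSemigroup = record
                  { isMagma = record
                    { isEquivalence = record { refl = base M.≈ᴹ-refl ; sym = ~sym ; trans = ~trans }
                    ; ∙-cong = ~+
                    }
                  ; assoc = λ _ _ _ → base (M.+ᴹ-assoc _ _ _)
                  }
                ; identity = (λ _ → base (M.+ᴹ-identityˡ _)) , (λ _ → base (M.+ᴹ-identityʳ _))
                }
              ; comm = λ _ _ → base (M.+ᴹ-comm _ _)
              }
            ; isPreleftSemimodule = record
              { *ₗ-cong = λ {_} {r} p q → ~trans (base (M.*ₗ-congʳ p)) (~* r q)
              ; *ₗ-zeroˡ = λ _ → base (M.*ₗ-zeroˡ _)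
              ; *ₗ-distribʳ = λ _ _ _ → base (M.*ₗ-distribʳ _ _ _)
              ; *ₗ-identityˡ = λ _ → base (M.*ₗ-identityˡ _)
              ; *ₗ-assoc = λ _ _ _ → base (M.*ₗ-assoc _ _ _)
              ; *ₗ-zeroʳ = λ _ → base (M.*ₗ-zeroʳ _)
              ; *ₗ-distribˡ = λ _ _ _ → base (M.*ₗ-distribˡ _ _ _)
              }
            }
          ; -ᴹ‿cong = ~-
          ; -ᴹ‿inverse = (λ _ → base (M.-ᴹ‿inverseˡ _)) , (λ _ → base (M.-ᴹ‿inverseʳ _))
          }
        }
      ; _•_ = M._•_
      ; •-cong = λ {_} {h} p q → ~trans (base (M.•-cong p M.≈ᴹ-refl)) (act h q)
      ; •-identity = λ _ → base (M.•-identity _)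
      ; •-assoc = λ g h _ → base (M.•-assoc g h _)
      ; •-+ = λ g _ _ → base (M.•-+ g _ _)
      ; •-*ₗ = λ g r _ → base (M.•-*ₗ g r _)
      }
      where
      act : ∀ g {x y} → x ≈/ y → g M.• x ≈/ g M.• y
      act g (base p)     = base (M.•-cong G.refl p)
      act g (kill p)     = ~trans (stable g p) (base (M.≈ᴹ-sym (M.•-0 g)))
      act g (~sym p)     = ~sym (act g p)
      act g (~trans p q) = ~trans (act g p) (act g q)
      act g (~+ p q)     = ~trans (base (M.•-+ g _ _)) (~trans (~+ (act g p) (act g q)) (base (M.≈ᴹ-sym (M.•-+ g _ _))))
      act g (~- p)       = ~trans (base (M.•-neg g _)) (~trans (~- (act g p)) (base (M.≈ᴹ-sym (M.•-neg g _))))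
      act g (~* r p)     = ~trans (base (M.•-*ₗ g r _)) (~trans (~* r (act g p)) (base (M.≈ᴹ-sym (M.•-*ₗ g r _))))

  module _ {M : Rep m₁ ℓ₁} {N : Rep m₂ ℓ₂} {S : Pred (Rep.Carrierᴹ M) a} {T : Pred (Rep.Carrierᴹ N) b}
           {stableS : ∀ g {x} → S x → _≈/_ M S (Rep._•_ M g x) (Rep.0ᴹ M)}
           {stableT : ∀ g {y} → T y → _≈/_ N T (Rep._•_ N g y) (Rep.0ᴹ N)}
           (f : RepHom M N) where

    private
      module N = Rep N
      module f = RepHom f

    quotientMap : (∀ {x} → S x → _≈/_ N T (f.to x) N.0ᴹ) →
                  RepHom (Quotient M S stableS) (Quotient N T stableT)
    quotientMap S⇒T = mkHom _ _ f.to respects (λ x y → base (f.+ᴹ-homo x y))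
                        (λ r x → base (f.*ₗ-homo r x)) (λ g x → base (f.equivariant g x))
      where
      respects : ∀ {x y} → _≈/_ M S x y → _≈/_ N T (f.to x) (f.to y)
      respects (base p)     = base (f.⟦⟧-cong p)
      respects (kill p)     = ~trans (S⇒T p) (base (N.≈ᴹ-sym f.0ᴹ-homo))
      respects (~sym p)     = ~sym (respects p)
      respects (~trans p q) = ~trans (respects p) (respects q)
      respects (~+ p q)     = ~trans (base (f.+ᴹ-homo _ _)) (~trans (~+ (respects p) (respects q)) (base (N.≈ᴹ-sym (f.+ᴹ-homo _ _))))
      respects (~- p)       = ~trans (base (f.-ᴹ-homo _)) (~trans (~- (respects p)) (base (N.≈ᴹ-sym (f.-ᴹ-homo _))))
      respects (~* r p)     = ~trans (base (f.*ₗ-homo r _)) (~trans (~* r (respects p)) (base (N.≈ᴹ-sym (f.*ₗ-homo r _))))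

  quotientHom : {M : Rep m₁ ℓ₁} {S : Pred (Rep.Carrierᴹ M) a} {stable : _} →
                RepHom M (Quotient M S stable)
  quotientHom {M = M} = mkHom _ _ id base (λ _ _ → base ≈ᴹ-refl) (λ _ _ → base ≈ᴹ-refl) (λ _ _ → base ≈ᴹ-refl)
    where open Rep M

  ----------------------------------------------------------------------
  -- Modules given by generators and relations

  data Term (X : Set a) : Set (c ⊔ a) where
    gen     : X → Term X
    𝟘       : Term X
    _⊞_     : Term X → Term X → Term X
    ⊟_      : Term X → Term X
    _⊡_     : R.Carrier → Term X → Term X

  mapTerm : {X : Set a} {Y : Set b} → (X → Y) → Term X → Term Y
  mapTerm f (gen x) = gen (f x)
  mapTerm f 𝟘       = 𝟘
  mapTerm f (t ⊞ u) = mapTerm f t ⊞ mapTerm f u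
  mapTerm f (⊟ t)   = ⊟ mapTerm f t
  mapTerm f (r ⊡ t) = r ⊡ mapTerm f t

  module _ {X : Set a} (_≐_ : Term X → Term X → Set b) where

    infix 4 _≈ᵀ_

    data _≈ᵀ_ : Term X → Term X → Set (c ⊔ ℓ ⊔ a ⊔ b) where
      rel        : ∀ {t u} → t ≐ u → t ≈ᵀ u
      refl       : ∀ {t} → t ≈ᵀ t
      sym        : ∀ {t u} → t ≈ᵀ u → u ≈ᵀ t
      trans      : ∀ {t u v} → t ≈ᵀ u → u ≈ᵀ v → t ≈ᵀ v
      ⊞-cong     : ∀ {t t′ u u′} → t ≈ᵀ t′ → u ≈ᵀ u′ → t ⊞ u ≈ᵀ t′ ⊞ u′
      ⊟-cong     : ∀ {t u} → t ≈ᵀ u → ⊟ t ≈ᵀ ⊟ u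
      ⊡-cong     : ∀ {r r′ t t′} → r R.≈ r′ → t ≈ᵀ t′ → r ⊡ t ≈ᵀ r′ ⊡ t′
      ⊞-assoc    : ∀ t u v → (t ⊞ u) ⊞ v ≈ᵀ t ⊞ (u ⊞ v)
      ⊞-comm     : ∀ t u → t ⊞ u ≈ᵀ u ⊞ t
      ⊞-identity : ∀ t → 𝟘 ⊞ t ≈ᵀ t
      ⊞-inverse  : ∀ t → (⊟ t) ⊞ t ≈ᵀ 𝟘
      ⊡-distribˡ : ∀ r t u → r ⊡ (t ⊞ u) ≈ᵀ (r ⊡ t) ⊞ (r ⊡ u)
      ⊡-distribʳ : ∀ t r q → (r R.+ q) ⊡ t ≈ᵀ (r ⊡ t) ⊞ (q ⊡ t)
      ⊡-assoc    : ∀ r q t → (r R.* q) ⊡ t ≈ᵀ r ⊡ (q ⊡ t)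
      ⊡-identity : ∀ t → R.1# ⊡ t ≈ᵀ t
      ⊡-zeroˡ    : ∀ t → R.0# ⊡ t ≈ᵀ 𝟘
      ⊡-zeroʳ    : ∀ r → r ⊡ 𝟘 ≈ᵀ 𝟘

    Presented : (act : G.Carrier → X → X) →
                (∀ g {t u} → t ≐ u → mapTerm (act g) t ≈ᵀ mapTerm (act g) u) →
                (∀ {g h} → g G.≈ h → ∀ x → gen (act g x) ≈ᵀ gen (act h x)) →
                (∀ x → gen (act G.ε x) ≈ᵀ gen x) →
                (∀ g h x → gen (act (g G.∙ h) x) ≈ᵀ gen (act g (act h x))) →
                Rep (c ⊔ a) (c ⊔ ℓ ⊔ a ⊔ b)
    Presented act act-rel act-cong act-ε act-∙ = record
      { leftModule = record
        { _≈ᴹ_ = _≈ᵀ_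
        ; _+ᴹ_ = _⊞_
        ; _*ₗ_ = _⊡_
        ; 0ᴹ = 𝟘
        ; -ᴹ_ = ⊟_
        ; isLeftModule = record
          { isLeftSemimodule = record
            { +ᴹ-isCommutativeMonoid = record
              { isMonoid = record
                { isSemigroup = record
                  { isMagma = record
                    { isEquivalence = record { refl = refl ; sym = sym ; trans = trans }
                    ; ∙-cong = ⊞-cong
                    }
                  ; assoc = ⊞-assoc
                  }
                ; identity = ⊞-identity , (λ t → trans (⊞-comm t 𝟘) (⊞-identity t))
                }
              ; comm = ⊞-comm
              }
            ; isPreleftSemimodule = record
              { *ₗ-cong = ⊡-cong
              ; *ₗ-zeroˡ = ⊡-zeroˡ
              ; *ₗ-distribʳ = ⊡-distribʳ
              ; *ₗ-identityˡ = ⊡-identity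
              ; *ₗ-assoc = ⊡-assoc
              ; *ₗ-zeroʳ = ⊡-zeroʳ
              ; *ₗ-distribˡ = ⊡-distribˡ
              }
            }
          ; -ᴹ‿cong = ⊟-cong
          ; -ᴹ‿inverse = ⊞-inverse , (λ t → trans (⊞-comm t (⊟ t)) (⊞-inverse t))
          }
        }
      ; _•_ = λ g → mapTerm (act g)
      ; •-cong = λ {_} {h} {x} p q → trans (pointwise x (act-cong p)) (act-≈ h q)
      ; •-identity = identity
      ; •-assoc = composite
      ; •-+ = λ _ _ _ → refl
      ; •-*ₗ = λ _ _ _ → refl
      }
      where
      pointwise : ∀ {f f′ : X → X} t → (∀ x → gen (f x) ≈ᵀ gen (f′ x)) → mapTerm f t ≈ᵀ mapTerm f′ t
      pointwise (gen x) p = p x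
      pointwise 𝟘       p = refl
      pointwise (t ⊞ u) p = ⊞-cong (pointwise t p) (pointwise u p)
      pointwise (⊟ t)   p = ⊟-cong (pointwise t p)
      pointwise (r ⊡ t) p = ⊡-cong R.refl (pointwise t p)

      identity : ∀ t → mapTerm (act G.ε) t ≈ᵀ t
      identity (gen x) = act-ε x
      identity 𝟘       = refl
      identity (t ⊞ u) = ⊞-cong (identity t) (identity u)
      identity (⊟ t)   = ⊟-cong (identity t)
      identity (r ⊡ t) = ⊡-cong R.refl (identity t)

      composite : ∀ g h t → mapTerm (act (g G.∙ h)) t ≈ᵀ mapTerm (act g) (mapTerm (act h) t)
      composite g h (gen x) = act-∙ g h x
      composite g h 𝟘       = refl
      composite g h (t ⊞ u) = ⊞-cong (composite g h t) (composite g h u)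
      composite g h (⊟ t)   = ⊟-cong (composite g h t)
      composite g h (r ⊡ t) = ⊡-cong R.refl (composite g h t)

      act-≈ : ∀ g {t u} → t ≈ᵀ u → mapTerm (act g) t ≈ᵀ mapTerm (act g) u
      act-≈ g (rel p)            = act-rel g p
      act-≈ g refl               = refl
      act-≈ g (sym p)            = sym (act-≈ g p)
      act-≈ g (trans p q)        = trans (act-≈ g p) (act-≈ g q)
      act-≈ g (⊞-cong p q)       = ⊞-cong (act-≈ g p) (act-≈ g q)
      act-≈ g (⊟-cong p)         = ⊟-cong (act-≈ g p)
      act-≈ g (⊡-cong p q)       = ⊡-cong p (act-≈ g q)
      act-≈ g (⊞-assoc t u v)    = ⊞-assoc _ _ _
      act-≈ g (⊞-comm t u)       = ⊞-comm _ _
      act-≈ g (⊞-identity t)     = ⊞-identity _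
      act-≈ g (⊞-inverse t)      = ⊞-inverse _
      act-≈ g (⊡-distribˡ r t u) = ⊡-distribˡ _ _ _
      act-≈ g (⊡-distribʳ t r q) = ⊡-distribʳ _ _ _
      act-≈ g (⊡-assoc r q t)    = ⊡-assoc _ _ _
      act-≈ g (⊡-identity t)     = ⊡-identity _
      act-≈ g (⊡-zeroˡ t)        = ⊡-zeroˡ _
      act-≈ g (⊡-zeroʳ r)        = ⊡-zeroʳ _

  -- The trivial representation, as the free module on one generator.

  NoRelation : Term ⊤ → Term ⊤ → Set
  NoRelation _ _ = ⊥

  𝟙 : Rep c (c ⊔ ℓ)
  𝟙 = Presented NoRelation (λ _ → id) (λ _ ()) (λ _ _ → refl) (λ _ → refl) (λ _ _ _ → refl)

  module _ (M : Rep m₁ ℓ₁) (N : Rep m₂ ℓ₂) where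

    private
      module M = Rep M
      module N = Rep N

    data Bilinear : Term (M.Carrierᴹ × N.Carrierᴹ) → Term (M.Carrierᴹ × N.Carrierᴹ) →
                    Set (c ⊔ m₁ ⊔ ℓ₁ ⊔ m₂ ⊔ ℓ₂) where
      ⊗-cong : ∀ {x x′ y y′} → x M.≈ᴹ x′ → y N.≈ᴹ y′ → Bilinear (gen (x , y)) (gen (x′ , y′))
      ⊗-+ˡ   : ∀ x x′ y → Bilinear (gen (x M.+ᴹ x′ , y)) (gen (x , y) ⊞ gen (x′ , y))
      ⊗-+ʳ   : ∀ x y y′ → Bilinear (gen (x , y N.+ᴹ y′)) (gen (x , y) ⊞ gen (x , y′))
      ⊗-*ˡ   : ∀ r x y → Bilinear (gen (r M.*ₗ x , y)) (r ⊡ gen (x , y))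
      ⊗-*ʳ   : ∀ r x y → Bilinear (gen (x , r N.*ₗ y)) (r ⊡ gen (x , y))

    infixr 7 _⊗_

    _⊗_ : Rep (c ⊔ m₁ ⊔ m₂) (c ⊔ ℓ ⊔ m₁ ⊔ ℓ₁ ⊔ m₂ ⊔ ℓ₂)
    _⊗_ = Presented Bilinear (λ g (x , y) → g M.• x , g N.• y) stable
      (λ g≈h _ → rel (⊗-cong (M.•-cong g≈h M.≈ᴹ-refl) (N.•-cong g≈h N.≈ᴹ-refl)))
      (λ _ → rel (⊗-cong (M.•-identity _) (N.•-identity _)))
      (λ g h _ → rel (⊗-cong (M.•-assoc g h _) (N.•-assoc g h _)))
      where
      stable : ∀ g {t u} → Bilinear t u → _≈ᵀ_ Bilinear (mapTerm _ t) (mapTerm _ u)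
      stable g (⊗-cong p q)    = rel (⊗-cong (M.•-cong G.refl p) (N.•-cong G.refl q))
      stable g (⊗-+ˡ x x′ y)   = trans (rel (⊗-cong (M.•-+ g x x′) N.≈ᴹ-refl)) (rel (⊗-+ˡ _ _ _))
      stable g (⊗-+ʳ x y y′)   = trans (rel (⊗-cong M.≈ᴹ-refl (N.•-+ g y y′))) (rel (⊗-+ʳ _ _ _))
      stable g (⊗-*ˡ r x y)    = trans (rel (⊗-cong (M.•-*ₗ g r x) N.≈ᴹ-refl)) (rel (⊗-*ˡ _ _ _))
      stable g (⊗-*ʳ r x y)    = trans (rel (⊗-cong M.≈ᴹ-refl (N.•-*ₗ g r y))) (rel (⊗-*ʳ _ _ _))

  module _ {M : Rep m₁ ℓ₁} {M′ : Rep m₂ ℓ₂} {N : Rep m₃ ℓ₃} {N′ : Rep m₄ ℓ₄} where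

    private
      module M = Rep M
      module M′ = Rep M′
      module N = Rep N
      module N′ = Rep N′

    _⊗ᴴ_ : RepHom M M′ → RepHom N N′ → RepHom (M ⊗ N) (M′ ⊗ N′)
    f ⊗ᴴ h = mkHom (M ⊗ N) (M′ ⊗ N′) (mapTerm f⊗h) respects (λ _ _ → refl) (λ _ _ → refl) equiv
      where
      module f = RepHom f
      module h = RepHom h
      f⊗h : M.Carrierᴹ × N.Carrierᴹ → M′.Carrierᴹ × N′.Carrierᴹ
      f⊗h (x , y) = f.to x , h.to y

      respects : ∀ {t u} → Rep._≈ᴹ_ (M ⊗ N) t u → Rep._≈ᴹ_ (M′ ⊗ N′) (mapTerm f⊗h t) (mapTerm f⊗h u)
      respects (rel (⊗-cong p q))  = rel (⊗-cong (f.⟦⟧-cong p) (h.⟦⟧-cong q))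
      respects (rel (⊗-+ˡ x x′ y)) = trans (rel (⊗-cong (f.+ᴹ-homo x x′) N′.≈ᴹ-refl)) (rel (⊗-+ˡ _ _ _))
      respects (rel (⊗-+ʳ x y y′)) = trans (rel (⊗-cong M′.≈ᴹ-refl (h.+ᴹ-homo y y′))) (rel (⊗-+ʳ _ _ _))
      respects (rel (⊗-*ˡ r x y))  = trans (rel (⊗-cong (f.*ₗ-homo r x) N′.≈ᴹ-refl)) (rel (⊗-*ˡ _ _ _))
      respects (rel (⊗-*ʳ r x y))  = trans (rel (⊗-cong M′.≈ᴹ-refl (h.*ₗ-homo r y))) (rel (⊗-*ʳ _ _ _))
      respects refl               = refl
      respects (sym p)            = sym (respects p)
      respects (trans p q)        = trans (respects p) (respects q)
      respects (⊞-cong p q)       = ⊞-cong (respects p) (respects q)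
      respects (⊟-cong p)         = ⊟-cong (respects p)
      respects (⊡-cong p q)       = ⊡-cong p (respects q)
      respects (⊞-assoc t u v)    = ⊞-assoc _ _ _
      respects (⊞-comm t u)       = ⊞-comm _ _
      respects (⊞-identity t)     = ⊞-identity _
      respects (⊞-inverse t)      = ⊞-inverse _
      respects (⊡-distribˡ r t u) = ⊡-distribˡ _ _ _
      respects (⊡-distribʳ t r q) = ⊡-distribʳ _ _ _
      respects (⊡-assoc r q t)    = ⊡-assoc _ _ _
      respects (⊡-identity t)     = ⊡-identity _
      respects (⊡-zeroˡ t)        = ⊡-zeroˡ _
      respects (⊡-zeroʳ r)        = ⊡-zeroʳ _

      equiv : ∀ g t → Rep._≈ᴹ_ (M′ ⊗ N′) (mapTerm f⊗h (Rep._•_ (M ⊗ N) g t)) (Rep._•_ (M′ ⊗ N′) g (mapTerm f⊗h t))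
      equiv g (gen _) = rel (⊗-cong (f.equivariant g _) (h.equivariant g _))
      equiv g 𝟘       = refl
      equiv g (t ⊞ u) = ⊞-cong (equiv g t) (equiv g u)
      equiv g (⊟ t)   = ⊟-cong (equiv g t)
      equiv g (r ⊡ t) = ⊡-cong R.refl (equiv g t)

  -- ⋀ r M is generated by the symbols gen v = v₁ ∧ ⋯ ∧ v_r.

  module _ (r : ℕ) (M : Rep m₁ ℓ₁) where

    private
      module M = Rep M

    data Alternating : Term (Fin r → M.Carrierᴹ) → Term (Fin r → M.Carrierᴹ) → Set (c ⊔ m₁ ⊔ ℓ₁) where
      ∧-cong : ∀ {v w} → (∀ i → v i M.≈ᴹ w i) → Alternating (gen v) (gen w)
      ∧-+    : ∀ i {u v w} → w i M.≈ᴹ u i M.+ᴹ v i →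
               (∀ j → j ≢ i → u j M.≈ᴹ w j) → (∀ j → j ≢ i → v j M.≈ᴹ w j) →
               Alternating (gen w) (gen u ⊞ gen v)
      ∧-*    : ∀ q i {v w} → w i M.≈ᴹ q M.*ₗ v i → (∀ j → j ≢ i → v j M.≈ᴹ w j) →
               Alternating (gen w) (q ⊡ gen v)
      ∧-alt  : ∀ i j {v} → i ≢ j → v i M.≈ᴹ v j → Alternating (gen v) 𝟘

    ⋀ : Rep (c ⊔ m₁) (c ⊔ ℓ ⊔ m₁ ⊔ ℓ₁)
    ⋀ = Presented Alternating (λ g v i → g M.• v i) stable
      (λ g≈h _ → rel (∧-cong λ _ → M.•-cong g≈h M.≈ᴹ-refl))
      (λ _ → rel (∧-cong λ _ → M.•-identity _))
      (λ g h _ → rel (∧-cong λ _ → M.•-assoc g h _))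
      where
      stable : ∀ g {t u} → Alternating t u → _≈ᵀ_ Alternating (mapTerm _ t) (mapTerm _ u)
      stable g (∧-cong p)      = rel (∧-cong λ i → M.•-cong G.refl (p i))
      stable g (∧-+ i p p₁ p₂) = rel (∧-+ i (M.≈ᴹ-trans (M.•-cong G.refl p) (M.•-+ g _ _))
                                   (λ j j≢i → M.•-cong G.refl (p₁ j j≢i)) (λ j j≢i → M.•-cong G.refl (p₂ j j≢i)))
      stable g (∧-* q i p p₁)  = rel (∧-* q i (M.≈ᴹ-trans (M.•-cong G.refl p) (M.•-*ₗ g q _))
                                   (λ j j≢i → M.•-cong G.refl (p₁ j j≢i)))
      stable g (∧-alt i j i≢j p) = rel (∧-alt i j i≢j (M.•-cong G.refl p))

------------------------------------------------------------------------
-- Polynomial rings and determinants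

module Polynomials {c ℓ} (R : CommutativeRing c ℓ) where

  private
    module R = CommutativeRing R

  data Poly (V : Set) : Set c where
    con : R.Carrier → Poly V
    var : V → Poly V
    _⊕_ : Poly V → Poly V → Poly V
    _⊛_ : Poly V → Poly V → Poly V
    ⊝_  : Poly V → Poly V

  infixl 6 _⊕_
  infixl 7 _⊛_

  -- The free commutative R-algebra on V, modulo the variables in Z: the
  -- ring k[V] in which the variables in Z are set to 0.

  module _ {V : Set} {z} (Z : Pred V z) where

    infix 4 _≈ᴾ_

    data _≈ᴾ_ : Poly V → Poly V → Set (c ⊔ ℓ ⊔ z) where
      vanish     : ∀ {x} → Z x → var x ≈ᴾ con R.0#
      refl       : ∀ {f} → f ≈ᴾ f
      sym        : ∀ {f g} → f ≈ᴾ g → g ≈ᴾ f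
      trans      : ∀ {f g h} → f ≈ᴾ g → g ≈ᴾ h → f ≈ᴾ h
      ⊕-cong     : ∀ {f f′ g g′} → f ≈ᴾ f′ → g ≈ᴾ g′ → f ⊕ g ≈ᴾ f′ ⊕ g′
      ⊛-cong     : ∀ {f f′ g g′} → f ≈ᴾ f′ → g ≈ᴾ g′ → f ⊛ g ≈ᴾ f′ ⊛ g′
      ⊝-cong     : ∀ {f g} → f ≈ᴾ g → ⊝ f ≈ᴾ ⊝ g
      ⊕-assoc    : ∀ f g h → (f ⊕ g) ⊕ h ≈ᴾ f ⊕ (g ⊕ h)
      ⊕-comm     : ∀ f g → f ⊕ g ≈ᴾ g ⊕ f
      ⊕-identity : ∀ f → con R.0# ⊕ f ≈ᴾ f
      ⊕-inverse  : ∀ f → (⊝ f) ⊕ f ≈ᴾ con R.0#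
      ⊛-assoc    : ∀ f g h → (f ⊛ g) ⊛ h ≈ᴾ f ⊛ (g ⊛ h)
      ⊛-comm     : ∀ f g → f ⊛ g ≈ᴾ g ⊛ f
      ⊛-identity : ∀ f → con R.1# ⊛ f ≈ᴾ f
      distrib    : ∀ f g h → f ⊛ (g ⊕ h) ≈ᴾ (f ⊛ g) ⊕ (f ⊛ h)
      con-cong   : ∀ {r q} → r R.≈ q → con r ≈ᴾ con q
      con-+      : ∀ r q → con (r R.+ q) ≈ᴾ con r ⊕ con q
      con-*      : ∀ r q → con (r R.* q) ≈ᴾ con r ⊛ con q

    polynomialRing : CommutativeRing c (c ⊔ ℓ ⊔ z)
    polynomialRing = record
      { Carrier = Poly V
      ; _≈_ = _≈ᴾ_
      ; _+_ = _⊕_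
      ; _*_ = _⊛_
      ; -_ = ⊝_
      ; 0# = con R.0#
      ; 1# = con R.1#
      ; isCommutativeRing = record
        { isRing = record
          { +-isAbelianGroup = record
            { isGroup = record
              { isMonoid = record
                { isSemigroup = record
                  { isMagma = record
                    { isEquivalence = record { refl = refl ; sym = sym ; trans = trans }
                    ; ∙-cong = ⊕-cong
                    }
                  ; assoc = ⊕-assoc
                  }
                ; identity = ⊕-identity , (λ f → trans (⊕-comm f _) (⊕-identity f))
                }
              ; inverse = ⊕-inverse , (λ f → trans (⊕-comm f _) (⊕-inverse f))
              ; ⁻¹-cong = ⊝-cong
              }
            ; comm = ⊕-comm
            }
          ; *-cong = ⊛-cong
          ; *-assoc = ⊛-assoc
          ; *-identity = ⊛-identity , (λ f → trans (⊛-comm f _) (⊛-identity f))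
          ; distrib = distrib , (λ f g h → trans (⊛-comm _ f) (trans (distrib f g h) (⊕-cong (⊛-comm f g) (⊛-comm f h))))
          }
        ; *-comm = ⊛-comm
        }
      }

  substitute : ∀ {V W : Set} → (V → Poly W) → Poly V → Poly W
  substitute σ (con r) = con r
  substitute σ (var x) = σ x
  substitute σ (f ⊕ g) = substitute σ f ⊕ substitute σ g
  substitute σ (f ⊛ g) = substitute σ f ⊛ substitute σ g
  substitute σ (⊝ f)   = ⊝ substitute σ f

  substitute-cong : ∀ {V W : Set} {y z} {Y : Pred V y} {Z : Pred W z} (σ : V → Poly W) →
                    (∀ {x} → Y x → _≈ᴾ_ Z (σ x) (con R.0#)) →
                    ∀ {f g} → _≈ᴾ_ Y f g → _≈ᴾ_ Z (substitute σ f) (substitute σ g)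
  substitute-cong {Y = Y} {Z} σ kills = go
    where
    go : ∀ {f g} → _≈ᴾ_ Y f g → _≈ᴾ_ Z (substitute σ f) (substitute σ g)
    go (vanish p)      = kills p
    go refl            = refl
    go (sym p)         = sym (go p)
    go (trans p q)     = trans (go p) (go q)
    go (⊕-cong p q)    = ⊕-cong (go p) (go q)
    go (⊛-cong p q)    = ⊛-cong (go p) (go q)
    go (⊝-cong p)      = ⊝-cong (go p)
    go (⊕-assoc _ _ _) = ⊕-assoc _ _ _
    go (⊕-comm _ _)    = ⊕-comm _ _
    go (⊕-identity _)  = ⊕-identity _
    go (⊕-inverse _)   = ⊕-inverse _
    go (⊛-assoc _ _ _) = ⊛-assoc _ _ _
    go (⊛-comm _ _)    = ⊛-comm _ _
    go (⊛-identity _)  = ⊛-identity _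
    go (distrib _ _ _) = distrib _ _ _
    go (con-cong p)    = con-cong p
    go (con-+ _ _)     = con-+ _ _
    go (con-* _ _)     = con-* _ _

  Σᴾ : ∀ {V : Set} {n} → (Fin n → Poly V) → Poly V
  Σᴾ = Vector.foldr _⊕_ (con R.0#)

  signed : ∀ {V : Set} → ℕ → Poly V → Poly V
  signed zero    f = f
  signed (suc i) f = ⊝ signed i f

  -- Laplace expansion along the first row.

  det : ∀ {V : Set} {r} → (Fin r → Fin r → Poly V) → Poly V
  det {r = zero}  A = con R.1#
  det {r = suc r} A = Σᴾ λ j → signed (toℕ j) (A zero j ⊛ det λ i j′ → A (suc i) (punchIn j j′))

------------------------------------------------------------------------
-- Flagged Schur modules

module FlaggedSchur {c ℓ} (R : CommutativeRing c ℓ) (n : ℕ) where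

  private
    module R = CommutativeRing R
  open SemiringSum R.semiring using (sum; sum-cong-≋; ∑-comm; *-distribˡ-sum; *-distribʳ-sum; ∑-distrib-+)
  open Polynomials R

  ----------------------------------------------------------------------
  -- The group B

  Matrix : Set c
  Matrix = Fin n → Fin n → R.Carrier

  δ : Matrix
  δ i j with i Fin.≟ j
  ... | yes _ = R.1#
  ... | no  _ = R.0#

  infixl 7 _·_
  _·_ : Matrix → Matrix → Matrix
  (A · B) i j = sum λ l → A i l R.* B l j

  infix 4 _≋_
  _≋_ : Matrix → Matrix → Set ℓ
  A ≋ B = ∀ i j → A i j R.≈ B i j

  -- Column j of the matrix of g is g z_j.

  record Borel : Set (c ⊔ ℓ) where
    field
      matrix   : Matrix
      inverse  : Matrix
      inverseˡ : inverse · matrix ≋ δ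
      inverseʳ : matrix · inverse ≋ δ
      lower    : ∀ {i j} → i Fin.< j → matrix i j R.≈ R.0#

  private
    sum-zero : ∀ {m} {f : Fin m → R.Carrier} → (∀ l → f l R.≈ R.0#) → sum f R.≈ R.0#
    sum-zero {zero}  p = R.refl
    sum-zero {suc m} p = R.trans (R.+-cong (p zero) (sum-zero (p ∘ suc))) (R.+-identityˡ _)

    sum-single : ∀ {m} {f : Fin m → R.Carrier} i → (∀ l → l ≢ i → f l R.≈ R.0#) → sum f R.≈ f i
    sum-single zero    p = R.trans (R.+-congˡ (sum-zero λ l → p (suc l) λ ())) (R.+-identityʳ _)
    sum-single (suc i) p = R.trans (R.+-cong (p zero λ ()) (sum-single i λ l l≢i → p (suc l) (l≢i ∘ Fin.suc-injective)))
                                   (R.+-identityˡ _)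

    δ-diag : ∀ i → δ i i R.≈ R.1#
    δ-diag i with i Fin.≟ i
    ... | yes _   = R.refl
    ... | no  i≢i = contradiction ≡.refl i≢i

    δ-off : ∀ {i j} → i ≢ j → δ i j R.≈ R.0#
    δ-off {i} {j} i≢j with i Fin.≟ j
    ... | yes i≡j = contradiction i≡j i≢j
    ... | no  _   = R.refl

    sum-δˡ : ∀ i (f : Fin n → R.Carrier) → sum (λ l → δ i l R.* f l) R.≈ f i
    sum-δˡ i f = R.trans (sum-single i λ l l≢i → R.trans (R.*-congʳ (δ-off (l≢i ∘ ≡.sym))) (R.zeroˡ _))
                         (R.trans (R.*-congʳ (δ-diag i)) (R.*-identityˡ _))

    sum-δʳ : ∀ j (f : Fin n → R.Carrier) → sum (λ l → f l R.* δ l j) R.≈ f j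
    sum-δʳ j f = R.trans (sum-single j λ l l≢j → R.trans (R.*-congˡ (δ-off l≢j)) (R.zeroʳ _))
                         (R.trans (R.*-congˡ (δ-diag j)) (R.*-identityʳ _))

    sum-assoc : ∀ (f : Fin n → R.Carrier) (A : Matrix) (h : Fin n → R.Carrier) →
                sum (λ l → sum (λ p → f p R.* A p l) R.* h l) R.≈ sum (λ p → f p R.* sum (λ l → A p l R.* h l))
    sum-assoc f A h = begin
      sum (λ l → sum (λ p → f p R.* A p l) R.* h l)    ≈⟨ sum-cong-≋ (λ l → *-distribʳ-sum (h l) (λ p → f p R.* A p l)) ⟩
      sum (λ l → sum (λ p → f p R.* A p l R.* h l))    ≈⟨ ∑-comm (λ l p → f p R.* A p l R.* h l) ⟩
      sum (λ p → sum (λ l → f p R.* A p l R.* h l))    ≈⟨ sum-cong-≋ (λ p → sum-cong-≋ λ l → R.*-assoc (f p) (A p l) (h l)) ⟩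
      sum (λ p → sum (λ l → f p R.* (A p l R.* h l)))  ≈⟨ sum-cong-≋ (λ p → *-distribˡ-sum (f p) (λ l → A p l R.* h l)) ⟨
      sum (λ p → f p R.* sum (λ l → A p l R.* h l))    ∎
      where open ≈-Reasoning R.setoid

    ·-assoc : ∀ A B C → (A · B) · C ≋ A · (B · C)
    ·-assoc A B C i j = sum-assoc (A i) B (λ l → C l j)

    ·-cong : ∀ {A A′ B B′} → A ≋ A′ → B ≋ B′ → A · B ≋ A′ · B′
    ·-cong p q i j = sum-cong-≋ λ l → R.*-cong (p i l) (q l j)

    ·-identityˡ : ∀ A → δ · A ≋ A
    ·-identityˡ A i j = sum-δˡ i (λ l → A l j)

    ·-identityʳ : ∀ A → A · δ ≋ A
    ·-identityʳ A i j = sum-δʳ j (A i)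

    ·-lower : ∀ {A B} → (∀ {i j} → i Fin.< j → A i j R.≈ R.0#) → (∀ {i j} → i Fin.< j → B i j R.≈ R.0#) →
              ∀ {i j} → i Fin.< j → (A · B) i j R.≈ R.0#
    ·-lower {A} {B} p q {i} {j} i<j = sum-zero zeros
      where
      zeros : ∀ l → A i l R.* B l j R.≈ R.0#
      zeros l with i Fin.<? l
      ... | yes i<l = R.trans (R.*-congʳ (p i<l)) (R.zeroˡ _)
      ... | no  i≮l = R.trans (R.*-congˡ (q (ℕ.≤-<-trans (ℕ.≮⇒≥ i≮l) i<j))) (R.zeroʳ _)

    ≋-trans : ∀ {A B C : Matrix} → A ≋ B → B ≋ C → A ≋ C
    ≋-trans p q i j = R.trans (p i j) (q i j)

    cancel : ∀ A B C D → A · B ≋ δ → C · D ≋ δ → (C · A) · (B · D) ≋ δ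
    cancel A B C D p q =
      ≋-trans (·-assoc C A (B · D))
      (≋-trans (·-cong {A = C} (λ _ _ → R.refl)
                 (≋-trans (λ i j → R.sym (·-assoc A B D i j))
                 (≋-trans (·-cong {B = D} p (λ _ _ → R.refl)) (·-identityˡ D))))
               q)

    inverse-lower : ∀ A B → A · B ≋ δ → (∀ {i j} → i Fin.< j → A i j R.≈ R.0#) →
                    ∀ {i j} → i Fin.< j → B i j R.≈ R.0#
    inverse-lower A B AB≋δ lower {i} = go i (<-wellFounded (toℕ i))
      where
      go : ∀ i → Acc ℕ._<_ (toℕ i) → ∀ {j} → i Fin.< j → B i j R.≈ R.0#
      go i (acc rs) {j} i<j = begin
        B i j                          ≈⟨ R.*-identityˡ _ ⟨
        R.1# R.* B i j                 ≈⟨ R.*-congʳ (R.trans (diagonal ℕ.≤-refl) (δ-diag i)) ⟨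
        A i i R.* B i i R.* B i j      ≈⟨ R.*-congʳ (R.*-comm _ _) ⟩
        B i i R.* A i i R.* B i j      ≈⟨ R.*-assoc _ _ _ ⟩
        B i i R.* (A i i R.* B i j)    ≈⟨ R.*-congˡ (R.trans (diagonal (ℕ.<⇒≤ i<j)) (δ-off {i} {j} λ { ≡.refl → ℕ.<-irrefl ≡.refl i<j })) ⟩
        B i i R.* R.0#                 ≈⟨ R.zeroʳ _ ⟩
        R.0#                           ∎
        where
        open ≈-Reasoning R.setoid
        zeros : ∀ {j} → i Fin.≤ j → ∀ l → l ≢ i → A i l R.* B l j R.≈ R.0#
        zeros i≤j l l≢i with i Fin.<? l
        ... | yes i<l = R.trans (R.*-congʳ (lower i<l)) (R.zeroˡ _)
        ... | no  i≮l = R.trans (R.*-congˡ (go l (rs l<i) (ℕ.<-≤-trans l<i i≤j))) (R.zeroʳ _)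
          where l<i = ℕ.≤∧≢⇒< (ℕ.≮⇒≥ i≮l) (l≢i ∘ Fin.toℕ-injective)
        diagonal : ∀ {j} → i Fin.≤ j → A i i R.* B i j R.≈ δ i j
        diagonal {j} i≤j = R.trans (R.sym (sum-single i (zeros i≤j))) (AB≋δ i j)

  𝔹 : Group (c ⊔ ℓ) ℓ
  𝔹 = record
    { Carrier = Borel
    ; _≈_ = λ g h → matrix g ≋ matrix h
    ; _∙_ = λ g h → record
      { matrix = matrix g · matrix h
      ; inverse = inverse h · inverse g
      ; inverseˡ = cancel (inverse g) (matrix g) (inverse h) (matrix h) (inverseˡ g) (inverseˡ h)
      ; inverseʳ = cancel (matrix h) (inverse h) (matrix g) (inverse g) (inverseʳ h) (inverseʳ g)
      ; lower = ·-lower {matrix g} {matrix h} (lower g) (lower h)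
      }
    ; ε = record
      { matrix = δ
      ; inverse = δ
      ; inverseˡ = ·-identityˡ δ
      ; inverseʳ = ·-identityˡ δ
      ; lower = λ {i} {j} i<j → δ-off {i} {j} λ { ≡.refl → ℕ.<-irrefl ≡.refl i<j }
      }
    ; _⁻¹ = λ g → record
      { matrix = inverse g
      ; inverse = matrix g
      ; inverseˡ = inverseʳ g
      ; inverseʳ = inverseˡ g
      ; lower = inverse-lower (matrix g) (inverse g) (inverseʳ g) (lower g)
      }
    ; isGroup = record
      { isMonoid = record
        { isSemigroup = record
          { isMagma = record
            { isEquivalence = record
              { refl = λ _ _ → R.refl
              ; sym = λ p i j → R.sym (p i j)
              ; trans = ≋-trans
              }
            ; ∙-cong = ·-cong
            }
          ; assoc = λ g h k → ·-assoc (matrix g) (matrix h) (matrix k)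
          }
        ; identity = (λ g → ·-identityˡ (matrix g)) , (λ g → ·-identityʳ (matrix g))
        }
      ; inverse = inverseˡ , inverseʳ
      ; ⁻¹-cong = λ {g} {h} p →
          ≋-trans (λ i j → R.sym (·-identityʳ (inverse g) i j))
          (≋-trans (·-cong {A = inverse g} (λ _ _ → R.refl) (λ i j → R.sym (inverseʳ h i j)))
          (≋-trans (λ i j → R.sym (·-assoc (inverse g) (matrix h) (inverse h) i j))
          (≋-trans (·-cong {B = inverse h} (·-cong {A = inverse g} (λ _ _ → R.refl) (λ i j → R.sym (p i j))) (λ _ _ → R.refl))
          (≋-trans (·-cong {B = inverse h} (inverseˡ g) (λ _ _ → R.refl)) (·-identityˡ (inverse h))))))
      }
    }
    where open Borel

  open Representations R 𝔹 public

  ----------------------------------------------------------------------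
  -- The free module E on z₁, …, zₙ and its quotients

  𝔼 : Rep c ℓ
  𝔼 = record
    { leftModule = record
      { Carrierᴹ = Fin n → R.Carrier
      ; _≈ᴹ_ = λ v w → ∀ i → v i R.≈ w i
      ; _+ᴹ_ = λ v w i → v i R.+ w i
      ; _*ₗ_ = λ r v i → r R.* v i
      ; 0ᴹ = λ _ → R.0#
      ; -ᴹ_ = λ v i → R.- v i
      ; isLeftModule = record
        { isLeftSemimodule = record
          { +ᴹ-isCommutativeMonoid = record
            { isMonoid = record
              { isSemigroup = record
                { isMagma = record
                  { isEquivalence = record
                    { refl = λ _ → R.refl
                    ; sym = λ p i → R.sym (p i)
                    ; trans = λ p q i → R.trans (p i) (q i)
                    }
                  ; ∙-cong = λ p q i → R.+-cong (p i) (q i)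
                  }
                ; assoc = λ _ _ _ _ → R.+-assoc _ _ _
                }
              ; identity = (λ _ _ → R.+-identityˡ _) , (λ _ _ → R.+-identityʳ _)
              }
            ; comm = λ _ _ _ → R.+-comm _ _
            }
          ; isPreleftSemimodule = record
            { *ₗ-cong = λ p q i → R.*-cong p (q i)
            ; *ₗ-zeroˡ = λ _ _ → R.zeroˡ _
            ; *ₗ-distribʳ = λ _ _ _ _ → R.distribʳ _ _ _
            ; *ₗ-identityˡ = λ _ _ → R.*-identityˡ _
            ; *ₗ-assoc = λ _ _ _ _ → R.*-assoc _ _ _
            ; *ₗ-zeroʳ = λ _ _ → R.zeroʳ _
            ; *ₗ-distribˡ = λ _ _ _ _ → R.distribˡ _ _ _
            }
          }
        ; -ᴹ‿cong = λ p i → R.-‿cong (p i)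
        ; -ᴹ‿inverse = (λ _ _ → R.-‿inverseˡ _) , (λ _ _ → R.-‿inverseʳ _)
        }
      }
    ; _•_ = λ g v i → sum λ j → matrix g i j R.* v j
    ; •-cong = λ p q i → sum-cong-≋ λ j → R.*-cong (p i j) (q j)
    ; •-identity = λ v i → sum-δˡ i v
    ; •-assoc = λ g h v i → sum-assoc (matrix g i) (matrix h) v
    ; •-+ = λ g v w i → R.trans (sum-cong-≋ λ j → R.distribˡ (matrix g i j) (v j) (w j))
        (∑-distrib-+ (λ j → matrix g i j R.* v j) (λ j → matrix g i j R.* w j))
    ; •-*ₗ = λ g r v i → R.trans
        (sum-cong-≋ λ j → R.trans (R.sym (R.*-assoc (matrix g i j) r (v j)))
                      (R.trans (R.*-congʳ (R.*-comm (matrix g i j) r)) (R.*-assoc r (matrix g i j) (v j))))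
        (R.sym (*-distribˡ-sum r (λ j → matrix g i j R.* v j)))
    }
    where open Borel

  open Rep 𝔼 using () renaming (Carrierᴹ to E; _•_ to _•ᴱ_; 0ᴹ to 0ᴱ)

  z : Fin n → E
  z q i = δ i q

  -- A flag of quotients ⋯ → F₂ → F₁ of E by B-submodules: F_i is the
  -- quotient of E by the submodule generated by `relations i`.

  record Flag : Set (lsuc (c ⊔ ℓ)) where
    field
      relations : ℕ → Pred E (c ⊔ ℓ)
      stable    : ∀ i g {v} → relations i v → _≈/_ 𝔼 (relations i) (g •ᴱ v) 0ᴱ
      nested    : ∀ {i j v} → i ℕ.≤ j → relations j v → _≈/_ 𝔼 (relations i) v 0ᴱ

    at : ℕ → Rep c (c ⊔ ℓ)
    at i = Quotient 𝔼 (relations i) (stable i)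

    ∈ker : ℕ → Pred E (c ⊔ ℓ)
    ∈ker i v = Rep._≈ᴹ_ (at i) v 0ᴱ

  -- A map of flags consists of maps F_i → G_i under E, and so is unique
  -- when it exists.

  record _⟶_ (F G : Flag) : Set (c ⊔ ℓ) where
    field
      factors : ∀ i {v} → Flag.relations F i v → Flag.∈ker G i v

    component : ∀ i → RepHom (Flag.at F i) (Flag.at G i)
    component i = quotientMap idHom (factors i)

  open _⟶_ public using (component)

  -- E_d = E / ⟨z_{d+1}, …, zₙ⟩; in particular E_d = E for d ≥ n.

  data Beyond (d : ℕ) : Pred E (c ⊔ ℓ) where
    beyond : ∀ q → d ℕ.< row q → Beyond d (z q)

  private
    zero-sum : ∀ {d m} (w : Fin m → E) → (∀ q → _≈/_ 𝔼 (Beyond d) (w q) 0ᴱ) →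
               _≈/_ 𝔼 (Beyond d) (λ i → sum λ q → w q i) 0ᴱ
    zero-sum {m = zero}  w p = base λ _ → R.refl
    zero-sum {m = suc m} w p = ~trans (~+ (p zero) (zero-sum (w ∘ suc) (p ∘ suc))) (base λ _ → R.+-identityˡ _)

    truncated : ∀ {d} v → (∀ q → row q ℕ.≤ d → v q R.≈ R.0#) → _≈/_ 𝔼 (Beyond d) v 0ᴱ
    truncated {d} v p = ~trans (base λ i → R.sym (R.trans (sum-cong-≋ λ q → R.*-comm (v q) (δ i q)) (sum-δˡ i v)))
                               (zero-sum (λ q i → v q R.* z q i) term)
      where
      term : ∀ q → _≈/_ 𝔼 (Beyond d) (λ i → v q R.* z q i) 0ᴱ
      term q with row q ℕ.≤? d
      ... | yes q≤d = base λ i → R.trans (R.*-congʳ (p q q≤d)) (R.zeroˡ _)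
      ... | no  q≰d = ~trans (~* (v q) (kill (beyond q (ℕ.≰⇒> q≰d)))) (base λ _ → R.zeroʳ _)

  standard : Flag
  standard = record { relations = Beyond ; stable = stable ; nested = nested }
    where
    stable : ∀ d g {v} → Beyond d v → _≈/_ 𝔼 (Beyond d) (g •ᴱ v) 0ᴱ
    stable d g (beyond q d<q) = truncated _ λ i i≤d →
      R.trans (sum-δʳ q (Borel.matrix g i)) (Borel.lower g (ℕ.≤-pred (ℕ.≤-<-trans i≤d d<q)))
    nested : ∀ {i j v} → i ℕ.≤ j → Beyond j v → _≈/_ 𝔼 (Beyond i) v 0ᴱ
    nested i≤j (beyond q j<q) = kill (beyond q (ℕ.≤-<-trans i≤j j<q))

  skip : ℕ → ℕ → ℕ
  skip k i with i ℕ.<? k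
  ... | yes _ = i
  ... | no  _ = pred i

  private
    skip-mono : ∀ k {i j} → i ℕ.≤ j → skip k i ℕ.≤ skip k j
    skip-mono k {i} {j} i≤j with i ℕ.<? k | j ℕ.<? k
    ... | yes _   | yes _   = i≤j
    ... | yes i<k | no  j≮k = ℕ.<⇒≤pred (ℕ.<-≤-trans i<k (ℕ.≮⇒≥ j≮k))
    ... | no  i≮k | yes j<k = contradiction (ℕ.≤-<-trans i≤j j<k) i≮k
    ... | no  _   | no  _   = ℕ.pred-mono-≤ i≤j

    skip-suc : ∀ k i → skip k i ℕ.≤ skip (suc k) i
    skip-suc k i with i ℕ.<? k | i ℕ.<? suc k
    ... | yes _   | yes _    = ℕ.≤-refl
    ... | yes i<k | no  i≮1+k = contradiction (ℕ.m<n⇒m<1+n i<k) i≮1+k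
    ... | no  _   | yes _    = ℕ.pred[n]≤n
    ... | no  _   | no  _    = ℕ.≤-refl

  𝖱 : ℕ → Flag → Flag
  𝖱 k F = record
    { relations = relations ∘ skip k
    ; stable = stable ∘ skip k
    ; nested = nested ∘ skip-mono k
    }
    where open Flag F

  𝖱-map : ∀ k F → 𝖱 (suc k) F ⟶ 𝖱 k F
  𝖱-map k F = record { factors = λ i → Flag.nested F (skip-suc k i) }

  ----------------------------------------------------------------------
  -- Flagged Schur modules

  module _ {N : ℕ} where

    -- Variables z_{pq} with p > n never occur when the diagram lies in
    -- rows 1, …, n.

    Variable : Set
    Variable = Fin N × Fin n

    -- The p-th row of the generic matrix, extended from basis vectors to
    -- a linear form: pairing p (z q) is the entry z_{pq}.

    pairing : Fin N → E → Poly Variable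
    pairing p v = Σᴾ λ q → con (v q) ⊛ var (p , q)

    extend : ∀ {x} {X : Set x} → (X → Poly Variable) → Term X → Poly Variable
    extend f (gen x) = f x
    extend f 𝟘       = con R.0#
    extend f (t ⊞ u) = extend f t ⊕ extend f u
    extend f (⊟ t)   = ⊝ extend f t
    extend f (r ⊡ t) = con r ⊛ extend f t

    T : Diagram N → Rep c (c ⊔ ℓ)
    T []      = 𝟙
    T (a ∷ D) = ⋀ ∣ a ∣ 𝔼 ⊗ T D

    -- The map T E^D → k[z_{pq}] on all decomposable tensors.  For basis
    -- vectors v j = z_{b_j} the determinant below is the minor Δ_{a,b}.

    minor : (a : Column N) → (Fin ∣ a ∣ → E) → Poly Variable
    minor a v = det λ i j → pairing (element a i) (v j)

    Δ : (D : Diagram N) → Rep.Carrierᴹ (T D) → Poly Variable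
    Δ []      = extend λ _ → con R.1#
    Δ (a ∷ D) = extend λ (t , u) → extend (minor a) t ⊛ Δ D u

    None : Pred Variable (c ⊔ ℓ)
    None _ = ⊥

    IsExchangeRelation : (D : Diagram N) → Pred (Rep.Carrierᴹ (T D)) (c ⊔ ℓ)
    IsExchangeRelation D e = _≈ᴾ_ None (Δ D e) (con R.0#)

    private
      module P = CommutativeRing (polynomialRing None)
      module ΣP = SemiringSum P.semiring

      pairing-cong : ∀ p {v w} → (∀ i → v i R.≈ w i) → pairing p v P.≈ pairing p w
      pairing-cong p eq = ΣP.sum-cong-≋ λ q → ⊛-cong (con-cong (eq q)) refl

      pairing-0 : ∀ p → pairing p 0ᴱ P.≈ con R.0#
      pairing-0 p = zeros λ q → P.zeroˡ (var (p , q))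
        where
        zeros : ∀ {m} {f : Fin m → Poly Variable} → (∀ l → f l P.≈ con R.0#) → Σᴾ f P.≈ con R.0#
        zeros {zero}  h = refl
        zeros {suc m} h = trans (⊕-cong (h zero) (zeros (h ∘ suc))) (⊕-identity _)

      pairing-+* : ∀ p r v w → pairing p (λ i → r R.* v i R.+ w i) P.≈ con r ⊛ pairing p v ⊕ pairing p w
      pairing-+* p r v w = trans
        (ΣP.sum-cong-≋ λ q → trans (⊛-cong (trans (con-+ (r R.* v q) (w q)) (⊕-cong (con-* r (v q)) refl)) refl)
          (trans (P.distribʳ (var (p , q)) (con r ⊛ con (v q)) (con (w q))) (⊕-cong (⊛-assoc (con r) (con (v q)) (var (p , q))) refl)))
        (trans (ΣP.∑-distrib-+ (λ q → con r ⊛ (con (v q) ⊛ var (p , q))) (λ q → con (w q) ⊛ var (p , q)))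
          (⊕-cong (sym (ΣP.*-distribˡ-sum (con r) (λ q → con (v q) ⊛ var (p , q)))) refl))

      pairing-sum : ∀ p {m} (v : Fin m → R.Carrier) (w : Fin m → E) →
                    Σᴾ (λ q → con (v q) ⊛ pairing p (w q)) P.≈ pairing p (λ i → sum λ q → v q R.* w q i)
      pairing-sum p {zero}  v w = sym (pairing-0 p)
      pairing-sum p {suc m} v w =
        trans (⊕-cong refl (pairing-sum p (v ∘ suc) (w ∘ suc))) (sym (pairing-+* p (v zero) (w zero) _))

      -- The action of g on polynomials, z_{pq} ↦ ⟨p , g z_q⟩.

      σ : Borel → Variable → Poly Variable
      σ g (p , q) = pairing p (g •ᴱ z q)

      substitute-Σ : ∀ g {m} (f : Fin m → Poly Variable) → substitute (σ g) (Σᴾ f) ≡ Σᴾ (λ i → substitute (σ g) (f i))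
      substitute-Σ g {zero}  f = ≡.refl
      substitute-Σ g {suc m} f = ≡.cong (substitute (σ g) (f zero) ⊕_) (substitute-Σ g (f ∘ suc))

      substitute-pairing : ∀ g p v → substitute (σ g) (pairing p v) P.≈ pairing p (g •ᴱ v)
      substitute-pairing g p v = trans (P.reflexive (substitute-Σ g λ q → con (v q) ⊛ var (p , q)))
        (trans (pairing-sum p v (λ q → g •ᴱ z q))
          (pairing-cong p λ i → sum-cong-≋ λ q → R.trans (R.*-congˡ (sum-δʳ q (Borel.matrix g i))) (R.*-comm (v q) (Borel.matrix g i q))))

      signed-cong : ∀ i {f h} → f P.≈ h → signed i f P.≈ signed i h
      signed-cong zero    p = p
      signed-cong (suc i) p = ⊝-cong (signed-cong i p)

      substitute-signed : ∀ g i f → substitute (σ g) (signed i f) ≡ signed i (substitute (σ g) f)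
      substitute-signed g zero    f = ≡.refl
      substitute-signed g (suc i) f = ≡.cong ⊝_ (substitute-signed g i f)

      substitute-det : ∀ g {r} (A A′ : Fin r → Fin r → Poly Variable) → (∀ i j → substitute (σ g) (A i j) P.≈ A′ i j) →
                       substitute (σ g) (det A) P.≈ det A′
      substitute-det g {zero}  A A′ p = refl
      substitute-det g {suc r} A A′ p = trans (P.reflexive (substitute-Σ g term))
        (ΣP.sum-cong-≋ λ j → trans (P.reflexive (substitute-signed g (toℕ j) (A zero j ⊛ det (drop A j))))
          (signed-cong (toℕ j) (⊛-cong (p zero j) (substitute-det g (drop A j) (drop A′ j) λ i j′ → p (suc i) (punchIn j j′)))))
        where
        drop : (Fin (suc r) → Fin (suc r) → Poly Variable) → Fin (suc r) → Fin r → Fin r → Poly Variable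
        drop A j i j′ = A (suc i) (punchIn j j′)
        term : Fin (suc r) → Poly Variable
        term j = signed (toℕ j) (A zero j ⊛ det (drop A j))

      substitute-extend : ∀ g {x} {X : Set x} (f : X → Poly Variable) (act : X → X) →
                          (∀ x → substitute (σ g) (f x) P.≈ f (act x)) →
                          ∀ t → substitute (σ g) (extend f t) P.≈ extend f (mapTerm act t)
      substitute-extend g f act p (gen x) = p x
      substitute-extend g f act p 𝟘       = refl
      substitute-extend g f act p (t ⊞ u) = ⊕-cong (substitute-extend g f act p t) (substitute-extend g f act p u)
      substitute-extend g f act p (⊟ t)   = ⊝-cong (substitute-extend g f act p t)
      substitute-extend g f act p (r ⊡ t) = ⊛-cong refl (substitute-extend g f act p t)

      substitute-Δ : ∀ D g e → substitute (σ g) (Δ D e) P.≈ Δ D (Rep._•_ (T D) g e)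
      substitute-Δ []      g = substitute-extend g _ id λ _ → refl
      substitute-Δ (a ∷ D) g = substitute-extend g _ _ λ (t , u) →
        ⊛-cong (substitute-extend g (minor a) _ (λ v → substitute-det g _ _ λ i j → substitute-pairing g (element a i) (v j)) t)
               (substitute-Δ D g u)

      exchange-stable : ∀ D g e → IsExchangeRelation D e → IsExchangeRelation D (Rep._•_ (T D) g e)
      exchange-stable D g e p = trans (sym (substitute-Δ D g e)) (substitute-cong (σ g) (λ ()) p)

    module _ (F : Flag) where

      open Flag F using (at; ∈ker)

      -- With j counted from 0 this is the i of ⋀ⁱ E ⊗ ⋀ʳ⁻ⁱ ker(E → F_{a_{i+1}}):
      -- the vectors v_{i+1}, …, v_r all lie in that kernel.

      data FlagRelation (a : Column N) : Pred (Rep.Carrierᴹ (⋀ ∣ a ∣ 𝔼)) (c ⊔ ℓ) where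
        flagged : ∀ v j → (∀ l → j Fin.≤ l → ∈ker (row (element a j)) (v l)) →
                  FlagRelation a (gen v)

      columnModule : Column N → Rep c (c ⊔ ℓ)
      columnModule a = Quotient (⋀ ∣ a ∣ 𝔼) (FlagRelation a) stable
        where
        stable : ∀ g {t} → FlagRelation a t → _≈/_ (⋀ ∣ a ∣ 𝔼) (FlagRelation a) (Rep._•_ (⋀ ∣ a ∣ 𝔼) g t) 𝟘
        stable g (flagged v j p) = kill (flagged _ j λ l j≤l →
          let open Rep (at (row (element a j))) in ≈ᴹ-trans (•-cong {g} {g} (Group.refl 𝔹 {g}) (p l j≤l)) (•-0 g))

      TF : Diagram N → Rep c (c ⊔ ℓ)
      TF []      = 𝟙
      TF (a ∷ D) = columnModule a ⊗ TF D

      projection : (D : Diagram N) → RepHom (T D) (TF D)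
      projection []      = idHom
      projection (a ∷ D) = quotientHom ⊗ᴴ projection D

      data Exchange (D : Diagram N) : Pred (Rep.Carrierᴹ (TF D)) (c ⊔ ℓ) where
        exchange : ∀ e → IsExchangeRelation D e → Exchange D (RepHom.to (projection D) e)

      private
        stable : (D : Diagram N) → ∀ g {t} → Exchange D t → _≈/_ (TF D) (Exchange D) (Rep._•_ (TF D) g t) (Rep.0ᴹ (TF D))
        stable D g (exchange e p) =
          ~trans (base (Rep.≈ᴹ-sym (TF D) (RepHom.equivariant (projection D) g e)))
                 (kill (exchange (Rep._•_ (T D) g e) (exchange-stable D g e p)))

      Schur : Diagram N → Rep c (c ⊔ ℓ)
      Schur D = Quotient (TF D) (Exchange D) (stable D)

      -- z_{pq} is set to 0 whenever z_q maps to 0 in F_p.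

      Vanishing : Pred Variable (c ⊔ ℓ)
      Vanishing (p , q) = ∈ker (row p) (z q)

      -- z_τ ↦ ∏ⱼ Δ_{a⁽ʲ⁾,b⁽ʲ⁾} identifies Schur D with a submodule of the
      -- polynomial ring.  Every element of Schur D comes from T D, and an
      -- element of T D that is 0 in Schur D always maps to 0, so only
      -- injectivity is at stake.  It is not automatic: for n = 5, the flag
      -- 𝖱 5 standard and the columns {2,3}, {2,5}, the difference of
      -- (z₁ ∧ z₃) ⊗ (z₂ ∧ z₃) and (z₂ ∧ z₃) ⊗ (z₁ ∧ z₃) maps to 0 but is
      -- not 0 in Schur D unless R is trivial.

      IsSubmoduleOfPolynomials : Diagram N → Set (c ⊔ ℓ)
      IsSubmoduleOfPolynomials D = ∀ e → _≈ᴾ_ Vanishing (Δ D e) (con R.0#) →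
        Rep._≈ᴹ_ (Schur D) (RepHom.to (projection D) e) (Rep.0ᴹ (Schur D))

    module _ {F G : Flag} (f : F ⟶ G) where

      columnMap : ∀ a → RepHom (columnModule F a) (columnModule G a)
      columnMap a = quotientMap idHom λ where
        (flagged v j p) → kill (flagged v j λ l j≤l → RepHom.⟦⟧-cong (component f _) (p l j≤l))

      TF-map : (D : Diagram N) → RepHom (TF F D) (TF G D)
      TF-map []      = idHom
      TF-map (a ∷ D) = columnMap a ⊗ᴴ TF-map D

      private
        natural : (D : Diagram N) → ∀ e →
                  RepHom.to (TF-map D) (RepHom.to (projection F D) e) ≡ RepHom.to (projection G D) e
        natural []      e = ≡.refl
        natural (a ∷ D) e = go e
          where
          go : ∀ e → RepHom.to (TF-map (a ∷ D)) (RepHom.to (projection F (a ∷ D)) e) ≡ RepHom.to (projection G (a ∷ D)) e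
          go (gen (t , u)) = ≡.cong (λ u → gen (t , u)) (natural D u)
          go 𝟘             = ≡.refl
          go (t ⊞ u)       = ≡.cong₂ _⊞_ (go t) (go u)
          go (⊟ t)         = ≡.cong ⊟_ (go t)
          go (r ⊡ t)       = ≡.cong (r ⊡_) (go t)

      Schur-map : (D : Diagram N) → RepHom (Schur F D) (Schur G D)
      Schur-map D = quotientMap (TF-map D) λ where
        (exchange e p) → ~trans (base (Rep.≈ᴹ-reflexive (TF G D) (natural D e))) (kill (exchange e p))

{-# OPTIONS --safe #-}

-- Write F = 𝖱ₖ₊₁E and G = 𝖱ₖE, and x for the variable z_{kk}.  As Schur F D
-- and Schur F (sₖD) embed in the polynomial ring of F, everything takes
-- place there.  Let τ exchange the rows k and k + 1 of variables, which is
-- an automorphism since F_k = F_{k+1}; it turns the minors of a column with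
-- its rows k and k + 1 swapped into those of the column itself, up to sign.
-- The isomorphism matches a kernel element with polynomial f with z_k ⊗ y
-- where f = x · τ(y).  As x is not a zero divisor, it remains to see that
-- the kernel and x · τ(Schur F (sₖD)) are the same polynomials.
--
-- Let w be the witnessing column.  As k is its largest element,
-- x Δ_{w∖k, u} = Δ_{w, u ∧ z_k}, and this is in the kernel.  Conversely the
-- kernel is spanned by products of minors with a factor Δ_{a, v} for which
-- k = a_j and v_j, v_{j+1}, … have no components before z_k.  If a = w, this
-- factor is a multiple of x Δ_{w∖k, u}.  If k + 1 ∈ a, two rows of a
-- block are proportional and Δ_{a, v} = 0.  If a ∩ {1, …, k+1} ⊆ w, then
-- Δ_{a, v} = x M, and expanding Δ_{w, u} along its last row writes M Δ_{w, u}
-- through products Δ_{w∖k, u′} Δ_{a, v′}.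

module Submission where

open import Algebra.Bundles using (CommutativeRing)
import Algebra.Properties.AbelianGroup as AbelianGroupProperties
import Algebra.Properties.CommutativeSemigroup as CommutativeSemigroupProperties
import Algebra.Properties.Group as GroupProperties
import Algebra.Properties.Ring as RingProperties
import Algebra.Properties.Semiring.Sum as SemiringSum
open import Data.Fin.Base as Fin using (Fin; zero; suc; toℕ; fromℕ; fromℕ<; inject₁; punchIn; cast)
open import Data.Fin.Permutation using (transpose; lift₀-transpose; _⟨$⟩ʳ_)
import Data.Fin.Properties as Fin
open import Data.Fin.Subset using (inside; outside; _∈_; _-_; _─_; ∣_∣) renaming (⊥ to ∅)
open import Data.Fin.Subset.Properties using (p─⊥≡p; x∈p∧x≢y⇒x∈p-y)
open import Data.List.Base using (List; []; _∷_; _++_; map)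
import Data.List.Properties as List
open import Data.List.Relation.Binary.Permutation.Propositional as ↭ using (_↭_)
import Data.List.Relation.Binary.Permutation.Propositional.Properties as ↭
open import Data.List.Relation.Unary.All as All using (All)
import Data.List.Relation.Unary.All.Properties as All
open import Data.List.Relation.Unary.Any using (Any; here; there)
open import Data.Nat.Base as ℕ using (ℕ; zero; suc; pred; z≤n; s≤s)
import Data.Nat.Properties as ℕ
open import Data.Product.Base using (Σ; ∃; ∃₂; _×_; _,_; proj₁; proj₂)
open import Data.Product.Properties using (≡-dec)
open import Data.Sum.Base using (_⊎_; inj₁; inj₂)
open import Data.Unit.Base using (tt)
open import Data.Vec.Base using ([]; _∷_; here; there; lookup)
open import Data.Vec.Functional using (updateAt)
open import Data.Vec.Functional.Properties using (updateAt-updates; updateAt-minimal)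
import Data.Vec.Properties as Vec
open import Defs
open import Function.Base using (_∘_)
open import Level using (_⊔_) renaming (suc to lsuc)
open import Relation.Binary.Definitions using (DecidableEquality; tri<; tri≈; tri>)
open import Relation.Binary.PropositionalEquality as ≡ using (_≡_; _≢_)
import Relation.Binary.Reasoning.Setoid as ≈-Reasoning
open import Relation.Nullary using (yes; no; contradiction)
open import Relation.Unary using (Pred)

-- A kernel element comes with a derivation that it equals 0 in `Schur G D`, not as a combination of
-- products. So `poly` is shown to respect equality modulo every R-submodule of the polynomial ring
-- that contains the products with a flagged factor. For F and the zero submodule this makes the
-- polynomial of an element well defined; for G and `Twisted` it is the inclusion of the kernel. The
-- formula for M Δ_{w, u} is a weighted Laplace expansion: put row p of a on top of the rows of
-- `w⁻`, expand along it, weight by the determinant of a with row p replaced by the coefficients of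
-- z_k, and sum over p. For p < k a row of `w⁻` is repeated, for p > k the weight is 0, and p = k
-- gives M Δ_{w, u} up to sign. Equivariance holds because B acts on the columns of the generic
-- matrix and τ on its rows, while x is an eigenvector: as F_k = E_k and g z_k starts at z_k, g x =
-- γ x for the diagonal entry γ of g, which is also the scalar by which g acts on K_k.

punchIn-≤ : ∀ {n} (i : Fin (suc n)) (j : Fin n) → i Fin.≤ inject₁ j → punchIn i j ≡ suc j
punchIn-≤ zero    j       _       = ≡.refl
punchIn-≤ (suc i) (suc j) (s≤s p) = ≡.cong suc (punchIn-≤ i j p)

punchIn-inject₁ : ∀ {n} (i : Fin (suc n)) (j : Fin n) → punchIn (inject₁ i) (inject₁ j) ≡ inject₁ (punchIn i j)
punchIn-inject₁ zero    j       = ≡.refl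
punchIn-inject₁ (suc i) zero    = ≡.refl
punchIn-inject₁ (suc i) (suc j) = ≡.cong suc (punchIn-inject₁ i j)

punchIn-fromℕ : ∀ {n} (i : Fin (suc n)) → punchIn (inject₁ i) (fromℕ n) ≡ fromℕ (suc n)
punchIn-fromℕ {zero}  zero    = ≡.refl
punchIn-fromℕ {suc n} zero    = ≡.refl
punchIn-fromℕ {suc n} (suc i) = ≡.cong suc (punchIn-fromℕ i)

infixl 8 _[_]≔_
_[_]≔_ : ∀ {a} {A : Set a} {n} → (Fin n → A) → Fin n → A → Fin n → A
v [ i ]≔ x = updateAt v i λ _ → x

-- Determinants over a polynomial ring, from the expansion along the first row

module Determinants {c ℓ} (R : CommutativeRing c ℓ) {V : Set} {y} (Z : Pred V y) where

  open Polynomials R using (Poly; signed; polynomialRing)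
  open CommutativeRing (polynomialRing Z) hiding (zero)
  private module Sum = SemiringSum semiring
  open RingProperties ring using (-‿distribˡ-*; -1*x≈-x; -0#≈0#; -‿involutive)
  open CommutativeSemigroupProperties *-commutativeSemigroup using (x∙yz≈y∙xz; interchange)
  open ≈-Reasoning setoid

  Square : ℕ → Set c
  Square r = Fin r → Fin r → Poly V

  _ᵀ : ∀ {r} → Square r → Square r
  (A ᵀ) i j = A j i

  minorAt : ∀ {r} → Square (suc r) → Fin (suc r) → Square r
  minorAt A j i j′ = A (suc i) (punchIn j j′)

  -- Opaque, so that Agda can solve for the summand and for the matrix.

  opaque

    sum : ∀ {m} → (Fin m → Poly V) → Poly V
    sum = Sum.sum

    det : ∀ {r} → Square r → Poly V
    det = Polynomials.det R

    sum≡ : ∀ {m} (f : Fin m → Poly V) → sum f ≡ Sum.sum f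
    sum≡ f = ≡.refl

    det≡ : ∀ {r} (A : Square r) → det A ≡ Polynomials.det R A
    det≡ A = ≡.refl

    sum-cong : ∀ {m} {f g : Fin m → Poly V} → (∀ i → f i ≈ g i) → sum f ≈ sum g
    sum-cong = Sum.sum-cong-≋

    sum-comm : ∀ {m n} (f : Fin m → Fin n → Poly V) → sum (λ i → sum λ j → f i j) ≈ sum λ j → sum λ i → f i j
    sum-comm = Sum.∑-comm

    sum-+ : ∀ {m} (f g : Fin m → Poly V) → sum (λ i → f i + g i) ≈ sum f + sum g
    sum-+ = Sum.∑-distrib-+

    *-sum : ∀ {m} q (f : Fin m → Poly V) → q * sum f ≈ sum λ i → q * f i
    *-sum = Sum.*-distribˡ-sum

    sum-suc : ∀ {m} (f : Fin (suc m) → Poly V) → sum f ≈ f zero + sum (λ i → f (suc i))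
    sum-suc f = refl

    sum-last : ∀ {m} (f : Fin (suc m) → Poly V) → sum f ≈ sum (λ i → f (inject₁ i)) + f (fromℕ m)
    sum-last = Sum.sum-init-last

    sum-zero : ∀ {m} {f : Fin m → Poly V} → (∀ i → f i ≈ 0#) → sum f ≈ 0#
    sum-zero {m} p = trans (Sum.sum-cong-≋ p) (Sum.sum-replicate-zero m)

    sgn : ℕ → Poly V
    sgn i = signed i 1#

    sgn-0 : sgn 0 ≈ 1#
    sgn-0 = refl

    sgn-suc : ∀ i → sgn (suc i) ≈ - sgn i
    sgn-suc i = refl

    signed≈ : ∀ i f → signed i f ≈ sgn i * f
    signed≈ zero    f = sym (*-identityˡ f)
    signed≈ (suc i) f = trans (-‿cong (signed≈ i f)) (-‿distribˡ-* (sgn i) f)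

    det₀ : ∀ {A : Square 0} → det A ≈ 1#
    det₀ = refl

    expand-row : ∀ {r} (A : Square (suc r)) → det A ≈ sum λ j → (sgn (toℕ j) * A zero j) * det (minorAt A j)
    expand-row A = Sum.sum-cong-≋ λ j → trans (signed≈ (toℕ j) (A zero j * det (minorAt A j)))
                                            (sym (*-assoc (sgn (toℕ j)) (A zero j) (det (minorAt A j))))

  -1*-1 : - 1# * - 1# ≈ 1#
  -1*-1 = trans (-1*x≈-x (- 1#)) (-‿involutive 1#)

  sgn-square : ∀ i → sgn i * sgn i ≈ 1#
  sgn-square zero    = trans (*-cong sgn-0 sgn-0) (*-identityˡ 1#)
  sgn-square (suc i) = begin
    sgn (suc i) * sgn (suc i)          ≈⟨ *-cong (sgn-suc i) (sgn-suc i) ⟩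
    - sgn i * - sgn i                  ≈⟨ *-cong (-1*x≈-x (sgn i)) (-1*x≈-x (sgn i)) ⟨
    (- 1# * sgn i) * (- 1# * sgn i)    ≈⟨ interchange (- 1#) (sgn i) (- 1#) (sgn i) ⟩
    (- 1# * - 1#) * (sgn i * sgn i)    ≈⟨ *-cong -1*-1 (sgn-square i) ⟩
    1# * 1#                            ≈⟨ *-identityˡ 1# ⟩
    1#                                 ∎

  sgn-+ : ∀ i j → sgn (i ℕ.+ j) ≈ sgn i * sgn j
  sgn-+ zero    j = sym (trans (*-congʳ sgn-0) (*-identityˡ _))
  sgn-+ (suc i) j = begin
    sgn (suc (i ℕ.+ j))     ≈⟨ sgn-suc _ ⟩
    - sgn (i ℕ.+ j)         ≈⟨ -‿cong (sgn-+ i j) ⟩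
    - (sgn i * sgn j)       ≈⟨ -‿distribˡ-* _ _ ⟩
    - sgn i * sgn j         ≈⟨ *-congʳ (sgn-suc i) ⟨
    sgn (suc i) * sgn j     ∎

  det-cong : ∀ {r} {A B : Square r} → (∀ i j → A i j ≈ B i j) → det A ≈ det B
  det-cong {zero}          p = trans det₀ (sym det₀)
  det-cong {suc r} {A} {B} p = begin
    det A                                                     ≈⟨ expand-row A ⟩
    sum (λ j → (sgn (toℕ j) * A zero j) * det (minorAt A j))  ≈⟨ sum-cong (λ j → *-cong (*-congˡ (p zero j)) (det-cong λ i j′ → p (suc i) (punchIn j j′))) ⟩
    sum (λ j → (sgn (toℕ j) * B zero j) * det (minorAt B j))  ≈⟨ expand-row B ⟨
    det B                                                     ∎

  det-cast : ∀ {r r′} (eq : r ≡ r′) (A : Square r′) → det (λ i j → A (Fin.cast eq i) (Fin.cast eq j)) ≈ det A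
  det-cast ≡.refl A = det-cong λ i j → reflexive (≡.cong₂ A (Fin.cast-is-id ≡.refl i) (Fin.cast-is-id ≡.refl j))

  -- Additivity and scaling of a row are combined, so that one induction on the row index gives
  -- both. For the first row the minors agree; for a later row linearity passes to each minor.
  det-linear : ∀ {r} (i : Fin r) {A B C : Square r} q → (∀ j → C i j ≈ q * A i j + B i j) →
               (∀ p → p ≢ i → ∀ j → A p j ≈ C p j) → (∀ p → p ≢ i → ∀ j → B p j ≈ C p j) →
               det C ≈ q * det A + det B
  det-linear {suc r} i {A} {B} {C} q eq A≈C B≈C = begin
    det C                                  ≈⟨ expand-row C ⟩
    sum (λ j → (sgn (toℕ j) * C zero j) * det (minorAt C j))
      ≈⟨ sum-cong (term i eq A≈C B≈C) ⟩
    sum (λ j → q * a j + b j)              ≈⟨ sum-+ (λ j → q * a j) b ⟩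
    sum (λ j → q * a j) + sum b            ≈⟨ +-cong (*-sum q a) refl ⟨
    q * sum a + sum b                      ≈⟨ +-cong (*-congˡ (expand-row A)) (expand-row B) ⟨
    q * det A + det B                      ∎
    where
    a b : Fin (suc r) → Poly V
    a j = (sgn (toℕ j) * A zero j) * det (minorAt A j)
    b j = (sgn (toℕ j) * B zero j) * det (minorAt B j)

    term : ∀ i → (∀ j → C i j ≈ q * A i j + B i j) →
           (∀ p → p ≢ i → ∀ j → A p j ≈ C p j) → (∀ p → p ≢ i → ∀ j → B p j ≈ C p j) →
           ∀ j → (sgn (toℕ j) * C zero j) * det (minorAt C j) ≈ q * a j + b j
    term zero eq A≈C B≈C j = begin
      (sgn (toℕ j) * C zero j) * d                               ≈⟨ *-congʳ (*-congˡ (eq j)) ⟩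
      (sgn (toℕ j) * (q * A zero j + B zero j)) * d              ≈⟨ *-congʳ (distribˡ _ _ _) ⟩
      (sgn (toℕ j) * (q * A zero j) + sgn (toℕ j) * B zero j) * d ≈⟨ distribʳ _ _ _ ⟩
      (sgn (toℕ j) * (q * A zero j)) * d + (sgn (toℕ j) * B zero j) * d
        ≈⟨ +-cong (trans (*-congʳ (x∙yz≈y∙xz _ q _)) (*-assoc q _ d)) refl ⟩
      q * ((sgn (toℕ j) * A zero j) * d) + (sgn (toℕ j) * B zero j) * d
        ≈⟨ +-cong (*-congˡ (*-congˡ (det-cong λ p j′ → sym (A≈C (suc p) (λ ()) _)))) (*-congˡ (det-cong λ p j′ → sym (B≈C (suc p) (λ ()) _))) ⟩
      q * a j + b j                                              ∎
      where d = det (minorAt C j)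
    term (suc i) eq A≈C B≈C j = begin
      (sgn (toℕ j) * C zero j) * det (minorAt C j)
        ≈⟨ *-congˡ (det-linear i q (λ j′ → eq (punchIn j j′))
             (λ p p≢i j′ → A≈C (suc p) (p≢i ∘ Fin.suc-injective) _) (λ p p≢i j′ → B≈C (suc p) (p≢i ∘ Fin.suc-injective) _)) ⟩
      (sgn (toℕ j) * C zero j) * (q * det (minorAt A j) + det (minorAt B j))
        ≈⟨ distribˡ _ _ _ ⟩
      (sgn (toℕ j) * C zero j) * (q * det (minorAt A j)) + (sgn (toℕ j) * C zero j) * det (minorAt B j)
        ≈⟨ +-cong (trans (x∙yz≈y∙xz _ q _) (*-congˡ (*-congʳ (*-congˡ (sym (A≈C zero (λ ()) j)))))) (*-congʳ (*-congˡ (sym (B≈C zero (λ ()) j)))) ⟩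
      q * a j + b j ∎

  -- A zero row ρ satisfies ρ = - ρ + ρ, so linearity with all three matrices equal to `A` gives det
  -- A = - det A + det A.
  det-zero-row : ∀ {r} (i : Fin r) {A : Square r} → (∀ j → A i j ≈ 0#) → det A ≈ 0#
  det-zero-row i {A} p = begin
    det A                    ≈⟨ det-linear i (- 1#) (λ j → trans (p j) (sym (trans (+-cong (*-congˡ (p j)) (p j)) (trans (+-identityʳ _) (zeroʳ _))))) (λ _ _ _ → refl) (λ _ _ _ → refl) ⟩
    - 1# * det A + det A     ≈⟨ +-cong (-1*x≈-x _) refl ⟩
    - det A + det A          ≈⟨ -‿inverseˡ _ ⟩
    0#                       ∎

  det-scale : ∀ {r} (i : Fin r) {A C : Square r} q → (∀ j → C i j ≈ q * A i j) →
              (∀ p → p ≢ i → ∀ j → A p j ≈ C p j) → det C ≈ q * det A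
  det-scale i {A} {C} q eq A≈C = begin
    det C                         ≈⟨ det-linear i q (λ j → trans (eq j) (trans (sym (+-identityʳ _)) (+-cong refl (sym (reflexive (≡.cong (λ ρ → ρ j) (updateAt-updates i C))))))) A≈C (λ p p≢i j → reflexive (≡.cong (λ ρ → ρ j) (updateAt-minimal p i C p≢i))) ⟩
    q * det A + det (C [ i ]≔ λ _ → 0#)  ≈⟨ +-cong refl (det-zero-row i λ j → reflexive (≡.cong (λ ρ → ρ j) (updateAt-updates i C))) ⟩
    q * det A + 0#                ≈⟨ +-identityʳ _ ⟩
    q * det A                     ∎

  -- Expanding the minors of the first row along their first column and
  -- those of the first column along their first row gives the same
  -- double sum.

  expand-column : ∀ {r} (A : Square (suc r)) →
                  det A ≈ sum λ i → (sgn (toℕ i) * A i zero) * det (λ i′ j → A (punchIn i i′) (suc j))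
  expand-column {zero}  A = trans (expand-row A) (sum-cong {1} λ { zero → *-congˡ (trans det₀ (sym det₀)) })
  expand-column {suc r} A = trans (expand-row A) (trans (sum-suc _) (trans (+-cong refl (begin
    sum (λ j → (sgn (suc (toℕ j)) * A zero (suc j)) * det (minorAt A (suc j)))
      ≈⟨ sum-cong (λ j → *-congˡ (expand-column (minorAt A (suc j)))) ⟩
    sum (λ j → (sgn (suc (toℕ j)) * A zero (suc j)) * sum (λ i → (sgn (toℕ i) * A (suc i) zero) * D i j))
      ≈⟨ sum-cong (λ j → *-sum _ _) ⟩
    sum (λ j → sum λ i → (sgn (suc (toℕ j)) * A zero (suc j)) * ((sgn (toℕ i) * A (suc i) zero) * D i j))
      ≈⟨ sum-cong (λ j → sum-cong λ i → exchange (toℕ j) (A zero (suc j)) (toℕ i) (A (suc i) zero) (D i j)) ⟩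
    sum (λ j → sum λ i → (sgn (suc (toℕ i)) * A (suc i) zero) * ((sgn (toℕ j) * A zero (suc j)) * D i j))
      ≈⟨ sum-comm (λ j i → (sgn (suc (toℕ i)) * A (suc i) zero) * ((sgn (toℕ j) * A zero (suc j)) * D i j)) ⟩
    sum (λ i → sum λ j → (sgn (suc (toℕ i)) * A (suc i) zero) * ((sgn (toℕ j) * A zero (suc j)) * D i j))
      ≈⟨ sum-cong (λ i → *-sum _ _) ⟨
    sum (λ i → (sgn (suc (toℕ i)) * A (suc i) zero) * sum (λ j → (sgn (toℕ j) * A zero (suc j)) * D i j))
      ≈⟨ sum-cong (λ i → *-congˡ (expand-row (λ i′ j → A (punchIn (suc i) i′) (suc j)))) ⟨
    sum (λ i → (sgn (suc (toℕ i)) * A (suc i) zero) * det (λ i′ j → A (punchIn (suc i) i′) (suc j))) ∎)) (sym (sum-suc _))))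
    where
    D : Fin (suc r) → Fin (suc r) → Poly V
    D i j = det λ i′ j′ → A (suc (punchIn i i′)) (suc (punchIn j j′))

    exchange : ∀ i a j b d → (sgn (suc i) * a) * ((sgn j * b) * d) ≈ (sgn (suc j) * b) * ((sgn i * a) * d)
    exchange i a j b d = begin
      (sgn (suc i) * a) * ((sgn j * b) * d)  ≈⟨ *-congʳ (trans (*-congʳ (sgn-suc i)) (sym (-‿distribˡ-* _ a))) ⟩
      - (sgn i * a) * ((sgn j * b) * d)      ≈⟨ -‿distribˡ-* _ _ ⟨
      - ((sgn i * a) * ((sgn j * b) * d))    ≈⟨ -‿cong (x∙yz≈y∙xz _ _ _) ⟩
      - ((sgn j * b) * ((sgn i * a) * d))    ≈⟨ -‿distribˡ-* _ _ ⟩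
      - (sgn j * b) * ((sgn i * a) * d)      ≈⟨ *-congʳ (trans (*-congʳ (sgn-suc j)) (sym (-‿distribˡ-* _ b))) ⟨
      (sgn (suc j) * b) * ((sgn i * a) * d)  ∎

  det-ᵀ : ∀ {r} (A : Square r) → det (A ᵀ) ≈ det A
  det-ᵀ {zero}  A = trans det₀ (sym det₀)
  det-ᵀ {suc r} A = begin
    det (A ᵀ)                                                                     ≈⟨ expand-row (A ᵀ) ⟩
    sum (λ i → (sgn (toℕ i) * A i zero) * det (minorAt (A ᵀ) i))                  ≈⟨ sum-cong (λ i → *-congˡ (det-ᵀ λ i′ j → A (punchIn i i′) (suc j))) ⟩
    sum (λ i → (sgn (toℕ i) * A i zero) * det (λ i′ j → A (punchIn i i′) (suc j))) ≈⟨ expand-column A ⟨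
    det A                                                                         ∎

  -- In the expansion along the first row the terms of the two equal columns have equal minors and
  -- opposite signs. Every other minor still contains both columns and vanishes by induction on the
  -- size.
  det-columns₀₁ : ∀ {r} {A : Square (suc (suc r))} → (∀ i → A i zero ≈ A i (suc zero)) → det A ≈ 0#
  det-columns₀₁ {r} {A} p = begin
    det A                                                      ≈⟨ expand-row A ⟩
    sum t                                                      ≈⟨ trans (sum-suc t) (+-cong refl (sum-suc _)) ⟩
    t zero + (t (suc zero) + sum (λ j → t (suc (suc j))))      ≈⟨ +-cong t₀≈-t₁ (trans (+-cong refl (sum-zero rest)) (+-identityʳ _)) ⟩
    - t (suc zero) + t (suc zero)                              ≈⟨ -‿inverseˡ _ ⟩
    0#                                                         ∎
    where
    t : Fin (suc (suc r)) → Poly V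
    t j = (sgn (toℕ j) * A zero j) * det (minorAt A j)

    t₀≈-t₁ : t zero ≈ - t (suc zero)
    t₀≈-t₁ = begin
      (sgn 0 * A zero zero) * det (minorAt A zero)
        ≈⟨ *-cong (*-congˡ (p zero)) (det-cong λ { i zero → sym (p (suc i)) ; i (suc j) → refl }) ⟩
      (sgn 0 * A zero (suc zero)) * det (minorAt A (suc zero))            ≈⟨ -‿involutive _ ⟨
      - - ((sgn 0 * A zero (suc zero)) * det (minorAt A (suc zero)))
        ≈⟨ -‿cong (trans (-‿distribˡ-* _ _) (*-congʳ (trans (-‿distribˡ-* _ _) (*-congʳ (sym (sgn-suc 0)))))) ⟩
      - t (suc zero)                                                      ∎

    rest : ∀ j → t (suc (suc j)) ≈ 0#
    rest = vanish-rest A p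
      where
      -- The size is generalized here, so that the presence of a third column can be matched on and
      -- the minor has visibly two columns.
      vanish-rest : ∀ {r} (A : Square (suc (suc r))) → (∀ i → A i zero ≈ A i (suc zero)) →
             ∀ j → (sgn (toℕ (suc (suc j))) * A zero (suc (suc j))) * det (minorAt A (suc (suc j))) ≈ 0#
      vanish-rest {suc r} A p j = trans (*-congˡ (det-columns₀₁ λ i → p (suc i))) (zeroʳ _)

  det-rows₀₁ : ∀ {r} {A : Square (suc (suc r))} → (∀ j → A zero j ≈ A (suc zero) j) → det A ≈ 0#
  det-rows₀₁ {A = A} p = trans (sym (det-ᵀ A)) (det-columns₀₁ p)

  swap₀₁ : ∀ {r} → Fin (suc (suc r)) → Fin (suc (suc r))
  swap₀₁ zero          = suc zero
  swap₀₁ (suc zero)    = zero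
  swap₀₁ (suc (suc i)) = suc (suc i)

  -- Polarization: the determinant vanishes with a + b in both of the first two rows, and likewise
  -- with a twice or b twice; what is left of the bilinear expansion is the sum of the two orders.
  det-swap₀₁ : ∀ {r} (A : Square (suc (suc r))) → det (A ∘ swap₀₁) ≈ - det A
  det-swap₀₁ {r} A = begin
    det (A ∘ swap₀₁)                             ≈⟨ det-cong (λ { zero _ → refl ; (suc zero) _ → refl ; (suc (suc _)) _ → refl }) ⟩
    det (M b a)                                  ≈⟨ +-identityʳ _ ⟨
    det (M b a) + 0#                             ≈⟨ +-cong refl (-‿inverseʳ _) ⟨
    det (M b a) + (det (M a b) + - det (M a b))  ≈⟨ +-assoc _ _ _ ⟨
    (det (M b a) + det (M a b)) + - det (M a b)  ≈⟨ +-cong sum≈0 refl ⟩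
    0# + - det (M a b)                           ≈⟨ +-identityˡ _ ⟩
    - det (M a b)                                ≈⟨ -‿cong (det-cong (λ { zero _ → refl ; (suc zero) _ → refl ; (suc (suc _)) _ → refl })) ⟩
    - det A                                      ∎
    where
    a b : Fin (suc (suc r)) → Poly V
    a = A zero
    b = A (suc zero)
    _⊹_ : (v w : Fin (suc (suc r)) → Poly V) → Fin (suc (suc r)) → Poly V
    (v ⊹ w) j = 1# * v j + w j
    M : (v w : Fin (suc (suc r)) → Poly V) → Square (suc (suc r))
    M v w zero          = v
    M v w (suc zero)    = w
    M v w (suc (suc i)) = A (suc (suc i))

    linear₀ : ∀ v v′ w → det (M (v ⊹ v′) w) ≈ det (M v w) + det (M v′ w)
    linear₀ v v′ w = trans (det-linear zero 1# (λ _ → refl)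
      (λ { zero p _ → contradiction ≡.refl p ; (suc zero) _ _ → refl ; (suc (suc _)) _ _ → refl })
      (λ { zero p _ → contradiction ≡.refl p ; (suc zero) _ _ → refl ; (suc (suc _)) _ _ → refl }))
      (+-cong (*-identityˡ _) refl)
    linear₁ : ∀ v w w′ → det (M v (w ⊹ w′)) ≈ det (M v w) + det (M v w′)
    linear₁ v w w′ = trans (det-linear (suc zero) 1# (λ _ → refl)
      (λ { (suc zero) p _ → contradiction ≡.refl p ; zero _ _ → refl ; (suc (suc _)) _ _ → refl })
      (λ { (suc zero) p _ → contradiction ≡.refl p ; zero _ _ → refl ; (suc (suc _)) _ _ → refl }))
      (+-cong (*-identityˡ _) refl)

    sum≈0 : det (M b a) + det (M a b) ≈ 0#
    sum≈0 = begin
      det (M b a) + det (M a b)                                      ≈⟨ +-cong (+-identityʳ _) (+-identityˡ _) ⟨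
      (det (M b a) + 0#) + (0# + det (M a b))                        ≈⟨ +-cong (+-cong refl (det-rows₀₁ λ _ → refl)) (+-cong (det-rows₀₁ λ _ → refl) refl) ⟨
      (det (M b a) + det (M b b)) + (det (M a a) + det (M a b))      ≈⟨ +-cong (linear₁ b a b) (linear₁ a a b) ⟨
      det (M b (a ⊹ b)) + det (M a (a ⊹ b))                          ≈⟨ +-comm _ _ ⟩
      det (M a (a ⊹ b)) + det (M b (a ⊹ b))                          ≈⟨ linear₀ a b (a ⊹ b) ⟨
      det (M (a ⊹ b) (a ⊹ b))                                        ≈⟨ det-rows₀₁ (λ _ → refl) ⟩
      0#                                                             ∎

  private
    det-minors-zero : ∀ {r} (A : Square (suc r)) → (∀ j → det (minorAt A j) ≈ 0#) → det A ≈ 0#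
    det-minors-zero A p = trans (expand-row A) (sum-zero λ j → trans (*-congˡ (p j)) (zeroʳ _))

  -- Two equal rows below the first persist in every minor of the expansion. If one of them is the
  -- first row and they are not adjacent, exchanging the first two rows moves it down.
  det-rows : ∀ {r} (i j : Fin r) {A : Square r} → i ≢ j → (∀ l → A i l ≈ A j l) → det A ≈ 0#
  det-rows zero          zero          i≢j p = contradiction ≡.refl i≢j
  det-rows zero          (suc zero)    i≢j p = det-rows₀₁ p
  det-rows (suc zero)    zero          i≢j p = det-rows₀₁ λ l → sym (p l)
  det-rows (suc i)       (suc j)   {A} i≢j p = det-minors-zero A λ l → det-rows i j (i≢j ∘ ≡.cong suc) λ l′ → p (punchIn l l′)
  det-rows zero          (suc (suc j)) {A} i≢j p = begin
    det A                     ≈⟨ -‿involutive _ ⟨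
    - - det A                 ≈⟨ -‿cong (det-swap₀₁ A) ⟨
    - det (A ∘ swap₀₁)        ≈⟨ -‿cong (det-minors-zero (A ∘ swap₀₁) λ l → det-rows zero (suc j) (λ ()) λ l′ → p (punchIn l l′)) ⟩
    - 0#                      ≈⟨ -0#≈0# ⟩
    0#                        ∎
  det-rows (suc (suc i)) zero      {A} i≢j p = begin
    det A                     ≈⟨ -‿involutive _ ⟨
    - - det A                 ≈⟨ -‿cong (det-swap₀₁ A) ⟨
    - det (A ∘ swap₀₁)        ≈⟨ -‿cong (det-minors-zero (A ∘ swap₀₁) λ l → det-rows (suc i) zero (λ ()) λ l′ → p (punchIn l l′)) ⟩
    - 0#                      ≈⟨ -0#≈0# ⟩
    0#                        ∎

  det-columns : ∀ {r} (i j : Fin r) {A : Square r} → i ≢ j → (∀ l → A l i ≈ A l j) → det A ≈ 0#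
  det-columns i j {A} i≢j p = trans (sym (det-ᵀ A)) (det-rows i j i≢j p)

  -- The block of zeros has j + 1 rows and r - j columns, in all one more than the size r. In the
  -- expansion along the first row, a column of the block contributes a zero entry, and a column
  -- left of it leaves a minor with a block of the same kind.
  det-zero-block : ∀ {r} (A : Square r) (j : Fin r) → (∀ i l → i Fin.≤ j → j Fin.≤ l → A i l ≈ 0#) → det A ≈ 0#
  det-zero-block A zero    p = det-zero-row zero {A} λ l → p zero l z≤n z≤n
  det-zero-block {suc (suc r)} A (suc j) p = trans (expand-row A) (sum-zero term)
    where
    term : ∀ l → (sgn (toℕ l) * A zero l) * det (minorAt A l) ≈ 0#
    term l with toℕ l ℕ.≤? toℕ j
    ... | no  l≰j = trans (*-congʳ (trans (*-congˡ (p zero l z≤n (ℕ.≰⇒> l≰j))) (zeroʳ _))) (zeroˡ _)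
    ... | yes l≤j = trans (*-congˡ (det-zero-block (minorAt A l) j λ i l′ i≤j j≤l′ →
      trans (reflexive (≡.cong (A (suc i)) (punchIn-≤ l l′ (ℕ.≤-trans (ℕ.≤-trans l≤j j≤l′) (ℕ.≤-reflexive (≡.sym (Fin.toℕ-inject₁ l′)))))))
            (p (suc i) (suc l′) (s≤s i≤j) (s≤s j≤l′)))) (zeroʳ _)

  lastFirst : ∀ {a} {X : Set a} {r} → (Fin (suc r) → X) → Fin (suc r) → X
  lastFirst f zero    = f (fromℕ _)
  lastFirst f (suc i) = f (inject₁ i)

  -- After an exchange of the first two rows, the first row of `A` is on top again and each minor is
  -- the rotation of a minor of `A`. So every step of the induction contributes one sign.
  det-lastFirst : ∀ {r} (A : Square (suc r)) → det (lastFirst A) ≈ sgn r * det A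
  det-lastFirst {zero}  A = trans (det-cong {A = lastFirst A} {A} λ { zero _ → refl }) (trans (sym (*-identityˡ _)) (*-congʳ (sym sgn-0)))
  det-lastFirst {suc r} A = begin
    det B                             ≈⟨ -‿involutive _ ⟨
    - - det B                         ≈⟨ -‿cong (det-swap₀₁ B) ⟨
    - det (B ∘ swap₀₁)                ≈⟨ -‿cong (expand-row (B ∘ swap₀₁)) ⟩
    - sum (λ j → (sgn (toℕ j) * A zero j) * det (minorAt (B ∘ swap₀₁) j))
      ≈⟨ -‿cong (sum-cong λ j → trans (*-congˡ (trans (det-cong {A = minorAt (B ∘ swap₀₁) j} {lastFirst (minorAt A j)} λ { zero _ → refl ; (suc _) _ → refl })
                                                       (det-lastFirst (minorAt A j)))) (x∙yz≈y∙xz _ (sgn r) _)) ⟩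
    - sum (λ j → sgn r * ((sgn (toℕ j) * A zero j) * det (minorAt A j)))   ≈⟨ -‿cong (*-sum (sgn r) _) ⟨
    - (sgn r * sum (λ j → (sgn (toℕ j) * A zero j) * det (minorAt A j)))   ≈⟨ -‿cong (*-congˡ (expand-row A)) ⟨
    - (sgn r * det A)                                                      ≈⟨ trans (-‿distribˡ-* _ _) (*-congʳ (sym (sgn-suc r))) ⟩
    sgn (suc r) * det A                                                    ∎
    where B = lastFirst A

  -- The term of the last column vanishes in the expansion along the first row, and all other minors
  -- keep the last column in last place, so the corner entry comes out of each of them without a
  -- sign.
  det-corner : ∀ {r} (A : Square (suc r)) → (∀ i → A (inject₁ i) (fromℕ r) ≈ 0#) →
               det A ≈ A (fromℕ r) (fromℕ r) * det (λ i j → A (inject₁ i) (inject₁ j))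
  det-corner {zero}  A p = trans (expand-row A) (trans (sum-suc _) (trans (+-cong (*-cong (trans (*-congʳ sgn-0) (*-identityˡ _)) (trans det₀ (sym det₀))) (sum-zero λ ())) (+-identityʳ _)))
  det-corner {suc r} A p = begin
    det A                                                                    ≈⟨ expand-row A ⟩
    sum (λ j → (sgn (toℕ j) * A zero j) * det (minorAt A j))                 ≈⟨ sum-last _ ⟩
    sum (λ j → (sgn (toℕ (inject₁ j)) * A zero (inject₁ j)) * det (minorAt A (inject₁ j))) + (sgn (toℕ (fromℕ (suc r))) * A zero (fromℕ (suc r))) * det (minorAt A (fromℕ (suc r)))
      ≈⟨ +-cong (sum-cong term) (trans (*-congʳ (trans (*-congˡ (p zero)) (zeroʳ _))) (zeroˡ _)) ⟩
    sum (λ j → q * ((sgn (toℕ j) * C zero j) * det (minorAt C j))) + 0#      ≈⟨ +-identityʳ _ ⟩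
    sum (λ j → q * ((sgn (toℕ j) * C zero j) * det (minorAt C j)))           ≈⟨ *-sum q _ ⟨
    q * sum (λ j → (sgn (toℕ j) * C zero j) * det (minorAt C j))             ≈⟨ *-congˡ (expand-row C) ⟨
    q * det C                                                                ∎
    where
    q = A (fromℕ (suc r)) (fromℕ (suc r))
    C : Square (suc r)
    C i j = A (inject₁ i) (inject₁ j)
    term : ∀ j → (sgn (toℕ (inject₁ j)) * A zero (inject₁ j)) * det (minorAt A (inject₁ j)) ≈ q * ((sgn (toℕ j) * C zero j) * det (minorAt C j))
    term j = begin
      (sgn (toℕ (inject₁ j)) * A zero (inject₁ j)) * det (minorAt A (inject₁ j))
        ≈⟨ *-cong (*-congʳ (reflexive (≡.cong sgn (Fin.toℕ-inject₁ j))))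
             (det-corner (minorAt A (inject₁ j)) λ i → trans (reflexive (≡.cong (A (suc (inject₁ i))) (punchIn-fromℕ j))) (p (suc i))) ⟩
      (sgn (toℕ j) * C zero j) * (A (suc (fromℕ r)) (punchIn (inject₁ j) (fromℕ r)) * det (λ i j′ → A (suc (inject₁ i)) (punchIn (inject₁ j) (inject₁ j′))))
        ≈⟨ *-congˡ (*-cong (reflexive (≡.cong (A (suc (fromℕ r))) (punchIn-fromℕ j)))
             (det-cong λ i j′ → reflexive (≡.cong (A (suc (inject₁ i))) (punchIn-inject₁ j j′)))) ⟩
      (sgn (toℕ j) * C zero j) * (q * det (minorAt C j))             ≈⟨ x∙yz≈y∙xz _ q _ ⟩
      q * ((sgn (toℕ j) * C zero j) * det (minorAt C j))             ∎

  -- Replacing rows and columns; cofactors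

  row-≡ : ∀ {r s} (A : Fin r → Fin s → Poly V) i ρ j → (A [ i ]≔ ρ) i j ≈ ρ j
  row-≡ A i ρ j = reflexive (≡.cong (λ v → v j) (updateAt-updates i A))

  row-≢ : ∀ {r s} (A : Fin r → Fin s → Poly V) {i p} ρ → p ≢ i → ∀ j → (A [ i ]≔ ρ) p j ≈ A p j
  row-≢ A {i} {p} ρ p≢i j = reflexive (≡.cong (λ v → v j) (updateAt-minimal p i A p≢i))

  replaceColumn : ∀ {r} → Square r → Fin r → (Fin r → Poly V) → Square r
  replaceColumn A l x i = A i [ l ]≔ x i

  column-≡ : ∀ {r} (A : Square r) l x i → replaceColumn A l x i l ≈ x i
  column-≡ A l x i = reflexive (updateAt-updates l (A i))

  column-≢ : ∀ {r} (A : Square r) {l j} x → j ≢ l → ∀ i → replaceColumn A l x i j ≈ A i j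
  column-≢ A {l} {j} x j≢l i = reflexive (updateAt-minimal j l (A i) j≢l)

  replaceColumn-ᵀ : ∀ {r} (A : Square r) l x i j → replaceColumn A l x j i ≈ (A ᵀ [ l ]≔ x) i j
  replaceColumn-ᵀ A l x i j with i Fin.≟ l
  ... | yes ≡.refl = trans (column-≡ A l x j) (sym (row-≡ (A ᵀ) l x j))
  ... | no  i≢l    = trans (column-≢ A x i≢l j) (sym (row-≢ (A ᵀ) x i≢l j))

  det-linear-≔ : ∀ {r} (A : Square r) i {ρ ρ₁ ρ₂} q → (∀ j → ρ j ≈ q * ρ₁ j + ρ₂ j) →
                 det (A [ i ]≔ ρ) ≈ q * det (A [ i ]≔ ρ₁) + det (A [ i ]≔ ρ₂)
  det-linear-≔ A i {ρ} {ρ₁} {ρ₂} q eq = det-linear i q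
    (λ j → trans (row-≡ A i ρ j) (trans (eq j) (sym (+-cong (*-congˡ (row-≡ A i ρ₁ j)) (row-≡ A i ρ₂ j)))))
    (λ p p≢i j → trans (row-≢ A ρ₁ p≢i j) (sym (row-≢ A ρ p≢i j)))
    (λ p p≢i j → trans (row-≢ A ρ₂ p≢i j) (sym (row-≢ A ρ p≢i j)))

  det-≔-cong : ∀ {r} (A : Square r) i {ρ ρ′} → (∀ j → ρ j ≈ ρ′ j) → det (A [ i ]≔ ρ) ≈ det (A [ i ]≔ ρ′)
  det-≔-cong A i {ρ} {ρ′} eq = det-cong go
    where
    go : ∀ p j → (A [ i ]≔ ρ) p j ≈ (A [ i ]≔ ρ′) p j
    go p j with p Fin.≟ i
    ... | yes ≡.refl = trans (row-≡ A i ρ j) (trans (eq j) (sym (row-≡ A i ρ′ j)))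
    ... | no  p≢i    = trans (row-≢ A ρ p≢i j) (sym (row-≢ A ρ′ p≢i j))

  det-≔-self : ∀ {r} (A : Square r) i → det (A [ i ]≔ A i) ≈ det A
  det-≔-self A i = det-cong go
    where
    go : ∀ p j → (A [ i ]≔ A i) p j ≈ A p j
    go p j with p Fin.≟ i
    ... | yes ≡.refl = row-≡ A i (A i) j
    ... | no  p≢i    = row-≢ A (A i) p≢i j

  det-≔-0 : ∀ {r} (A : Square r) i {ρ} → (∀ j → ρ j ≈ 0#) → det (A [ i ]≔ ρ) ≈ 0#
  det-≔-0 A i {ρ} eq = det-zero-row i λ j → trans (row-≡ A i ρ j) (eq j)

  det-≔-sum : ∀ {r m} (A : Square r) i (q : Fin m → Poly V) (ρ : Fin m → Fin r → Poly V) →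
              det (A [ i ]≔ λ j → sum λ t → q t * ρ t j) ≈ sum λ t → q t * det (A [ i ]≔ ρ t)
  det-≔-sum {m = zero}  A i q ρ = trans (det-≔-0 A i λ j → sum-zero λ ()) (sym (sum-zero λ ()))
  det-≔-sum {m = suc m} A i q ρ = begin
    det (A [ i ]≔ λ j → sum λ t → q t * ρ t j)
      ≈⟨ det-linear-≔ A i (q zero) (λ j → sum-suc λ t → q t * ρ t j) ⟩
    q zero * det (A [ i ]≔ ρ zero) + det (A [ i ]≔ λ j → sum λ t → q (suc t) * ρ (suc t) j)
      ≈⟨ +-cong refl (det-≔-sum A i (q ∘ suc) (ρ ∘ suc)) ⟩
    q zero * det (A [ i ]≔ ρ zero) + sum (λ t → q (suc t) * det (A [ i ]≔ ρ (suc t)))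
      ≈⟨ sum-suc _ ⟨
    sum (λ t → q t * det (A [ i ]≔ ρ t)) ∎

  sum-single : ∀ {m} {f : Fin m → Poly V} i → (∀ j → j ≢ i → f j ≈ 0#) → sum f ≈ f i
  sum-single {suc m} {f} zero    p = trans (sum-suc f) (trans (+-cong refl (sum-zero λ j → p (suc j) λ ())) (+-identityʳ _))
  sum-single {suc m} {f} (suc i) p = trans (sum-suc f) (trans (+-cong (p zero λ ()) (sum-single i λ j j≢i → p (suc j) (j≢i ∘ Fin.suc-injective))) (+-identityˡ _))

  unit : ∀ {r} → Fin r → Fin r → Poly V
  unit i j with i Fin.≟ j
  ... | yes _ = 1#
  ... | no  _ = 0#

  unit-≡ : ∀ {r} (i : Fin r) → unit i i ≈ 1#
  unit-≡ i with i Fin.≟ i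
  ... | yes _   = refl
  ... | no  i≢i = contradiction ≡.refl i≢i

  unit-≢ : ∀ {r} {i j : Fin r} → i ≢ j → unit i j ≈ 0#
  unit-≢ {i = i} {j} i≢j with i Fin.≟ j
  ... | yes i≡j = contradiction i≡j i≢j
  ... | no  _   = refl

  sum-unit : ∀ {r} (x : Fin r → Poly V) j → x j ≈ sum λ i → x i * unit i j
  sum-unit x j = sym (trans (sum-single j λ i i≢j → trans (*-congˡ (unit-≢ i≢j)) (zeroʳ _))
                            (trans (*-congˡ (unit-≡ j)) (*-identityʳ _)))

  -- Row `p` is the unit row plus a remainder that is 0 in column `l`. With the remainder in row `p`
  -- the whole column `l` is 0, so it does not contribute.
  det-unit-column : ∀ {r} (A : Square r) p l →
                    det (replaceColumn A l (unit p)) ≈ det (replaceColumn A l (unit p) [ p ]≔ unit l)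
  det-unit-column {r} A p l = begin
    det Y                                          ≈⟨ det-≔-self Y p ⟨
    det (Y [ p ]≔ Y p)                             ≈⟨ det-linear-≔ Y p 1# split ⟩
    1# * det (Y [ p ]≔ unit l) + det (Y [ p ]≔ Y₀) ≈⟨ +-cong (*-identityˡ _) column-zero ⟩
    det (Y [ p ]≔ unit l) + 0#                     ≈⟨ +-identityʳ _ ⟩
    det (Y [ p ]≔ unit l)                          ∎
    where
    Y : Square r
    Y = replaceColumn A l (unit p)
    Y₀ : Fin r → Poly V
    Y₀ = Y p [ l ]≔ 0#

    split : ∀ j → Y p j ≈ 1# * unit l j + Y₀ j
    split j with j Fin.≟ l
    ... | yes ≡.refl = trans (trans (column-≡ A l (unit p) p) (unit-≡ p)) (sym (trans (+-cong (trans (*-identityˡ _) (unit-≡ l)) (reflexive (updateAt-updates l (Y p)))) (+-identityʳ _)))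
    ... | no  j≢l    = sym (trans (+-cong (trans (*-identityˡ _) (unit-≢ (j≢l ∘ ≡.sym))) (reflexive (updateAt-minimal j l (Y p) j≢l))) (+-identityˡ _))

    column-zero : det (Y [ p ]≔ Y₀) ≈ 0#
    column-zero = trans (sym (det-ᵀ (Y [ p ]≔ Y₀))) (det-zero-row l entry)
      where
      entry : ∀ i → (Y [ p ]≔ Y₀) i l ≈ 0#
      entry i with i Fin.≟ p
      ... | yes ≡.refl = trans (row-≡ Y p Y₀ l) (reflexive (updateAt-updates l (Y p)))
      ... | no  i≢p    = trans (row-≢ Y Y₀ i≢p l) (trans (column-≡ A l (unit p) i) (unit-≢ (i≢p ∘ ≡.sym)))

  -- Both sides are the cofactor of the entry (p, l), encoded by a unit row or a unit column instead
  -- of a sign and a punched-out minor. They meet in the matrix where both the row and the column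
  -- are replaced.
  det-unit : ∀ {r} (A : Square r) p l → det (A [ p ]≔ unit l) ≈ det (replaceColumn A l (unit p))
  det-unit A p l = begin
    det (A [ p ]≔ unit l)                                         ≈⟨ det-ᵀ (A [ p ]≔ unit l) ⟨
    det ((A [ p ]≔ unit l) ᵀ)                                     ≈⟨ det-cong (λ i j → sym (replaceColumn-ᵀ (A ᵀ) p (unit l) j i)) ⟩
    det (replaceColumn (A ᵀ) p (unit l))                          ≈⟨ det-unit-column (A ᵀ) l p ⟩
    det (replaceColumn (A ᵀ) p (unit l) [ l ]≔ unit p)            ≈⟨ det-ᵀ _ ⟨
    det ((replaceColumn (A ᵀ) p (unit l) [ l ]≔ unit p) ᵀ)        ≈⟨ det-cong entry ⟩
    det (replaceColumn A l (unit p) [ p ]≔ unit l)                ≈⟨ det-unit-column A p l ⟨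
    det (replaceColumn A l (unit p))                              ∎
    where
    entry : ∀ i j → (replaceColumn (A ᵀ) p (unit l) [ l ]≔ unit p) j i ≈ (replaceColumn A l (unit p) [ p ]≔ unit l) i j
    entry i j with i Fin.≟ p | j Fin.≟ l
    ... | yes ≡.refl | yes ≡.refl = trans (row-≡ (replaceColumn (A ᵀ) p (unit l)) l (unit p) p) (trans (unit-≡ p) (sym (trans (row-≡ (replaceColumn A l (unit p)) p (unit l) l) (unit-≡ l))))
    ... | yes ≡.refl | no  j≢l    = trans (row-≢ (replaceColumn (A ᵀ) p (unit l)) (unit p) j≢l p) (trans (column-≡ (A ᵀ) p (unit l) j) (sym (row-≡ (replaceColumn A l (unit p)) p (unit l) j)))
    ... | no  i≢p    | yes ≡.refl = trans (row-≡ (replaceColumn (A ᵀ) p (unit l)) l (unit p) i) (sym (trans (row-≢ (replaceColumn A l (unit p)) (unit l) i≢p l) (column-≡ A l (unit p) i)))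
    ... | no  i≢p    | no  j≢l    = trans (row-≢ (replaceColumn (A ᵀ) p (unit l)) (unit p) j≢l i) (trans (column-≢ (A ᵀ) (unit l) i≢p j) (sym (trans (row-≢ (replaceColumn A l (unit p)) (unit l) i≢p j) (column-≢ A (unit p) j≢l i))))

  -- Both sides are the sum of all c l * x p * cofactor p l.

  det-replace : ∀ {r} (A : Square r) (c x : Fin r → Poly V) →
                sum (λ l → c l * det (replaceColumn A l x)) ≈ sum λ p → x p * det (A [ p ]≔ c)
  det-replace A c x = begin
    sum (λ l → c l * det (replaceColumn A l x))
      ≈⟨ sum-cong (λ l → *-congˡ (columns l)) ⟩
    sum (λ l → c l * sum λ p → x p * det (A [ p ]≔ unit l))
      ≈⟨ sum-cong (λ l → *-sum (c l) _) ⟩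
    sum (λ l → sum λ p → c l * (x p * det (A [ p ]≔ unit l)))
      ≈⟨ sum-comm _ ⟩
    sum (λ p → sum λ l → c l * (x p * det (A [ p ]≔ unit l)))
      ≈⟨ sum-cong (λ p → sum-cong λ l → x∙yz≈y∙xz (c l) (x p) _) ⟩
    sum (λ p → sum λ l → x p * (c l * det (A [ p ]≔ unit l)))
      ≈⟨ sum-cong (λ p → *-sum (x p) _) ⟨
    sum (λ p → x p * sum λ l → c l * det (A [ p ]≔ unit l))
      ≈⟨ sum-cong (λ p → *-congˡ (trans (det-≔-cong A p (sum-unit c)) (det-≔-sum A p c unit))) ⟨
    sum (λ p → x p * det (A [ p ]≔ c)) ∎
    where
    columns : ∀ l → det (replaceColumn A l x) ≈ sum λ p → x p * det (A [ p ]≔ unit l)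
    columns l = begin
      det (replaceColumn A l x)                    ≈⟨ det-ᵀ (replaceColumn A l x) ⟨
      det (replaceColumn A l x ᵀ)                  ≈⟨ det-cong (replaceColumn-ᵀ A l x) ⟩
      det (A ᵀ [ l ]≔ x)                           ≈⟨ det-≔-cong (A ᵀ) l (sum-unit x) ⟩
      det (A ᵀ [ l ]≔ λ j → sum λ p → x p * unit p j) ≈⟨ det-≔-sum (A ᵀ) l x unit ⟩
      sum (λ p → x p * det (A ᵀ [ l ]≔ unit p))    ≈⟨ sum-cong (λ p → *-congˡ (trans (det-unit (A ᵀ) l p) (det-cong λ i j → replaceColumn-ᵀ (A ᵀ) p (unit l) j i))) ⟩
      sum (λ p → x p * det ((A [ p ]≔ unit l) ᵀ))  ≈⟨ sum-cong (λ p → *-congˡ (det-ᵀ (A [ p ]≔ unit l))) ⟩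
      sum (λ p → x p * det (A [ p ]≔ unit l))      ∎

  det-≔-scale : ∀ {r} (A : Square r) i q ρ → det (A [ i ]≔ λ j → q * ρ j) ≈ q * det (A [ i ]≔ ρ)
  det-≔-scale A i q ρ = begin
    det (A [ i ]≔ λ j → q * ρ j)                          ≈⟨ det-linear-≔ A i q (λ j → sym (+-identityʳ _)) ⟩
    q * det (A [ i ]≔ ρ) + det (A [ i ]≔ λ _ → 0#)        ≈⟨ +-cong refl (det-≔-0 A i λ _ → refl) ⟩
    q * det (A [ i ]≔ ρ) + 0#                             ≈⟨ +-identityʳ _ ⟩
    q * det (A [ i ]≔ ρ)                                  ∎

  det-≔-row : ∀ {r} (A : Square r) {i p} → p ≢ i → det (A [ i ]≔ A p) ≈ 0#
  det-≔-row A {i} {p} p≢i = det-rows p i p≢i λ j → trans (row-≢ A (A p) p≢i j) (sym (row-≡ A i (A p) j))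

  -- Matrices whose rows above row `j` vanish from column `j` on

  module Block {r} (j : Fin r) where

    Vanishes : Square r → Set _
    Vanishes A = ∀ i l → i Fin.< j → j Fin.≤ l → A i l ≈ 0#

    -- The difference of the two candidates for row `j` vanishes from column `j` on and so completes
    -- the zeros above it to the block of `det-zero-block`.
    det-≔-mod : ∀ (A : Square r) {ρ ρ′} → Vanishes A → (∀ l → j Fin.≤ l → ρ l ≈ ρ′ l) →
                det (A [ j ]≔ ρ) ≈ det (A [ j ]≔ ρ′)
    det-≔-mod A {ρ} {ρ′} van eq = begin
      det (A [ j ]≔ ρ)                                      ≈⟨ det-linear-≔ A j 1# (λ l → sym (rearrange (ρ l) (ρ′ l))) ⟩
      1# * det (A [ j ]≔ ρ′) + det (A [ j ]≔ difference)    ≈⟨ +-cong (*-identityˡ _) (det-zero-block (A [ j ]≔ difference) j entry) ⟩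
      det (A [ j ]≔ ρ′) + 0#                                ≈⟨ +-identityʳ _ ⟩
      det (A [ j ]≔ ρ′)                                     ∎
      where
      difference : Fin r → Poly V
      difference l = ρ l + - ρ′ l
      rearrange : ∀ a b → 1# * b + (a + - b) ≈ a
      rearrange a b = begin
        1# * b + (a + - b)   ≈⟨ +-cong (*-identityˡ b) (+-comm a (- b)) ⟩
        b + (- b + a)        ≈⟨ +-assoc b (- b) a ⟨
        (b + - b) + a        ≈⟨ +-cong (-‿inverseʳ b) refl ⟩
        0# + a               ≈⟨ +-identityˡ a ⟩
        a                    ∎
      entry : ∀ i l → i Fin.≤ j → j Fin.≤ l → (A [ j ]≔ difference) i l ≈ 0#
      entry i l i≤j j≤l with i Fin.≟ j
      ... | yes ≡.refl = trans (row-≡ A j difference l) (trans (+-cong (eq l j≤l) refl) (-‿inverseʳ _))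
      ... | no  i≢j    = trans (row-≢ A difference i≢j l) (van i l (ℕ.≤∧≢⇒< i≤j (i≢j ∘ Fin.toℕ-injective)) j≤l)

    module _ {A : Square r} {κ : Fin r → Poly V} (van : Vanishes A) where

      det-≔-multiple : ∀ {q ρ} → (∀ l → j Fin.≤ l → ρ l ≈ q * κ l) → det (A [ j ]≔ ρ) ≈ q * det (A [ j ]≔ κ)
      det-≔-multiple {q} eq = trans (det-≔-mod A van eq) (det-≔-scale A j q κ)

      det-multiple : ∀ {q} → (∀ l → j Fin.≤ l → A j l ≈ q * κ l) → det A ≈ q * det (A [ j ]≔ κ)
      det-multiple eq = trans (sym (det-≔-self A j)) (det-≔-multiple eq)

      -- From column `j` on, q κ is row `p`. Putting it into row `j` therefore amounts to having row
      -- `p` twice.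
      det-proportional : ∀ {q p} → p ≢ j → (∀ l → j Fin.≤ l → A p l ≈ q * κ l) → q * det (A [ j ]≔ κ) ≈ 0#
      det-proportional p≢j eq = trans (sym (det-≔-multiple eq)) (det-≔-row A p≢j)

    -- A replacement below row `j` leaves the zeros above row `j` intact, so row `j` may still be
    -- rewritten as q κ, and κ then occurs twice.
    det-replaced : ∀ {A : Square r} {κ : Fin r → Poly V} {q} → Vanishes A → (∀ l → j Fin.≤ l → A j l ≈ q * κ l) →
                   ∀ {p} → j Fin.< p → det (A [ p ]≔ κ) ≈ 0#
    det-replaced {A} {κ} {q} van eq {p} j<p = begin
      det B                    ≈⟨ det-multiple {B} {κ} van-B (λ l j≤l → trans (row-≢ A κ j≢p l) (eq l j≤l)) ⟩
      q * det (B [ j ]≔ κ)     ≈⟨ *-congˡ (det-rows j p j≢p λ l → trans (row-≡ B j κ l) (sym (trans (row-≢ B κ (j≢p ∘ ≡.sym) l) (row-≡ A p κ l)))) ⟩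
      q * 0#                   ≈⟨ zeroʳ q ⟩
      0#                       ∎
      where
      B : Square r
      B = A [ p ]≔ κ
      j≢p : j ≢ p
      j≢p ≡.refl = ℕ.<-irrefl ≡.refl j<p
      van-B : Vanishes B
      van-B i l i<j j≤l = trans (row-≢ A κ (λ { ≡.refl → ℕ.<-asym i<j j<p }) l) (van i l i<j j≤l)

-- The elements of a column and the removal of its largest one

element-∈ : ∀ {N} (a : Column N) i → element a i ∈ a
element-∈ (inside  ∷ a) zero    = here
element-∈ (inside  ∷ a) (suc i) = there (element-∈ a i)
element-∈ (outside ∷ a) i       = there (element-∈ a i)

element-surjective : ∀ {N} (a : Column N) {p} → p ∈ a → ∃ λ i → element a i ≡ p
element-surjective (inside  ∷ a) here        = zero , ≡.refl
element-surjective (inside  ∷ a) (there p∈a) = let i , eq = element-surjective a p∈a in suc i , ≡.cong suc eq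
element-surjective (outside ∷ a) (there p∈a) = let i , eq = element-surjective a p∈a in i , ≡.cong suc eq

element-mono-< : ∀ {N} (a : Column N) {i j} → i Fin.< j → element a i Fin.< element a j
element-mono-< (inside  ∷ a) {zero}  {suc j} _         = s≤s z≤n
element-mono-< (inside  ∷ a) {suc i} {suc j} (s≤s i<j) = s≤s (element-mono-< a i<j)
element-mono-< (outside ∷ a) {i}     {j}     i<j       = s≤s (element-mono-< a i<j)

element-mono-≤ : ∀ {N} (a : Column N) {i j} → i Fin.≤ j → element a i Fin.≤ element a j
element-mono-≤ a {i} {j} i≤j with i Fin.≟ j
... | yes ≡.refl = ℕ.≤-refl
... | no  i≢j    = ℕ.<⇒≤ (element-mono-< a (ℕ.≤∧≢⇒< i≤j (i≢j ∘ Fin.toℕ-injective)))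

size-remove : ∀ {N} (a : Column N) {k} → k ∈ a → (∀ {i} → i ∈ a → i Fin.≤ k) → suc ∣ a - k ∣ ≡ ∣ a ∣
size-remove (inside  ∷ a) here          top = ≡.cong (suc ∘ ∣_∣) (p─⊥≡p a)
size-remove (inside  ∷ a) (there k∈a) top = ≡.cong suc (size-remove a k∈a (ℕ.≤-pred ∘ top ∘ there))
size-remove (outside ∷ a) (there k∈a) top = size-remove a k∈a (ℕ.≤-pred ∘ top ∘ there)

element-last : ∀ {N} (a : Column N) {k} → k ∈ a → (∀ {i} → i ∈ a → i Fin.≤ k) →
               (eq : suc ∣ a - k ∣ ≡ ∣ a ∣) → element a (cast eq (fromℕ _)) ≡ k
element-last a {k} k∈a top eq with element-surjective a k∈a
... | i , ≡.refl = Fin.toℕ-injective (ℕ.≤-antisym (top (element-∈ a _)) (element-mono-≤ a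
        (ℕ.≤-trans (ℕ.≤-pred (≡.subst (toℕ i ℕ.<_) (≡.sym eq) (Fin.toℕ<n i)))
                   (ℕ.≤-reflexive (≡.sym (≡.trans (Fin.toℕ-cast eq _) (Fin.toℕ-fromℕ _)))))))

element-remove : ∀ {N} (a : Column N) {k} → k ∈ a → (∀ {i} → i ∈ a → i Fin.≤ k) →
                 (eq : suc ∣ a - k ∣ ≡ ∣ a ∣) → ∀ i → element a (cast eq (inject₁ i)) ≡ element (a - k) i
-- If the largest element is the first row, the column has no other element, so there is no index
-- `i`.
element-remove (inside ∷ a) here top eq i = contradiction (top (there (≡.subst (element (a ─ ∅) i ∈_) (p─⊥≡p a) (element-∈ _ i)))) λ ()
element-remove (inside  ∷ a) (there k∈a) top eq zero    = ≡.refl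
element-remove (inside  ∷ a) (there k∈a) top eq (suc i) = ≡.cong suc (element-remove a k∈a (ℕ.≤-pred ∘ top ∘ there) (ℕ.suc-injective eq) i)
element-remove (outside ∷ a) (there k∈a) top eq i       = ≡.cong suc (element-remove a k∈a (ℕ.≤-pred ∘ top ∘ there) eq i)

-- The exchange of the rows k and k + 1, on columns and on minors

module _ {m : ℕ} (k : Fin m) where

  swapRow : Fin (suc m) → Fin (suc m)
  swapRow = transpose (inject₁ k) (suc k) ⟨$⟩ʳ_

  -- An elimination principle that hides the decisions inside `transpose`. The equations below use
  -- it with an implication as `P`, whose premise selects the relevant case.
  swapRow-cases : ∀ {ℓ} (P : Fin (suc m) → Fin (suc m) → Set ℓ) → P (inject₁ k) (suc k) → P (suc k) (inject₁ k) →
                   (∀ i → i ≢ inject₁ k → i ≢ suc k → P i i) → ∀ i → P i (swapRow i)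
  swapRow-cases P low high other i with i Fin.≟ inject₁ k
  ... | yes ≡.refl = low
  ... | no  i≢k with i Fin.≟ suc k
  ...   | yes ≡.refl = high
  ...   | no  i≢k′   = other i i≢k i≢k′

  swapRow-low : swapRow (inject₁ k) ≡ suc k
  swapRow-low = swapRow-cases (λ i j → i ≡ inject₁ k → j ≡ suc k) (λ _ → ≡.refl) ≡.sym (λ i i≢k _ i≡k → contradiction i≡k i≢k) _ ≡.refl

  swapRow-high : swapRow (suc k) ≡ inject₁ k
  swapRow-high = swapRow-cases (λ i j → i ≡ suc k → j ≡ inject₁ k) ≡.sym (λ _ → ≡.refl) (λ i _ i≢k′ i≡k′ → contradiction i≡k′ i≢k′) _ ≡.refl

  swapRow-other : ∀ {i} → i ≢ inject₁ k → i ≢ suc k → swapRow i ≡ i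
  swapRow-other i≢k i≢k′ = swapRow-cases (λ i j → i ≢ inject₁ k → i ≢ suc k → j ≡ i)
    (λ neq _ → contradiction ≡.refl neq) (λ _ neq → contradiction ≡.refl neq) (λ _ _ _ _ _ → ≡.refl) _ i≢k i≢k′

  swapRow-involutive : ∀ i → swapRow (swapRow i) ≡ i
  swapRow-involutive = swapRow-cases (λ i j → swapRow j ≡ i) swapRow-high swapRow-low λ i → swapRow-other

swapRow-suc : ∀ {m} (k : Fin m) i → swapRow (suc k) (suc i) ≡ suc (swapRow k i)
swapRow-suc k i = lift₀-transpose (inject₁ k) (suc k) (suc i)

swapRows-suc : ∀ {m} (k : Fin m) x a → swapRows (suc k) (x ∷ a) ≡ x ∷ swapRows k a
swapRows-suc k x a = ≡.cong (x ∷_) (Vec.tabulate-cong λ i → ≡.cong (lookup (x ∷ a)) (swapRow-suc k i))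

swapRows-zero : ∀ {m} x y (a : Column m) → swapRows zero (x ∷ y ∷ a) ≡ y ∷ x ∷ a
swapRows-zero x y a = ≡.cong (λ a → y ∷ x ∷ a) (Vec.tabulate∘lookup a)

size-swapRows : ∀ {m} (k : Fin m) a → ∣ swapRows k a ∣ ≡ ∣ a ∣
size-swapRows zero (x ∷ y ∷ a) = ≡.trans (≡.cong ∣_∣ (swapRows-zero x y a)) (swapped x y)
  where
  swapped : ∀ x y → ∣ y ∷ x ∷ a ∣ ≡ ∣ x ∷ y ∷ a ∣
  swapped inside  inside  = ≡.refl
  swapped inside  outside = ≡.refl
  swapped outside inside  = ≡.refl
  swapped outside outside = ≡.refl
size-swapRows (suc k) (inside  ∷ a) = ≡.trans (≡.cong ∣_∣ (swapRows-suc k inside  a)) (≡.cong suc (size-swapRows k a))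
size-swapRows (suc k) (outside ∷ a) = ≡.trans (≡.cong ∣_∣ (swapRows-suc k outside a)) (size-swapRows k a)

module SwapRows {c ℓ} (R : CommutativeRing c ℓ) {V : Set} {y} (Z : Pred V y) where

  open Polynomials R using (Poly; polynomialRing)
  open CommutativeRing (polynomialRing Z) hiding (zero)
  open RingProperties ring using (-1*x≈-x)
  open CommutativeSemigroupProperties *-commutativeSemigroup using (x∙yz≈y∙xz)
  open Determinants R Z
  open ≈-Reasoning setoid

  rows : ∀ {N r} → (Fin N → Fin r → Poly V) → (a : Column N) → r ≡ ∣ a ∣ → Square r
  rows M a eq i = M (element a (cast eq i))

  -- The sign is - 1 only if the column contains both rows, which then trade places inside the
  -- minor. It is fixed before `M`, because the induction needs the same sign for all minors of one
  -- expansion. The sizes of `a` and `b` agree only propositionally, hence the common size `r` with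
  -- two casts, and `b` is a variable so that the computed form of `swapRows k a` can be matched.
  det-swapRows : ∀ {m} (k : Fin m) a b → b ≡ swapRows k a → ∀ {r} (a# : r ≡ ∣ a ∣) (b# : r ≡ ∣ b ∣) →
                 ∃ λ s → ∀ M → det (rows (M ∘ swapRow k) b b#) ≈ sgn s * det (rows M a a#)
  det-swapRows zero (x ∷ y ∷ a) b b≡ a# b# with ≡.trans b≡ (swapRows-zero x y a)
  det-swapRows zero (inside ∷ inside ∷ a) _ _ {suc (suc r)} a# b# | ≡.refl = 1 , λ M → begin
    det (rows (M ∘ swapRow zero) (inside ∷ inside ∷ a) b#)
      ≈⟨ det-cong {A = rows (M ∘ swapRow zero) (inside ∷ inside ∷ a) b#} {rows M (inside ∷ inside ∷ a) a# ∘ swap₀₁}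
           (λ { zero j → refl ; (suc zero) j → refl ; (suc (suc i)) j → refl }) ⟩
    det (rows M (inside ∷ inside ∷ a) a# ∘ swap₀₁)       ≈⟨ det-swap₀₁ (rows M (inside ∷ inside ∷ a) a#) ⟩
    - det (rows M (inside ∷ inside ∷ a) a#)              ≈⟨ -1*x≈-x _ ⟨
    - 1# * det (rows M (inside ∷ inside ∷ a) a#)         ≈⟨ *-congʳ (trans (sgn-suc 0) (-‿cong sgn-0)) ⟨
    sgn 1 * det (rows M (inside ∷ inside ∷ a) a#)        ∎
  det-swapRows zero (inside ∷ outside ∷ a) _ _ {suc r} a# b# | ≡.refl = 0 , λ M →
    trans (det-cong {A = rows (M ∘ swapRow zero) (outside ∷ inside ∷ a) b#} {rows M (inside ∷ outside ∷ a) a#}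
             (λ { zero j → refl ; (suc i) j → refl })) (sym (trans (*-congʳ sgn-0) (*-identityˡ _)))
  det-swapRows zero (outside ∷ inside ∷ a) _ _ {suc r} a# b# | ≡.refl = 0 , λ M →
    trans (det-cong {A = rows (M ∘ swapRow zero) (inside ∷ outside ∷ a) b#} {rows M (outside ∷ inside ∷ a) a#}
             (λ { zero j → refl ; (suc i) j → refl })) (sym (trans (*-congʳ sgn-0) (*-identityˡ _)))
  det-swapRows zero (outside ∷ outside ∷ a) _ _ a# b# | ≡.refl = 0 , λ M →
    trans (det-cong {A = rows (M ∘ swapRow zero) (outside ∷ outside ∷ a) b#} {rows M (outside ∷ outside ∷ a) a#}
             (λ i j → refl)) (sym (trans (*-congʳ sgn-0) (*-identityˡ _)))
  det-swapRows (suc k) (x ∷ a) b b≡ a# b# with ≡.trans b≡ (swapRows-suc k x a)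
  det-swapRows (suc k) (outside ∷ a) _ _ a# b# | ≡.refl with det-swapRows k a _ ≡.refl a# b#
  ... | s , eq = s , λ M → trans
    (det-cong {A = rows (M ∘ swapRow (suc k)) (outside ∷ swapRows k a) b#} {rows (M ∘ suc ∘ swapRow k) (swapRows k a) b#}
      λ i j → reflexive (≡.cong (λ p → M p j) (swapRow-suc k (element (swapRows k a) (cast b# i)))))
    (eq (M ∘ suc))
  det-swapRows (suc k) (inside ∷ a) _ _ {suc r} a# b# | ≡.refl
    with det-swapRows k a _ ≡.refl (ℕ.suc-injective a#) (ℕ.suc-injective b#)
  ... | s , eq = s , λ M → begin
    det (rows (M ∘ swapRow (suc k)) (inside ∷ swapRows k a) b#)        ≈⟨ expand-row _ ⟩
    sum (λ j → (sgn (toℕ j) * M (swapRow (suc k) zero) j) * det (minorAt (rows (M ∘ swapRow (suc k)) (inside ∷ swapRows k a) b#) j))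
      ≈⟨ sum-cong (λ j → trans (*-congˡ (trans (det-cong λ i j′ → reflexive (≡.cong (λ p → M p (punchIn j j′)) (swapRow-suc k (element (swapRows k a) (cast (ℕ.suc-injective b#) i)))))
           (eq λ p j′ → M (suc p) (punchIn j j′)))) (x∙yz≈y∙xz _ (sgn s) _)) ⟩
    sum (λ j → sgn s * ((sgn (toℕ j) * M zero j) * det (minorAt (rows M (inside ∷ a) a#) j)))    ≈⟨ *-sum (sgn s) _ ⟨
    sgn s * sum (λ j → (sgn (toℕ j) * M zero j) * det (minorAt (rows M (inside ∷ a) a#) j))      ≈⟨ *-congˡ (expand-row _) ⟨
    sgn s * det (rows M (inside ∷ a) a#)                                ∎

-- quotient f is (f − f|ₓ₌₀) / x, written as a twisted derivation so that
-- it is visibly well defined; hence x f = 0 implies f = 0.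

module DifferenceQuotient {c ℓ} (R : CommutativeRing c ℓ) {V : Set} {y} (Z : Pred V y) (_≟_ : DecidableEquality V)
  (x : V) (nonvanishing : Z x → CommutativeRing._≈_ R (CommutativeRing.1# R) (CommutativeRing.0# R)) where

  open Polynomials R hiding (refl; sym; trans)
  open CommutativeRing (polynomialRing Z)
  open RingProperties ring using (-‿distribʳ-*; -‿+-comm)
  private
    module + = CommutativeSemigroupProperties +-commutativeSemigroup
    module * = CommutativeSemigroupProperties *-commutativeSemigroup
  open ≈-Reasoning setoid

  at0-var : V → Poly V
  at0-var v with v ≟ x
  ... | yes _ = 0#
  ... | no  _ = var v

  at0 : Poly V → Poly V
  at0 = substitute at0-var

  quotient-var : V → Poly V
  quotient-var v with v ≟ x
  ... | yes _ = 1#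
  ... | no  _ = 0#

  quotient : Poly V → Poly V
  quotient (con r) = 0#
  quotient (var v) = quotient-var v
  quotient (f ⊕ g) = quotient f + quotient g
  quotient (f ⊛ g) = quotient f * g + at0 f * quotient g
  quotient (⊝ f)   = - quotient f

  division : ∀ f → f ≈ at0 f + var x * quotient f
  division (con r) = sym (trans (+-congˡ (zeroʳ _)) (+-identityʳ _))
  division (var v) with v ≟ x
  ... | yes ≡.refl = sym (trans (+-identityˡ _) (*-identityʳ _))
  ... | no  _      = sym (trans (+-congˡ (zeroʳ _)) (+-identityʳ _))
  division (f ⊕ g) = begin
    f + g                                                          ≈⟨ +-cong (division f) (division g) ⟩
    (at0 f + var x * quotient f) + (at0 g + var x * quotient g)    ≈⟨ +.interchange _ _ _ _ ⟩
    (at0 f + at0 g) + (var x * quotient f + var x * quotient g)    ≈⟨ +-congˡ (distribˡ _ _ _) ⟨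
    (at0 f + at0 g) + var x * (quotient f + quotient g)            ∎
  division (f ⊛ g) = begin
    f * g                                                          ≈⟨ *-congʳ (division f) ⟩
    (at0 f + var x * quotient f) * g                               ≈⟨ distribʳ _ _ _ ⟩
    at0 f * g + (var x * quotient f) * g                           ≈⟨ +-cong (*-congˡ (division g)) (*-assoc _ _ _) ⟩
    at0 f * (at0 g + var x * quotient g) + var x * (quotient f * g) ≈⟨ +-congʳ (distribˡ _ _ _) ⟩
    (at0 f * at0 g + at0 f * (var x * quotient g)) + var x * (quotient f * g)
      ≈⟨ +-assoc _ _ _ ⟩
    at0 f * at0 g + (at0 f * (var x * quotient g) + var x * (quotient f * g))
      ≈⟨ +-congˡ (trans (+-comm _ _) (+-congˡ (*.x∙yz≈y∙xz _ _ _))) ⟩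
    at0 f * at0 g + (var x * (quotient f * g) + var x * (at0 f * quotient g))
      ≈⟨ +-congˡ (distribˡ _ _ _) ⟨
    at0 f * at0 g + var x * (quotient f * g + at0 f * quotient g)  ∎
  division (⊝ f) = begin
    - f                                      ≈⟨ -‿cong (division f) ⟩
    - (at0 f + var x * quotient f)           ≈⟨ -‿+-comm _ _ ⟨
    - at0 f + - (var x * quotient f)         ≈⟨ +-congˡ (-‿distribʳ-* _ _) ⟩
    - at0 f + var x * (- quotient f)         ∎

  at0-cong : ∀ {f g} → f ≈ g → at0 f ≈ at0 g
  at0-cong = substitute-cong at0-var kills
    where
    kills : ∀ {v} → Z v → at0-var v ≈ 0#
    kills {v} p with v ≟ x
    ... | yes _ = refl
    ... | no  _ = vanish p

  quotient-* : ∀ f g → quotient f * g + at0 f * quotient g ≈ (quotient f * at0 g + at0 f * quotient g) + var x * (quotient f * quotient g)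
  quotient-* f g = begin
    quotient f * g + at0 f * quotient g                                              ≈⟨ +-congʳ (*-congˡ (division g)) ⟩
    quotient f * (at0 g + var x * quotient g) + at0 f * quotient g                   ≈⟨ +-congʳ (distribˡ _ _ _) ⟩
    (quotient f * at0 g + quotient f * (var x * quotient g)) + at0 f * quotient g    ≈⟨ +.xy∙z≈xz∙y _ _ _ ⟩
    (quotient f * at0 g + at0 f * quotient g) + quotient f * (var x * quotient g)    ≈⟨ +-congˡ (*.x∙yz≈y∙xz _ _ _) ⟩
    (quotient f * at0 g + at0 f * quotient g) + var x * (quotient f * quotient g)    ∎

  -- The twisted Leibniz rule is not symmetric in its factors, so commutativity goes through the
  -- symmetric form `quotient-*`. If x itself is set to 0, its quotient 1 has to be 0; the
  -- hypothesis `nonvanishing` says just that, so that the trivial ring is covered.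
  quotient-cong : ∀ {f g} → f ≈ g → quotient f ≈ quotient g
  quotient-cong (vanish {v} p) with v ≟ x
  ... | yes ≡.refl = con-cong (nonvanishing p)
  ... | no  _      = refl
  quotient-cong _≈ᴾ_.refl        = refl
  quotient-cong (_≈ᴾ_.sym p)     = sym (quotient-cong p)
  quotient-cong (_≈ᴾ_.trans p q) = trans (quotient-cong p) (quotient-cong q)
  quotient-cong (⊕-cong p q)     = +-cong (quotient-cong p) (quotient-cong q)
  quotient-cong (⊛-cong p q)     = +-cong (*-cong (quotient-cong p) q) (*-cong (at0-cong p) (quotient-cong q))
  quotient-cong (⊝-cong p)       = -‿cong (quotient-cong p)
  quotient-cong (⊕-assoc _ _ _)  = +-assoc _ _ _
  quotient-cong (⊕-comm _ _)     = +-comm _ _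
  quotient-cong (⊕-identity _)   = +-identityˡ _
  quotient-cong (⊕-inverse _)    = -‿inverseˡ _
  quotient-cong (⊛-assoc f g h)  = begin
    (quotient f * g + at0 f * quotient g) * h + (at0 f * at0 g) * quotient h               ≈⟨ +-cong (distribʳ _ _ _) (*-assoc _ _ _) ⟩
    ((quotient f * g) * h + (at0 f * quotient g) * h) + at0 f * (at0 g * quotient h)       ≈⟨ +-assoc _ _ _ ⟩
    (quotient f * g) * h + ((at0 f * quotient g) * h + at0 f * (at0 g * quotient h))       ≈⟨ +-cong (*-assoc _ _ _) (+-congʳ (*-assoc _ _ _)) ⟩
    quotient f * (g * h) + (at0 f * (quotient g * h) + at0 f * (at0 g * quotient h))       ≈⟨ +-congˡ (distribˡ _ _ _) ⟨
    quotient f * (g * h) + at0 f * (quotient g * h + at0 g * quotient h)                   ∎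
  quotient-cong (⊛-comm f g) = begin
    quotient f * g + at0 f * quotient g                                             ≈⟨ quotient-* f g ⟩
    (quotient f * at0 g + at0 f * quotient g) + var x * (quotient f * quotient g)   ≈⟨ +-cong (trans (+-comm _ _) (+-cong (*-comm _ _) (*-comm _ _))) (*-congˡ (*-comm _ _)) ⟩
    (quotient g * at0 f + at0 g * quotient f) + var x * (quotient g * quotient f)   ≈⟨ quotient-* g f ⟨
    quotient g * f + at0 g * quotient f                                             ∎
  quotient-cong (⊛-identity f)   = trans (+-cong (zeroˡ _) (*-identityˡ _)) (+-identityˡ _)
  quotient-cong (Polynomials.distrib f g h) = begin
    quotient f * (g + h) + at0 f * (quotient g + quotient h)                                     ≈⟨ +-cong (distribˡ _ _ _) (distribˡ _ _ _) ⟩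
    (quotient f * g + quotient f * h) + (at0 f * quotient g + at0 f * quotient h)                ≈⟨ +.interchange _ _ _ _ ⟩
    (quotient f * g + at0 f * quotient g) + (quotient f * h + at0 f * quotient h)                ∎
  quotient-cong (con-cong _)     = refl
  quotient-cong (con-+ _ _)      = sym (+-identityˡ _)
  quotient-cong (con-* _ _)      = sym (trans (+-cong (zeroˡ _) (zeroʳ _)) (+-identityˡ _))

  var-cancel : ∀ {f} → var x * f ≈ 0# → f ≈ 0#
  var-cancel {f} p = begin
    f                                                   ≈⟨ *-identityˡ f ⟨
    1# * f                                              ≈⟨ +-identityʳ _ ⟨
    1# * f + 0#                                         ≈⟨ +-cong (*-congʳ (sym quotient-x)) (sym (trans (*-congʳ at0-x) (zeroˡ _))) ⟩
    -- By definition this is `quotient` of `var x * f`.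
    quotient-var x * f + at0-var x * quotient f         ≈⟨ quotient-cong p ⟩
    0#                                                  ∎
    where
    quotient-x : quotient-var x ≈ 1#
    quotient-x with x ≟ x
    ... | yes _   = refl
    ... | no  x≢x = contradiction ≡.refl x≢x
    at0-x : at0-var x ≈ 0#
    at0-x with x ≟ x
    ... | yes _   = refl
    ... | no  x≢x = contradiction ≡.refl x≢x

-- Testing elements of Schur modules on products of minors

module Presentation {c ℓ} (R : CommutativeRing c ℓ) (n : ℕ) {N : ℕ}
  (Z : Pred (FlaggedSchur.Variable R n {N}) (c ⊔ ℓ)) where

  private module R = CommutativeRing R
  open FlaggedSchur R n hiding (refl; sym; trans; module _≈ᵀ_)
  open Polynomials R using (Poly; con; var; _⊕_; _⊛_; ⊝_; polynomialRing; con-cong; con-+; con-*)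
  open CommutativeRing (polynomialRing Z) hiding (zero)
  open RingProperties ring using (-‿distribˡ-*; -‿distribʳ-*; -‿+-comm; -0#≈0#; -‿involutive; -1*x≈-x; +-inverseˡ-unique)
  private
    module + = CommutativeSemigroupProperties +-commutativeSemigroup
    module * = CommutativeSemigroupProperties *-commutativeSemigroup
  open Determinants R Z
  open ≈-Reasoning setoid

  private
    E : Set c
    E = Rep.Carrierᴹ 𝔼

  con-neg : ∀ r → con (R.- r) ≈ - con r
  con-neg r = +-inverseˡ-unique _ _ (trans (sym (con-+ (R.- r) r)) (con-cong (R.-‿inverseˡ r)))

  pairing-sum : ∀ p v → pairing p v ≈ sum λ q → con (v q) * var (p , q)
  pairing-sum p v = reflexive (≡.sym (sum≡ λ q → con (v q) * var (p , q)))

  pairing-cong : ∀ p {v w} → (∀ i → v i R.≈ w i) → pairing p v ≈ pairing p w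
  pairing-cong p {v} {w} eq = trans (pairing-sum p v) (trans (sum-cong λ q → *-congʳ (con-cong (eq q))) (sym (pairing-sum p w)))

  pairing-+ : ∀ p {u v w} → (∀ i → w i R.≈ u i R.+ v i) → pairing p w ≈ pairing p u + pairing p v
  pairing-+ p {u} {v} {w} eq = begin
    pairing p w                                                           ≈⟨ pairing-sum p w ⟩
    sum (λ q → con (w q) * var (p , q))                                   ≈⟨ sum-cong (λ q → trans (*-congʳ (trans (con-cong (eq q)) (con-+ _ _))) (distribʳ _ _ _)) ⟩
    sum (λ q → con (u q) * var (p , q) + con (v q) * var (p , q))         ≈⟨ sum-+ _ _ ⟩
    sum (λ q → con (u q) * var (p , q)) + sum (λ q → con (v q) * var (p , q)) ≈⟨ +-cong (pairing-sum p u) (pairing-sum p v) ⟨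
    pairing p u + pairing p v                                             ∎

  pairing-* : ∀ p r {v w} → (∀ i → w i R.≈ r R.* v i) → pairing p w ≈ con r * pairing p v
  pairing-* p r {v} {w} eq = begin
    pairing p w                                                           ≈⟨ pairing-sum p w ⟩
    sum (λ q → con (w q) * var (p , q))                                   ≈⟨ sum-cong (λ q → trans (*-congʳ (trans (con-cong (eq q)) (con-* _ _))) (*-assoc _ _ _)) ⟩
    sum (λ q → con r * (con (v q) * var (p , q)))                         ≈⟨ *-sum _ _ ⟨
    con r * sum (λ q → con (v q) * var (p , q))                           ≈⟨ *-congˡ (pairing-sum p v) ⟨
    con r * pairing p v                                                   ∎

  pairing-0 : ∀ p {v} → (∀ i → v i R.≈ R.0#) → pairing p v ≈ 0#
  pairing-0 p {v} eq = trans (pairing-sum p v) (sum-zero λ q → trans (*-congʳ (con-cong (eq q))) (zeroˡ _))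

  entries : (a : Column N) → (Fin ∣ a ∣ → E) → Square ∣ a ∣
  entries a v i j = pairing (element a i) (v j)

  minor≈ : ∀ a v → minor a v ≈ det (entries a v)
  minor≈ a v = reflexive (≡.sym (det≡ (entries a v)))

  minor-alternating : ∀ a {t u} → Alternating ∣ a ∣ 𝔼 t u → extend (minor a) t ≈ extend (minor a) u
  minor-alternating a (∧-cong {v} {w} eq) =
    trans (minor≈ a v) (trans (det-cong λ i j → pairing-cong (element a i) (eq j)) (sym (minor≈ a w)))
  minor-alternating a (∧-+ i {u} {v} {w} eq u≈w v≈w) = begin
    minor a w                                        ≈⟨ minor≈ a w ⟩
    det (entries a w)                                ≈⟨ det-ᵀ _ ⟨
    det (entries a w ᵀ)                              ≈⟨ det-linear i 1# (λ p → trans (pairing-+ (element a p) eq) (+-cong (sym (*-identityˡ _)) refl))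
                                                          (λ j j≢i p → pairing-cong (element a p) (u≈w j j≢i)) (λ j j≢i p → pairing-cong (element a p) (v≈w j j≢i)) ⟩
    1# * det (entries a u ᵀ) + det (entries a v ᵀ)   ≈⟨ +-cong (trans (*-identityˡ _) (det-ᵀ _)) (det-ᵀ _) ⟩
    det (entries a u) + det (entries a v)            ≈⟨ +-cong (minor≈ a u) (minor≈ a v) ⟨
    minor a u + minor a v                            ∎
  minor-alternating a (∧-* q i {v} {w} eq v≈w) = begin
    minor a w                     ≈⟨ minor≈ a w ⟩
    det (entries a w)             ≈⟨ det-ᵀ _ ⟨
    det (entries a w ᵀ)           ≈⟨ det-scale i (con q) (λ p → pairing-* (element a p) q eq) (λ j j≢i p → pairing-cong (element a p) (v≈w j j≢i)) ⟩
    con q * det (entries a v ᵀ)   ≈⟨ *-congˡ (det-ᵀ _) ⟩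
    con q * det (entries a v)     ≈⟨ *-congˡ (minor≈ a v) ⟨
    con q * minor a v             ∎
  minor-alternating a (∧-alt i j {v} i≢j eq) =
    trans (minor≈ a v) (det-columns i j i≢j λ p → pairing-cong (element a p) eq)

  -- An R-submodule of the polynomial ring rather than an ideal, as images of Schur modules are.
  -- Membership is data: for `Twisted` and `Kernels` below, a proof of membership carries a
  -- preimage.
  record Submodule : Set (lsuc (c ⊔ ℓ)) where
    infix 4 _∋_
    field
      _∋_  : Poly (Variable {N}) → Set (c ⊔ ℓ)
      resp : ∀ {f g} → f ≈ g → _∋_ f → _∋_ g
      ∋-0  : _∋_ 0#
      ∋-+  : ∀ {f g} → _∋_ f → _∋_ g → _∋_ (f + g)
      ∋-*  : ∀ r {f} → _∋_ f → _∋_ (con r * f)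

    ∋-neg : ∀ {f} → _∋_ f → _∋_ (- f)
    ∋-neg {f} p = resp (trans (*-congʳ (con-neg R.1#)) (-1*x≈-x f)) (∋-* (R.- R.1#) p)

    ∋-sgn : ∀ i {f} → _∋_ f → _∋_ (sgn i * f)
    ∋-sgn zero    p = resp (sym (trans (*-congʳ sgn-0) (*-identityˡ _))) p
    ∋-sgn (suc i) p = resp (trans (-‿distribˡ-* _ _) (*-congʳ (sym (sgn-suc i)))) (∋-neg (∋-sgn i p))

    ∋-sum : ∀ {m} {f : Fin m → Poly (Variable {N})} → (∀ i → _∋_ (f i)) → _∋_ (sum f)
    ∋-sum {zero}  p = resp (sym (sum-zero λ ())) ∋-0
    ∋-sum {suc m} p = resp (sym (sum-suc _)) (∋-+ (p zero) (∋-sum (p ∘ suc)))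

    ∋-extend : ∀ {x} {X : Set x} {h : X → Poly (Variable {N})} → (∀ x → _∋_ (h x)) → ∀ t → _∋_ (extend h t)
    ∋-extend p (gen x) = p x
    ∋-extend p 𝟘       = ∋-0
    ∋-extend p (t ⊞ u) = ∋-+ (∋-extend p t) (∋-extend p u)
    ∋-extend p (⊟ t)   = ∋-neg (∋-extend p t)
    ∋-extend p (r ⊡ t) = ∋-* r (∋-extend p t)

  open Submodule public using (_∋_)

  infix 4 _⊢_~_
  _⊢_~_ : Submodule → Poly (Variable {N}) → Poly (Variable {N}) → Set (c ⊔ ℓ)
  Q ⊢ f ~ g = Q ∋ f + - g

  Zero : Submodule
  Zero = record
    { _∋_  = _≈ 0#
    ; resp = λ p q → trans (sym p) q
    ; ∋-0  = refl
    ; ∋-+  = λ p q → trans (+-cong p q) (+-identityˡ _)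
    ; ∋-*  = λ r p → trans (*-congˡ p) (zeroʳ _)
    }

  infixl 5 _∶_
  -- The colon submodule (Q : g). It isolates one tensor factor: with the other factors moved into
  -- `g`, membership in Q becomes a linear condition on the factor that is left.
  _∶_ : Submodule → Poly (Variable {N}) → Submodule
  Q ∶ g = record
    { _∋_  = λ f → Q ∋ g * f
    ; resp = λ p → resp (*-congˡ p)
    ; ∋-0  = resp (sym (zeroʳ g)) ∋-0
    ; ∋-+  = λ p q → resp (sym (distribˡ _ _ _)) (∋-+ p q)
    ; ∋-*  = λ r p → resp (*.x∙yz≈y∙xz _ _ _) (∋-* r p)
    }
    where open Submodule Q hiding (_∋_)

  module _ (Q : Submodule) where

    open Submodule Q hiding (_∋_)

    ~-≈ : ∀ {f g} → f ≈ g → Q ⊢ f ~ g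
    ~-≈ p = resp (sym (trans (+-congʳ p) (-‿inverseʳ _))) ∋-0

    ~-sym : ∀ {f g} → Q ⊢ f ~ g → Q ⊢ g ~ f
    ~-sym {f} {g} p = resp (trans (sym (-‿+-comm _ _)) (trans (+-congˡ (-‿involutive g)) (+-comm _ _))) (∋-neg p)

    ~-trans : ∀ {f g h} → Q ⊢ f ~ g → Q ⊢ g ~ h → Q ⊢ f ~ h
    ~-trans {f} {g} {h} p q = resp (begin
      (f + - g) + (g + - h)   ≈⟨ +-assoc _ _ _ ⟩
      f + (- g + (g + - h))   ≈⟨ +-congˡ (+-assoc _ _ _) ⟨
      f + ((- g + g) + - h)   ≈⟨ +-congˡ (trans (+-congʳ (-‿inverseˡ g)) (+-identityˡ _)) ⟩
      f + - h                 ∎) (∋-+ p q)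

    ~-+ : ∀ {f f′ g g′} → Q ⊢ f ~ f′ → Q ⊢ g ~ g′ → Q ⊢ f + g ~ f′ + g′
    ~-+ p q = resp (trans (+.interchange _ _ _ _) (+-congˡ (-‿+-comm _ _))) (∋-+ p q)

    ~-neg : ∀ {f g} → Q ⊢ f ~ g → Q ⊢ - f ~ - g
    ~-neg p = resp (sym (-‿+-comm _ _)) (∋-neg p)

    ~-* : ∀ r {f g} → Q ⊢ f ~ g → Q ⊢ con r * f ~ con r * g
    ~-* r p = resp (trans (distribˡ _ _ _) (+-congˡ (sym (-‿distribʳ-* _ _)))) (∋-* r p)

    ~-∶ : ∀ g {f f′} → Q ∶ g ⊢ f ~ f′ → Q ⊢ g * f ~ g * f′
    ~-∶ g p = resp (trans (distribˡ _ _ _) (+-congˡ (sym (-‿distribʳ-* _ _)))) p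

    ~-0 : ∀ {f} → Q ⊢ f ~ 0# → Q ∋ f
    ~-0 p = resp (trans (+-congˡ -0#≈0#) (+-identityʳ _)) p

    ∋⇒~ : ∀ {f} → Q ∋ f → Q ⊢ f ~ 0#
    ∋⇒~ p = resp (sym (trans (+-congˡ -0#≈0#) (+-identityʳ _))) p

    extend-~ : ∀ {x r} {X : Set x} {_≐_ : Term X → Term X → Set r} {h : X → Poly (Variable {N})} →
               (∀ {t u} → t ≐ u → Q ⊢ extend h t ~ extend h u) →
               ∀ {t u} → FlaggedSchur._≈ᵀ_ R n _≐_ t u → Q ⊢ extend h t ~ extend h u
    extend-~ p (rel q)            = p q
    extend-~ p FlaggedSchur.refl               = ~-≈ refl
    extend-~ p (FlaggedSchur.sym q)            = ~-sym (extend-~ p q)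
    extend-~ p (FlaggedSchur.trans q q′)       = ~-trans (extend-~ p q) (extend-~ p q′)
    extend-~ p (⊞-cong q q′)      = ~-+ (extend-~ p q) (extend-~ p q′)
    extend-~ p (⊟-cong q)         = ~-neg (extend-~ p q)
    extend-~ p (⊡-cong r≈r′ q)    = ~-trans (~-≈ (*-congʳ (con-cong r≈r′))) (~-* _ (extend-~ p q))
    extend-~ p (⊞-assoc t u v)    = ~-≈ (+-assoc _ _ _)
    extend-~ p (⊞-comm t u)       = ~-≈ (+-comm _ _)
    extend-~ p (⊞-identity t)     = ~-≈ (+-identityˡ _)
    extend-~ p (⊞-inverse t)      = ~-≈ (-‿inverseˡ _)
    extend-~ p (⊡-distribˡ r t u) = ~-≈ (distribˡ _ _ _)
    extend-~ p (⊡-distribʳ t r q) = ~-≈ (trans (*-congʳ (con-+ _ _)) (distribʳ _ _ _))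
    extend-~ p (⊡-assoc r q t)    = ~-≈ (trans (*-congʳ (con-* _ _)) (*-assoc _ _ _))
    extend-~ p (⊡-identity t)     = ~-≈ (*-identityˡ _)
    extend-~ p (⊡-zeroˡ t)        = ~-≈ (zeroˡ _)
    extend-~ p (⊡-zeroʳ r)        = ~-≈ (zeroʳ _)

  -- A list of entries stands for a pure tensor. The modules `TF` of a diagram and of its reordering
  -- differ, so columns are reordered on these lists, where commutativity of the polynomial ring
  -- preserves the product `Π`.
  Entry : Set c
  Entry = Σ (Column N) λ a → Fin ∣ a ∣ → E

  Π : List Entry → Poly (Variable {N})
  Π []            = 1#
  Π ((a , v) ∷ t) = minor a v * Π t

  Π-↭ : ∀ {t u} → t ↭ u → Π t ≈ Π u
  Π-↭ ↭.refl           = refl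
  Π-↭ (↭.prep _ p)     = *-congˡ (Π-↭ p)
  Π-↭ (↭.swap _ _ p)   = trans (*.x∙yz≈y∙xz _ _ _) (*-congˡ (*-congˡ (Π-↭ p)))
  Π-↭ (↭.trans p q)    = trans (Π-↭ p) (Π-↭ q)

  module _ (Φ : Flag) where

    Flagged : Entry → Set (c ⊔ ℓ)
    Flagged (a , v) = ∃ λ j → ∀ l → j Fin.≤ l → Flag.∈ker Φ (row (element a j)) (v l)

    poly : (D : Diagram N) → Rep.Carrierᴹ (TF Φ D) → Poly (Variable {N})
    poly []      = extend λ _ → 1#
    poly (a ∷ D) = extend λ (x , y) → extend (minor a) x * poly D y

    poly-+ : ∀ D x y → poly D (Rep._+ᴹ_ (TF Φ D) x y) ≈ poly D x + poly D y
    poly-+ []      x y = refl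
    poly-+ (a ∷ D) x y = refl

    poly-* : ∀ D r x → poly D (Rep._*ₗ_ (TF Φ D) r x) ≈ con r * poly D x
    poly-* []      r x = refl
    poly-* (a ∷ D) r x = refl

    poly-0 : ∀ D → poly D (Rep.0ᴹ (TF Φ D)) ≈ 0#
    poly-0 []      = refl
    poly-0 (a ∷ D) = refl

    poly-neg : ∀ D x → poly D (Rep.-ᴹ_ (TF Φ D) x) ≈ - poly D x
    poly-neg []      x = refl
    poly-neg (a ∷ D) x = refl

    -- Membership in Q is linear in each factor separately, so it need only be tested on products of
    -- minors; the colon by the other factors drives the induction.
    poly-∋ : ∀ D (Q : Submodule) → (∀ t → map proj₁ t ≡ D → Q ∋ Π t) → ∀ x → Q ∋ poly D x
    poly-∋ []      Q p = Submodule.∋-extend Q λ _ → p [] ≡.refl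
    poly-∋ (a ∷ D) Q p = Submodule.∋-extend Q λ (x , y) →
      Submodule.resp Q (*-comm _ _) (Submodule.∋-extend (Q ∶ poly D y) (λ v →
        Submodule.resp Q (*-comm _ _) (poly-∋ D (Q ∶ minor a v) (λ t eq → p ((a , v) ∷ t) (≡.cong (a ∷_) eq)) y)) x)

    column-~ : ∀ a (Q : Submodule) → (∀ v → Flagged (a , v) → Q ∋ minor a v) →
               ∀ {x y} → Rep._≈ᴹ_ (columnModule Φ a) x y → Q ⊢ extend (minor a) x ~ extend (minor a) y
    column-~ a Q p (base q)              = extend-~ Q (λ alt → ~-≈ Q (minor-alternating a alt)) q
    column-~ a Q p (kill (flagged v j q)) = ∋⇒~ Q (p v (j , q))
    column-~ a Q p (~sym q)              = ~-sym Q (column-~ a Q p q)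
    column-~ a Q p (~trans q q′)         = ~-trans Q (column-~ a Q p q) (column-~ a Q p q′)
    column-~ a Q p (~+ q q′)             = ~-+ Q (column-~ a Q p q) (column-~ a Q p q′)
    column-~ a Q p (~- q)                = ~-neg Q (column-~ a Q p q)
    column-~ a Q p (~* r q)              = ~-* Q r (column-~ a Q p q)

    -- Minors respect the alternating relations exactly, but the flag relations only modulo products
    -- with a flagged factor. Keeping Q arbitrary serves two ends: `Zero` for F, where flagged
    -- minors vanish, and `Twisted` for G, where they need not.
    TF-~ : ∀ D (Q : Submodule) → (∀ t → map proj₁ t ≡ D → Any Flagged t → Q ∋ Π t) →
           ∀ {x y} → Rep._≈ᴹ_ (TF Φ D) x y → Q ⊢ poly D x ~ poly D y
    TF-~ []      Q p = extend-~ Q λ ()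
    TF-~ (a ∷ D) Q p = extend-~ Q bilinear
      where
      bilinear : ∀ {t u} → Bilinear (columnModule Φ a) (TF Φ D) t u → Q ⊢ poly (a ∷ D) t ~ poly (a ∷ D) u
      bilinear (⊗-cong {x} {x′} {y} {y′} q q′) = ~-trans Q
        -- The factors change one at a time: the first modulo the colon by `poly D y`, then the
        -- second modulo the colon by the new first factor.
        (~-trans Q (~-≈ Q (*-comm _ _)) (~-trans Q (~-∶ Q (poly D y) (column-~ a (Q ∶ poly D y) flaggedˡ q)) (~-≈ Q (*-comm _ _))))
        (~-∶ Q X′ (TF-~ D (Q ∶ X′) flaggedʳ q′))
        where
        X′ = extend (minor a) x′
        flaggedˡ : ∀ v → Flagged (a , v) → (Q ∶ poly D y) ∋ minor a v
        flaggedˡ v f = Submodule.resp Q (*-comm _ _)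
          (poly-∋ D (Q ∶ minor a v) (λ t eq → p ((a , v) ∷ t) (≡.cong (a ∷_) eq) (here f)) y)
        flaggedʳ : ∀ t → map proj₁ t ≡ D → Any Flagged t → (Q ∶ X′) ∋ Π t
        flaggedʳ t eq f = Submodule.resp Q (*-comm _ _) (Submodule.∋-extend (Q ∶ Π t)
          (λ v → Submodule.resp Q (*-comm _ _) (p ((a , v) ∷ t) (≡.cong (a ∷_) eq) (there f))) x′)
      bilinear (⊗-+ˡ x x′ y) = ~-≈ Q (distribʳ _ _ _)
      bilinear (⊗-+ʳ x y y′) = ~-≈ Q (trans (*-congˡ (poly-+ D y y′)) (distribˡ _ _ _))
      bilinear (⊗-*ˡ r x y)  = ~-≈ Q (*-assoc _ _ _)
      bilinear (⊗-*ʳ r x y)  = ~-≈ Q (trans (*-congˡ (poly-* D r y)) (*.x∙yz≈y∙xz _ _ _))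

    poly-projection : ∀ D e → poly D (RepHom.to (projection Φ D) e) ≡ Δ D e
    poly-projection []      (gen x) = ≡.refl
    poly-projection []      𝟘       = ≡.refl
    poly-projection []      (t ⊞ u) = ≡.cong₂ _⊕_ (poly-projection [] t) (poly-projection [] u)
    poly-projection []      (⊟ t)   = ≡.cong ⊝_ (poly-projection [] t)
    poly-projection []      (r ⊡ t) = ≡.cong (con r ⊛_) (poly-projection [] t)
    poly-projection (a ∷ D) (gen (x , y)) = ≡.cong (extend (minor a) x ⊛_) (poly-projection D y)
    poly-projection (a ∷ D) 𝟘       = ≡.refl
    poly-projection (a ∷ D) (t ⊞ u) = ≡.cong₂ _⊕_ (poly-projection (a ∷ D) t) (poly-projection (a ∷ D) u)
    poly-projection (a ∷ D) (⊟ t)   = ≡.cong ⊝_ (poly-projection (a ∷ D) t)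
    poly-projection (a ∷ D) (r ⊡ t) = ≡.cong (con r ⊛_) (poly-projection (a ∷ D) t)

    -- A quotient keeps the carrier and only coarsens equality, so a representative lifts term by
    -- term. This section of `projection` need not respect equality.
    lift : (D : Diagram N) → Rep.Carrierᴹ (TF Φ D) → Rep.Carrierᴹ (T D)
    lift []      = λ t → t
    lift (a ∷ D) = mapTerm λ (x , y) → x , lift D y

    projection-lift : ∀ D x → RepHom.to (projection Φ D) (lift D x) ≡ x
    projection-lift []      x             = ≡.refl
    projection-lift (a ∷ D) (gen (x , y)) = ≡.cong (λ y → gen (x , y)) (projection-lift D y)
    projection-lift (a ∷ D) 𝟘             = ≡.refl
    projection-lift (a ∷ D) (t ⊞ u)       = ≡.cong₂ _⊞_ (projection-lift (a ∷ D) t) (projection-lift (a ∷ D) u)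
    projection-lift (a ∷ D) (⊟ t)         = ≡.cong ⊟_ (projection-lift (a ∷ D) t)
    projection-lift (a ∷ D) (r ⊡ t)       = ≡.cong (r ⊡_) (projection-lift (a ∷ D) t)

    pure : (t : List Entry) → Rep.Carrierᴹ (TF Φ (map proj₁ t))
    pure []            = gen tt
    pure ((a , v) ∷ t) = gen (gen v , pure t)

    poly-pure : ∀ t → poly (map proj₁ t) (pure t) ≡ Π t
    poly-pure []            = ≡.refl
    poly-pure ((a , v) ∷ t) = ≡.cong (minor a v ⊛_) (poly-pure t)

    pure-flagged : ∀ {t} → Any Flagged t → Rep._≈ᴹ_ (TF Φ (map proj₁ t)) (pure t) (Rep.0ᴹ (TF Φ (map proj₁ t)))
    pure-flagged {(a , v) ∷ t} (here (j , p)) = ≈ᴹ-trans (rel (⊗-cong (kill (flagged v j p)) (Rep.≈ᴹ-refl (TF Φ (map proj₁ t)))))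
      (≈ᴹ-trans (rel (⊗-cong (Rep.≈ᴹ-sym C (Rep.*ₗ-zeroˡ C 𝟘)) (Rep.≈ᴹ-refl (TF Φ (map proj₁ t)))))
      (≈ᴹ-trans (rel (⊗-*ˡ R.0# 𝟘 (pure t))) (⊡-zeroˡ _)))
      where
      C = columnModule Φ a
      open Rep (TF Φ (a ∷ map proj₁ t))
    pure-flagged {(a , v) ∷ t} (there p) = ≈ᴹ-trans (rel (⊗-cong (Rep.≈ᴹ-refl C) (pure-flagged p)))
      (≈ᴹ-trans (rel (⊗-cong (Rep.≈ᴹ-refl C) (Rep.≈ᴹ-sym U (Rep.*ₗ-zeroˡ U (Rep.0ᴹ U)))))
      (≈ᴹ-trans (rel (⊗-*ʳ R.0# (gen v) (Rep.0ᴹ U))) (⊡-zeroˡ _)))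
      where
      C = columnModule Φ a
      U = TF Φ (map proj₁ t)
      open Rep (TF Φ (a ∷ map proj₁ t))

-- The basis z_1, ..., z_n and the action of B on polynomials

module FreeModule {c ℓ} (R : CommutativeRing c ℓ) (n : ℕ) where

  private module R = CommutativeRing R
  open FlaggedSchur R n hiding (refl; sym; trans)
  open SemiringSum R.semiring using (sum-cong-≋; sum-replicate-zero) renaming (sum to sumᴿ)

  private
    E : Set c
    E = Rep.Carrierᴹ 𝔼
    _•ᴱ_ : Borel → E → E
    _•ᴱ_ = Rep._•_ 𝔼

  sumᴿ-single : ∀ {m} {f : Fin m → R.Carrier} i → (∀ j → j ≢ i → f j R.≈ R.0#) → sumᴿ f R.≈ f i
  sumᴿ-single {suc m} zero    p = R.trans (R.+-congˡ (R.trans (sum-cong-≋ λ j → p (suc j) λ ()) (sum-replicate-zero m))) (R.+-identityʳ _)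
  sumᴿ-single {suc m} (suc i) p = R.trans (R.+-cong (p zero λ ()) (sumᴿ-single i λ j j≢i → p (suc j) (j≢i ∘ Fin.suc-injective))) (R.+-identityˡ _)

  z-≡ : ∀ i → z i i R.≈ R.1#
  z-≡ i with i Fin.≟ i
  ... | yes _   = R.refl
  ... | no  i≢i = contradiction ≡.refl i≢i

  z-≢ : ∀ {i j} → i ≢ j → z j i R.≈ R.0#
  z-≢ {i} {j} i≢j with i Fin.≟ j
  ... | yes i≡j = contradiction i≡j i≢j
  ... | no  _   = R.refl

  basis-expansion : ∀ (v : E) i → sumᴿ (λ q → v q R.* z q i) R.≈ v i
  basis-expansion v i = R.trans (sumᴿ-single i λ j j≢i → R.trans (R.*-congˡ (z-≢ (j≢i ∘ ≡.sym))) (R.zeroʳ _))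
                                (R.trans (R.*-congˡ (z-≡ i)) (R.*-identityʳ _))

  action-z : ∀ g q i → (g •ᴱ z q) i R.≈ Borel.matrix g i q
  action-z g q i = R.trans (sumᴿ-single q λ j j≢q → R.trans (R.*-congˡ (z-≢ j≢q)) (R.zeroʳ _))
                           (R.trans (R.*-congˡ (z-≡ q)) (R.*-identityʳ _))

  module _ {N : ℕ} (Z : Pred (Variable {N}) (c ⊔ ℓ)) where

    open Polynomials R hiding (det; refl; sym; trans)
    private module Poly-sum = SemiringSum (CommutativeRing.semiring (polynomialRing Z))
    open CommutativeRing (polynomialRing Z) hiding (zero)
    open Determinants R Z
    open Presentation R n Z
    open ≈-Reasoning setoid

    module _ (L : E → Poly (Variable {N}))
      (L-cong : ∀ {v w} → (∀ i → v i R.≈ w i) → L v ≈ L w)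
      (L-0 : ∀ {v} → (∀ i → v i R.≈ R.0#) → L v ≈ 0#)
      (L-+ : ∀ v w → L (λ i → v i R.+ w i) ≈ L v + L w)
      (L-* : ∀ r v → L (λ i → r R.* v i) ≈ con r * L v) where

      linear-sum : ∀ {m} (r : Fin m → R.Carrier) (w : Fin m → E) →
                   L (λ i → sumᴿ λ q → r q R.* w q i) ≈ sum λ q → con (r q) * L (w q)
      linear-sum {zero}  r w = trans (L-0 λ _ → R.refl) (sym (sum-zero λ ()))
      linear-sum {suc m} r w = begin
        L (λ i → r zero R.* w zero i R.+ sumᴿ λ q → r (suc q) R.* w (suc q) i)                ≈⟨ L-+ (λ i → r zero R.* w zero i) _ ⟩
        L (λ i → r zero R.* w zero i) + L (λ i → sumᴿ λ q → r (suc q) R.* w (suc q) i)        ≈⟨ +-cong (L-* (r zero) (w zero)) (linear-sum (r ∘ suc) (w ∘ suc)) ⟩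
        con (r zero) * L (w zero) + sum (λ q → con (r (suc q)) * L (w (suc q)))               ≈⟨ sum-suc _ ⟨
        sum (λ q → con (r q) * L (w q))                                                       ∎

      linear-expansion : ∀ v → L v ≈ sum λ q → con (v q) * L (z q)
      linear-expansion v = trans (L-cong λ i → R.sym (basis-expansion v i)) (linear-sum v z)

    module _ (θ : Variable {N} → Poly (Variable {N})) where

      substitute-Σ : ∀ {m} (f : Fin m → Poly (Variable {N})) → substitute θ (Σᴾ f) ≡ Σᴾ (λ i → substitute θ (f i))
      substitute-Σ {zero}  f = ≡.refl
      substitute-Σ {suc m} f = ≡.cong (substitute θ (f zero) ⊕_) (substitute-Σ (f ∘ suc))

      substitute-signed : ∀ i f → substitute θ (signed i f) ≡ signed i (substitute θ f)
      substitute-signed zero    f = ≡.refl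
      substitute-signed (suc i) f = ≡.cong ⊝_ (substitute-signed i f)

      signed-cong : ∀ i {f g} → f ≈ g → signed i f ≈ signed i g
      signed-cong zero    p = p
      signed-cong (suc i) p = -‿cong (signed-cong i p)

      private
        substitute-det′ : ∀ {r} (A : Square r) → substitute θ (Polynomials.det R A) ≈ Polynomials.det R λ i j → substitute θ (A i j)
        substitute-det′ {zero}  A = refl
        substitute-det′ {suc r} A = trans (reflexive (substitute-Σ λ j → signed (toℕ j) (A zero j ⊛ Polynomials.det R (minorAt A j))))
          (Poly-sum.sum-cong-≋ λ j → trans (reflexive (substitute-signed (toℕ j) (A zero j ⊛ Polynomials.det R (minorAt A j))))
            (signed-cong (toℕ j) (*-congˡ (substitute-det′ (minorAt A j)))))

      substitute-minor : ∀ a v → substitute θ (minor a v) ≈ det λ i j → substitute θ (entries a v i j)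
      substitute-minor a v = trans (substitute-det′ (entries a v)) (reflexive (≡.sym (det≡ λ i j → substitute θ (entries a v i j))))

      substitute-pairing : ∀ p v → substitute θ (pairing p v) ≈ sum λ q → con (v q) * θ (p , q)
      substitute-pairing p v = trans (reflexive (substitute-Σ λ q → con (v q) ⊛ var (p , q))) (reflexive (≡.sym (sum≡ λ q → con (v q) ⊛ θ (p , q))))

    σ : Borel → Variable {N} → Poly (Variable {N})
    σ g (p , q) = pairing p (g •ᴱ z q)

    -- Both sides are linear in `v`, and on basis vectors they agree by the definition of `σ`.
    σ-pairing : ∀ g p v → substitute (σ g) (pairing p v) ≈ pairing p (g •ᴱ v)
    σ-pairing g p v = trans (substitute-pairing (σ g) p v) (sym (linear-expansion (λ v → pairing p (g •ᴱ v))
      (λ {v} {w} eq → pairing-cong p (•-cong {g} {g} {v} {w} (λ _ _ → R.refl) eq))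
      (λ {v} eq → pairing-0 p (λ i → R.trans (•-cong {g} {g} {v} (λ _ _ → R.refl) eq i) (•-0 g i)))
      (λ v w → pairing-+ p (•-+ g v w)) (λ r v → pairing-* p r (•-*ₗ g r v)) v))
      where open Rep 𝔼

    σ-poly : ∀ Φ D g x → substitute (σ g) (poly Φ D x) ≈ poly Φ D (Rep._•_ (TF Φ D) g x)
    σ-poly Φ D g = go D
      where
      column : ∀ a x → substitute (σ g) (extend (minor a) x) ≈ extend (minor a) (Rep._•_ (columnModule Φ a) g x)
      column a (gen v) = trans (substitute-minor (σ g) a v)
        (trans (det-cong λ i j → σ-pairing g (element a i) (v j)) (sym (minor≈ a λ j → g •ᴱ v j)))
      column a 𝟘       = refl
      column a (t ⊞ u) = +-cong (column a t) (column a u)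
      column a (⊟ t)   = -‿cong (column a t)
      column a (r ⊡ t) = *-congˡ (column a t)

      go : ∀ D x → substitute (σ g) (poly Φ D x) ≈ poly Φ D (Rep._•_ (TF Φ D) g x)
      go []      (gen x) = refl
      go []      𝟘       = refl
      go []      (t ⊞ u) = +-cong (go [] t) (go [] u)
      go []      (⊟ t)   = -‿cong (go [] t)
      go []      (r ⊡ t) = *-congˡ (go [] t)
      go (a ∷ D) (gen (x , y)) = *-cong (column a x) (go D y)
      go (a ∷ D) 𝟘       = refl
      go (a ∷ D) (t ⊞ u) = +-cong (go (a ∷ D) t) (go (a ∷ D) u)
      go (a ∷ D) (⊟ t)   = -‿cong (go (a ∷ D) t)
      go (a ∷ D) (r ⊡ t) = *-congˡ (go (a ∷ D) t)

-- The standard flag in coordinates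

module StandardFlag {c ℓ} (R : CommutativeRing c ℓ) (n : ℕ) where

  private module R = CommutativeRing R
  open FlaggedSchur R n hiding (refl; sym; trans)
  open FreeModule R n
  open SemiringSum R.semiring using () renaming (sum to sumᴿ)

  private
    E : Set c
    E = Rep.Carrierᴹ 𝔼

  coordinate : ∀ {d v w} → _≈/_ 𝔼 (Beyond d) v w → ∀ q → row q ℕ.≤ d → v q R.≈ w q
  coordinate (base p)              q q≤d = p q
  coordinate (kill (beyond q′ d<)) q q≤d = z-≢ {q} {q′} λ { ≡.refl → ℕ.<-irrefl ≡.refl (ℕ.<-≤-trans d< q≤d) }
  coordinate (~sym p)              q q≤d = R.sym (coordinate p q q≤d)
  coordinate (~trans p p′)         q q≤d = R.trans (coordinate p q q≤d) (coordinate p′ q q≤d)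
  coordinate (~+ p p′)             q q≤d = R.+-cong (coordinate p q q≤d) (coordinate p′ q q≤d)
  coordinate (~- p)                q q≤d = R.-‿cong (coordinate p q q≤d)
  coordinate (~* r p)              q q≤d = R.*-congˡ (coordinate p q q≤d)

  ≈/-coordinates : ∀ {d v w} → (∀ q → row q ℕ.≤ d → v q R.≈ w q) → _≈/_ 𝔼 (Beyond d) v w
  ≈/-coordinates {d} {v} {w} p = ~trans (base λ i → R.sym (basis-expansion v i))
    (~trans (combination v w z term) (base (basis-expansion w)))
    where
    combination : ∀ {m} (r s : Fin m → R.Carrier) (u : Fin m → E) →
                  (∀ q → _≈/_ 𝔼 (Beyond d) (λ i → r q R.* u q i) (λ i → s q R.* u q i)) →
                  _≈/_ 𝔼 (Beyond d) (λ i → sumᴿ λ q → r q R.* u q i) (λ i → sumᴿ λ q → s q R.* u q i)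
    combination {zero}  r s u p = base λ _ → R.refl
    combination {suc m} r s u p = ~+ (p zero) (combination (r ∘ suc) (s ∘ suc) (u ∘ suc) (p ∘ suc))
    term : ∀ q → _≈/_ 𝔼 (Beyond d) (λ i → v q R.* z q i) (λ i → w q R.* z q i)
    term q with row q ℕ.≤? d
    ... | yes q≤d = base λ i → R.*-congʳ (p q q≤d)
    ... | no  q≰d = ~trans (beyond-0 v) (~sym (beyond-0 w))
      where
      beyond-0 : ∀ (v : E) → _≈/_ 𝔼 (Beyond d) (λ i → v q R.* z q i) (λ _ → R.0#)
      beyond-0 v = ~trans (~* (v q) (kill (beyond q (ℕ.≰⇒> q≰d)))) (base λ _ → R.zeroʳ _)

  skip-mono : ∀ k {i j} → i ℕ.≤ j → skip k i ℕ.≤ skip k j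
  skip-mono k {i} {j} i≤j with i ℕ.<? k | j ℕ.<? k
  ... | yes _   | yes _   = i≤j
  ... | yes i<k | no  j≮k = ℕ.<⇒≤pred (ℕ.<-≤-trans i<k (ℕ.≮⇒≥ j≮k))
  ... | no  i≮k | yes j<k = contradiction (ℕ.≤-<-trans i≤j j<k) i≮k
  ... | no  _   | no  _   = ℕ.pred-mono-≤ i≤j

  skip-< : ∀ {k i} → i ℕ.< k → skip k i ≡ i
  skip-< {k} {i} i<k with i ℕ.<? k
  ... | yes _   = ≡.refl
  ... | no  i≮k = contradiction i<k i≮k

  skip-≥ : ∀ {k i} → k ℕ.≤ i → skip k i ≡ pred i
  skip-≥ {k} {i} k≤i with i ℕ.<? k
  ... | yes i<k = contradiction i<k (ℕ.≤⇒≯ k≤i)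
  ... | no  _   = ≡.refl

  skip-≢ : ∀ {k i} → i ≢ k → skip k i ≡ skip (suc k) i
  skip-≢ {k} {i} i≢k with i ℕ.<? k
  ... | yes i<k = ≡.sym (skip-< (ℕ.m<n⇒m<1+n i<k))
  ... | no  i≮k = ≡.sym (skip-≥ (ℕ.≤∧≢⇒< (ℕ.≮⇒≥ i≮k) (i≢k ∘ ≡.sym)))

-- The flags F and G, and the exchange τ of rows of variables

module TwoRows {c ℓ} (R : CommutativeRing c ℓ) (n : ℕ) {m : ℕ} (k : Fin m) (κ : Fin n) (κ≡k : toℕ κ ≡ toℕ k) where

  private module R = CommutativeRing R
  open FlaggedSchur R n hiding (refl; sym; trans)
  open FreeModule R n
  open StandardFlag R n

  F G : Flag
  F = 𝖱 (suc (row k)) standard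
  G = 𝖱 (row k) standard

  Z : Pred (Variable {suc m}) (c ⊔ ℓ)
  Z = Vanishing F

  open Polynomials R using (Poly; con; var; _⊕_; _⊛_; ⊝_; polynomialRing; con-cong; substitute; substitute-cong; vanish)
  open CommutativeRing (polynomialRing Z) hiding (zero; _-_)
  private
    module * = CommutativeSemigroupProperties *-commutativeSemigroup
  open Determinants R Z
  open SwapRows R Z
  open Presentation R n Z
  open ≈-Reasoning setoid

  private
    E : Set c
    E = Rep.Carrierᴹ 𝔼
    P : Set c
    P = Poly (Variable {suc m})

  low high : Fin (suc m)
  low  = inject₁ k
  high = suc k

  row-low : row low ≡ row k
  row-low = ≡.cong suc (Fin.toℕ-inject₁ k)

  -- The index d with F_p = E_d: in row p of the generic matrix the variables beyond column d are
  -- set to 0.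
  level : Fin (suc m) → ℕ
  level p = skip (suc (row k)) (row p)

  level-low : level low ≡ row k
  level-low = ≡.trans (≡.cong (skip (suc (row k))) row-low) (skip-< ℕ.≤-refl)

  level-high : level high ≡ row k
  level-high = skip-≥ {suc (row k)} ℕ.≤-refl

  level-< : ∀ {p} → p Fin.< low → level p ℕ.≤ toℕ k
  level-< {p} p<low = ℕ.≤-trans (ℕ.≤-reflexive (skip-< (ℕ.≤-trans p<k (ℕ.n≤1+n _)))) (ℕ.≤-pred p<k)
    where
    p<k : row p ℕ.< row k
    p<k = s≤s (ℕ.≤-trans p<low (ℕ.≤-reflexive (Fin.toℕ-inject₁ k)))

  level-swapRow : ∀ p → level (swapRow k p) ≡ level p
  level-swapRow = swapRow-cases k (λ p p′ → level p′ ≡ level p) (≡.trans level-high (≡.sym level-low))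
    (≡.trans level-low (≡.sym level-high)) (λ _ _ _ → ≡.refl)

  pairing-vanish : ∀ p {v} → (∀ q → row q ℕ.≤ level p → v q R.≈ R.0#) → pairing p v ≈ 0#
  pairing-vanish p {v} h = trans (pairing-sum p v) (sum-zero term)
    where
    term : ∀ q → con (v q) * var (p , q) ≈ 0#
    term q with row q ℕ.≤? level p
    ... | yes q≤ = trans (*-congʳ (con-cong (h q q≤))) (zeroˡ _)
    ... | no  q≰ = trans (*-congˡ (vanish (kill (beyond q (ℕ.≰⇒> q≰))))) (zeroʳ _)

  -- The kernel of E → G_k, in coordinates.

  Above : E → Set ℓ
  Above v = ∀ q → row q ℕ.≤ toℕ k → v q R.≈ R.0#

  pairing-below : ∀ {p v} → p Fin.< low → Above v → pairing p v ≈ 0#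
  pairing-below {p} p<low h = pairing-vanish p λ q q≤ → h q (ℕ.≤-trans q≤ (level-< p<low))

  -- Row p is cut off after column k and `v` has no components before z_k, so a single variable is
  -- left.
  pairing-at : ∀ {p v} → level p ≡ row k → Above v → pairing p v ≈ var (p , κ) * con (v κ)
  pairing-at {p} {v} lev h = trans (pairing-sum p v) (trans (sum-single κ term) (*-comm _ _))
    where
    term : ∀ q → q ≢ κ → con (v q) * var (p , q) ≈ 0#
    term q q≢κ with row q ℕ.≤? toℕ k | row q ℕ.≤? row k
    ... | yes q≤ | _      = trans (*-congʳ (con-cong (h q q≤))) (zeroˡ _)
    ... | no  q≰ | yes q≤ = contradiction (Fin.toℕ-injective (≡.trans (ℕ.suc-injective (ℕ.≤-antisym q≤ (ℕ.≰⇒> q≰))) (≡.sym κ≡k))) q≢κ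
    ... | no  _  | no  q≰ = trans (*-congˡ (vanish (kill (beyond q (≡.subst (ℕ._< row q) (≡.sym lev) (ℕ.≰⇒> q≰)))))) (zeroʳ _)

  above-z : Above (z κ)
  above-z q q≤k = z-≢ {q} {κ} λ { ≡.refl → ℕ.<-irrefl κ≡k q≤k }

  row-κ : row κ ≡ row k
  row-κ = ≡.cong suc κ≡k

  -- If z_k were 0 in F_p, its coordinate 1 at k would be 0 in R, which is the form of
  -- `nonvanishing` that the cancellation asks for.
  cancel : ∀ p → level p ≡ row k → ∀ {f} → var (p , κ) * f ≈ 0# → f ≈ 0#
  cancel p lev = DifferenceQuotient.var-cancel R Z (≡-dec Fin._≟_ Fin._≟_) (p , κ) λ v∈ker →
    R.trans (R.sym (z-≡ κ)) (coordinate v∈ker κ (ℕ.≤-reflexive (≡.trans row-κ (≡.sym lev))))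

  ∈ker-F : ∀ {a : Column (suc m)} {i j v} → i Fin.≤ j → Flag.∈ker F (row (element a j)) v → pairing (element a i) v ≈ 0#
  ∈ker-F {a} {i} {j} i≤j v∈ker = pairing-vanish (element a i) λ q q≤ →
    coordinate v∈ker q (ℕ.≤-trans q≤ (skip-mono (suc (row k)) (s≤s (element-mono-≤ a i≤j))))

  -- Since `level` is monotone, vectors killed at the row a_j are killed at all earlier rows of the
  -- column too. This makes a block of zeros with one row and column too many.
  flagged-F : ∀ {a v} → Flagged F (a , v) → minor a v ≈ 0#
  flagged-F {a} {v} (j , p) = trans (minor≈ a v)
    (det-zero-block (entries a v) j λ i l i≤j j≤l → ∈ker-F {a} i≤j (p l j≤l))

  ∈ker-G-low : ∀ {v} → Flag.∈ker G (row low) v → Above v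
  ∈ker-G-low {v} v∈ker q q≤k = coordinate v∈ker q (≡.subst (row q ℕ.≤_) (≡.sym (≡.trans (≡.cong (skip (row k)) row-low) (skip-≥ {row k} ℕ.≤-refl))) q≤k)

  low-∈ker-G : ∀ {v} → Above v → Flag.∈ker G (row low) v
  low-∈ker-G {v} h = ≈/-coordinates λ q q≤ → h q (≡.subst (row q ℕ.≤_) (≡.trans (≡.cong (skip (row k)) row-low) (skip-≥ {row k} ℕ.≤-refl)) q≤)

  ∈ker-G-other : ∀ {p v} → p ≢ low → Flag.∈ker G (row p) v → Flag.∈ker F (row p) v
  ∈ker-G-other {p} {v} p≢low = ≡.subst (λ d → _≈/_ 𝔼 (Beyond d) v (λ _ → R.0#))
    (skip-≢ λ eq → p≢low (Fin.toℕ-injective (ℕ.suc-injective (≡.trans eq (≡.sym row-low)))))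

  -- F and G differ at k only.

  flagged-G : ∀ {a v} → Flagged G (a , v) →
              Flagged F (a , v) ⊎ ∃ λ j → element a j ≡ low × (∀ l → j Fin.≤ l → Above (v l))
  flagged-G {a} {v} (j , p) with element a j Fin.≟ low
  ... | yes eq = inj₂ (j , eq , λ l j≤l → ∈ker-G-low (≡.subst (λ i → Flag.∈ker G (row i) (v l)) eq (p l j≤l)))
  ... | no neq = inj₁ (j , λ l j≤l → ∈ker-G-other neq (p l j≤l))

  τ-var : Variable {suc m} → P
  τ-var (p , q) = var (swapRow k p , q)

  τ : P → P
  τ = substitute τ-var

  τ-cong : ∀ {f g} → f ≈ g → τ f ≈ τ g
  τ-cong = substitute-cong τ-var λ {(p , q)} p∈ker →
    vanish (≡.subst (λ d → _≈/_ 𝔼 (Beyond d) (z q) (λ _ → R.0#)) (≡.sym (level-swapRow p)) p∈ker)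

  τ-involutive : ∀ f → τ (τ f) ≡ f
  τ-involutive (con r)       = ≡.refl
  τ-involutive (var (p , q)) = ≡.cong (λ p → var (p , q)) (swapRow-involutive k p)
  τ-involutive (f ⊕ g)       = ≡.cong₂ _⊕_ (τ-involutive f) (τ-involutive g)
  τ-involutive (f ⊛ g)       = ≡.cong₂ _⊛_ (τ-involutive f) (τ-involutive g)
  τ-involutive (⊝ f)         = ≡.cong ⊝_ (τ-involutive f)

  τ-pairing : ∀ p v → τ (pairing p v) ≈ pairing (swapRow k p) v
  τ-pairing p v = trans (substitute-pairing Z τ-var p v) (sym (pairing-sum (swapRow k p) v))

  -- `τ` changes only the row index of a variable, and `g` acts on the column index.
  τ-σ : ∀ g f → τ (substitute (σ Z g) f) ≈ substitute (σ Z g) (τ f)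
  τ-σ g (con r)       = refl
  τ-σ g (var (p , q)) = τ-pairing p _
  τ-σ g (f ⊕ h)       = +-cong (τ-σ g f) (τ-σ g h)
  τ-σ g (f ⊛ h)       = *-cong (τ-σ g f) (τ-σ g h)
  τ-σ g (⊝ f)         = -‿cong (τ-σ g f)

  minor-cong : ∀ a {v w} → (∀ j → v j ≡ w j) → minor a v ≈ minor a w
  minor-cong a {v} {w} eq = trans (minor≈ a v) (trans (det-cong λ i j → reflexive (≡.cong (pairing (element a i)) (eq j))) (sym (minor≈ a w)))

  minor-cast : ∀ a {r} (eq : r ≡ ∣ a ∣) v → minor a v ≈ det (rows (λ p j → pairing p (v (cast eq j))) a eq)
  minor-cast a eq v = trans (minor≈ a v) (sym (det-cast eq (entries a v)))

  unswap : ∀ a v → ∃ λ s → τ (minor (swapRows k a) v) ≈ sgn s * minor a (v ∘ cast (≡.sym (size-swapRows k a)))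
  unswap a v with det-swapRows k a (swapRows k a) ≡.refl (size-swapRows k a) ≡.refl
  ... | s , eq = s , (begin
    τ (minor (swapRows k a) v)                                                ≈⟨ substitute-minor Z τ-var (swapRows k a) v ⟩
    det (λ i j → τ (pairing (element (swapRows k a) i) (v j)))                ≈⟨ det-cong (λ i j → trans (τ-pairing (element (swapRows k a) i) (v j))
                                                                                   (reflexive (≡.cong (λ i → pairing (swapRow k (element (swapRows k a) i)) (v j)) (≡.sym (Fin.cast-is-id ≡.refl i))))) ⟩
    det (rows (λ p j → pairing (swapRow k p) (v j)) (swapRows k a) ≡.refl)   ≈⟨ eq (λ p j → pairing p (v j)) ⟩
    sgn s * det (rows (λ p j → pairing p (v j)) a (size-swapRows k a))
      ≈⟨ *-congˡ (trans (minor-cast a (size-swapRows k a) (v ∘ cast (≡.sym (size-swapRows k a))))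
           (det-cong λ i j → reflexive (≡.cong (λ j → pairing (element a (cast (size-swapRows k a) i)) (v j)) (Fin.cast-involutive (≡.sym (size-swapRows k a)) (size-swapRows k a) j)))) ⟨
    sgn s * minor a (v ∘ cast (≡.sym (size-swapRows k a)))                    ∎)

  private
    sgn-* : ∀ {s s′ f f′ g g′} → f ≈ sgn s * g → f′ ≈ sgn s′ * g′ → f * f′ ≈ sgn (s ℕ.+ s′) * (g * g′)
    sgn-* {s} {s′} p p′ = trans (*-cong p p′) (trans (*.interchange _ _ _ _) (*-congʳ (sym (sgn-+ s s′))))

  -- This direction places the twisted polynomials in the kernel; `swap-product` serves the opposite
  -- inclusion. Both keep one overall sign, collected from the columns.
  unswap-product : ∀ D t → map proj₁ t ≡ map (swapRows k) D →
                   ∃₂ λ u s → map proj₁ u ≡ D × τ (Π t) ≈ sgn s * Π u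
  unswap-product []      []            eq = [] , 0 , ≡.refl , sym (trans (*-congʳ sgn-0) (*-identityˡ _))
  unswap-product (a ∷ D) ((_ , v) ∷ t) eq with List.∷-injective eq
  ... | ≡.refl , eq′ with unswap a v | unswap-product D t eq′
  ... | s , p | u , s′ , shape , p′ = (a , _) ∷ u , s ℕ.+ s′ , ≡.cong (a ∷_) shape , sgn-* {s} {s′} p p′

  swap-product : ∀ t → ∃₂ λ u s → map proj₁ u ≡ map (swapRows k) (map proj₁ t) × τ (Π u) ≈ sgn s * Π t
  swap-product []            = [] , 0 , ≡.refl , sym (trans (*-congʳ sgn-0) (*-identityˡ _))
  swap-product ((a , v) ∷ t) with unswap a (v ∘ cast (size-swapRows k a)) | swap-product t
  ... | s , p | u , s′ , shape , p′ = (swapRows k a , _) ∷ u , s ℕ.+ s′ , ≡.cong (swapRows k a ∷_) shape ,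
    sgn-* {s} {s′} (trans p (*-congˡ (minor-cong a λ j → ≡.cong v (Fin.cast-involutive (size-swapRows k a) (≡.sym (size-swapRows k a)) j)))) p′

-- Appending a vector, and isolating an entry of a list

snoc : ∀ {a} {A : Set a} {r} → (Fin r → A) → A → Fin (suc r) → A
snoc {r = zero}  u x _       = x
snoc {r = suc r} u x zero    = u zero
snoc {r = suc r} u x (suc i) = snoc (u ∘ suc) x i

snoc-inject₁ : ∀ {a} {A : Set a} {r} (u : Fin r → A) x i → snoc u x (inject₁ i) ≡ u i
snoc-inject₁ u x zero    = ≡.refl
snoc-inject₁ u x (suc i) = snoc-inject₁ (u ∘ suc) x i

snoc-fromℕ : ∀ {a} {A : Set a} {r} (u : Fin r → A) x → snoc u x (fromℕ r) ≡ x
snoc-fromℕ {r = zero}  u x = ≡.refl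
snoc-fromℕ {r = suc r} u x = snoc-fromℕ (u ∘ suc) x

pick : ∀ {a p} {A : Set a} {P : Pred A p} {xs} → Any P xs → ∃₂ λ x ys → P x × xs ↭ x ∷ ys
pick {xs = x ∷ xs} (here px) = x , xs , px , ↭.refl
pick {xs = x ∷ xs} (there p) = let y , ys , py , q = pick p in y , x ∷ ys , py , ↭.trans (↭.prep x q) (↭.swap x y ↭.refl)

-- The descent: flagged products are twisted polynomials

module DescentAt {c ℓ} (R : CommutativeRing c ℓ) (n : ℕ) {m : ℕ} (k : Fin m) (κ : Fin n) (κ≡k : toℕ κ ≡ toℕ k)
  {D : Diagram (suc m)} (d : Descent k D) where

  private module R = CommutativeRing R
  open FlaggedSchur R n hiding (refl; sym; trans)
  open FreeModule R n
  open StandardFlag R n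
  open TwoRows R n k κ κ≡k
  open Polynomials R using (Poly; con; var; polynomialRing; con-cong)
  open CommutativeRing (polynomialRing Z) hiding (zero; _-_)
  private
    module * = CommutativeSemigroupProperties *-commutativeSemigroup
  open Determinants R Z
  open SwapRows R Z
  open Presentation R n Z
  open ≈-Reasoning setoid
  open Descent d renaming (witness to w)

  private
    E : Set c
    E = Rep.Carrierᴹ 𝔼
    P : Set c
    P = Poly (Variable {suc m})

  x₀ : P
  x₀ = var (low , κ)

  w⁻ : Column (suc m)
  w⁻ = w - low

  others : Diagram (suc m)
  others = left ++ right

  sD : Diagram (suc m)
  sD = s k d

  reordered : D ↭ w ∷ others
  reordered = ↭.trans reorder (↭.shift w left right)

  reordered-s : map (swapRows k) (w⁻ ∷ others) ↭ sD
  reordered-s = ↭.map⁺ (swapRows k) (↭.↭-sym (↭.shift w⁻ left right))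

  -- Once the witness is moved to the front, the side on which a column stood matters only through
  -- the condition that it satisfies.
  Admissible : Column (suc m) → Set
  Admissible a = Full k a ⊎ (∀ {i} → i ∈ a → i Fin.≤ high → i ∈ w)

  admissible : All Admissible others
  admissible = All.++⁺ (All.map inj₁ full) (All.map inj₂ contained)

  product-∈ : ∀ Φ D t → map proj₁ t ↭ D → ∃ λ y → poly Φ D y ≈ Π t
  product-∈ Φ D t p with ↭.↭-map-inv proj₁ p
  ... | u , ≡.refl , q = pure Φ u , trans (reflexive (poly-pure Φ u)) (sym (Π-↭ q))

  -- The image of K_k ⊗ Schur F sD in the polynomial ring.

  Twisted : Submodule
  Twisted = record
    { _∋_  = λ f → ∃ λ y → x₀ * τ (poly F sD y) ≈ f
    ; resp = λ p (y , q) → y , trans q p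
    ; ∋-0  = Rep.0ᴹ (TF F sD) , trans (*-congˡ (τ-cong (poly-0 F sD))) (zeroʳ _)
    ; ∋-+  = λ (x , p) (y , q) → Rep._+ᴹ_ (TF F sD) x y ,
        trans (*-congˡ (τ-cong (poly-+ F sD x y))) (trans (distribˡ _ _ _) (+-cong p q))
    ; ∋-*  = λ r (x , p) → Rep._*ₗ_ (TF F sD) r x ,
        trans (*-congˡ (τ-cong (poly-* F sD r x))) (trans (*.x∙yz≈y∙xz _ _ _) (*-congˡ p))
    }

  twisted-product : ∀ u t → map proj₁ t ↭ others → Twisted ∋ x₀ * (minor w⁻ u * Π t)
  twisted-product u t p with swap-product ((w⁻ , u) ∷ t)
  ... | t′ , i , shape , eq with product-∈ F sD t′ (↭.trans (↭.↭-reflexive shape) (↭.trans (↭.map⁺ (swapRows k) (↭.prep w⁻ p)) reordered-s))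
  -- Swapping the rows introduced the sign `sgn i`; multiplying by it once more removes it.
  ... | y , eq′ = Submodule.resp Twisted
    (trans (*-congˡ (*.x∙yz≈y∙xz _ _ _)) (trans (sym (*-assoc _ _ _)) (trans (*-congʳ (sgn-square i)) (*-identityˡ _))))
    (Submodule.∋-sgn Twisted i (y , *-congˡ (trans (τ-cong eq′) eq)))

  size : suc ∣ w⁻ ∣ ≡ ∣ w ∣
  size = size-remove w member largest

  end : Fin ∣ w ∣
  end = cast size (fromℕ _)

  element-end : element w end ≡ low
  element-end = element-last w member largest size

  element-w⁻ : ∀ i → element w (cast size (inject₁ i)) ≡ element w⁻ i
  element-w⁻ = element-remove w member largest size

  element-w⁻-< : ∀ i → element w⁻ i Fin.< low
  element-w⁻-< i = ≡.subst₂ Fin._<_ (element-w⁻ i) element-end (element-mono-< w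
    (≡.subst₂ ℕ._<_ (≡.sym (≡.trans (Fin.toℕ-cast size (inject₁ i)) (Fin.toℕ-inject₁ i)))
                    (≡.sym (≡.trans (Fin.toℕ-cast size (fromℕ _)) (Fin.toℕ-fromℕ _))) (Fin.toℕ<n i)))

  ≤-end : ∀ l → l Fin.≤ end
  ≤-end l = ℕ.≤-trans (ℕ.≤-pred (≡.subst (toℕ l ℕ.<_) (≡.sym size) (Fin.toℕ<n l)))
                      (ℕ.≤-reflexive (≡.sym (≡.trans (Fin.toℕ-cast size (fromℕ _)) (Fin.toℕ-fromℕ _))))

  -- The other rows of w come before k, so the last vector pairs to 0 with them and only the corner
  -- of the last column survives.
  minor-end : ∀ v → Above (v end) → minor w v ≈ (x₀ * con (v end κ)) * minor w⁻ (v ∘ cast size ∘ inject₁)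
  minor-end v above = begin
    minor w v                                         ≈⟨ minor-cast w size v ⟩
    det A                                             ≈⟨ det-corner A (λ i → trans (reflexive (≡.cong (λ p → pairing p (v end)) (element-w⁻ i))) (pairing-below (element-w⁻-< i) above)) ⟩
    A (fromℕ _) (fromℕ _) * det (λ i j → A (inject₁ i) (inject₁ j))
      ≈⟨ *-cong (trans (reflexive (≡.cong (λ p → pairing p (v end)) element-end)) (pairing-at level-low above))
                (trans (det-cong λ i j → reflexive (≡.cong (λ p → pairing p (v (cast size (inject₁ j)))) (element-w⁻ i)))
                       (sym (minor≈ w⁻ (v ∘ cast size ∘ inject₁)))) ⟩
    (x₀ * con (v end κ)) * minor w⁻ (v ∘ cast size ∘ inject₁) ∎
    where
    A : Square (suc ∣ w⁻ ∣)
    A = rows (λ p j → pairing p (v (cast size j))) w size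

  append-z : (Fin ∣ w⁻ ∣ → E) → Fin ∣ w ∣ → E
  append-z u = snoc u (z κ) ∘ cast (≡.sym size)

  append-z-end : ∀ u → append-z u end ≡ z κ
  append-z-end u = ≡.trans (≡.cong (snoc u (z κ)) (Fin.cast-involutive (≡.sym size) size _)) (snoc-fromℕ u (z κ))

  minor-append-z : ∀ u → minor w (append-z u) ≈ x₀ * minor w⁻ u
  minor-append-z u = begin
    minor w (append-z u)     ≈⟨ minor-end (append-z u) (≡.subst Above (≡.sym (append-z-end u)) above-z) ⟩
    (x₀ * con (append-z u end κ)) * minor w⁻ (append-z u ∘ cast size ∘ inject₁)
      ≈⟨ *-cong (trans (*-congˡ (con-cong (R.trans (R.reflexive (≡.cong (λ v → v κ) (append-z-end u))) (z-≡ κ)))) (*-identityʳ _))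
                (minor-cong w⁻ λ i → ≡.trans (≡.cong (snoc u (z κ)) (Fin.cast-involutive (≡.sym size) size _)) (snoc-inject₁ u (z κ) i)) ⟩
    x₀ * minor w⁻ u          ∎

  append-z-flagged : ∀ u → Flagged G (w , append-z u)
  append-z-flagged u = end , λ l end≤l → ≡.subst₂ (λ i v → Flag.∈ker G (row i) v) (≡.sym element-end)
    (≡.trans (≡.sym (append-z-end u)) (≡.cong (append-z u) (Fin.toℕ-injective (ℕ.≤-antisym end≤l (≤-end l)))))
    (low-∈ker-G above-z)

  module _ (a : Column (suc m)) (v : Fin ∣ a ∣ → E) (j : Fin ∣ a ∣) (a-j : element a j ≡ low)
           (above : ∀ l → j Fin.≤ l → Above (v l)) where

    A : Square ∣ a ∣
    A = entries a v

    open Block j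

    <-low : ∀ {i} → i Fin.< j → element a i Fin.< low
    <-low {i} i<j = ≡.subst (element a i Fin.<_) a-j (element-mono-< a i<j)

    A-vanishes : Vanishes A
    A-vanishes i l i<j j≤l = pairing-below (<-low i<j) (above l j≤l)

    -- The coefficients of z_k in the vectors from index `j` on, continued by 0. From column `j` on,
    -- the rows of `A` for k and k + 1 are multiples of `ρ`, and that range of columns is what
    -- `Block` compares.
    coefficient : Fin ∣ a ∣ → R.Carrier
    coefficient l with toℕ j ℕ.≤? toℕ l
    ... | yes _ = v l κ
    ... | no  _ = R.0#

    ρ : Fin ∣ a ∣ → P
    ρ l = con (coefficient l)

    A-multiple : ∀ p → level (element a p) ≡ row k → ∀ l → j Fin.≤ l → A p l ≈ var (element a p , κ) * ρ l
    A-multiple p lev l j≤l with toℕ j ℕ.≤? toℕ l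
    ... | yes _   = pairing-at lev (above l j≤l)
    ... | no  j≰l = contradiction j≤l j≰l

    A-j : ∀ l → j Fin.≤ l → A j l ≈ x₀ * ρ l
    A-j l j≤l = trans (A-multiple j (≡.trans (≡.cong level a-j) level-low) l j≤l) (*-congʳ (reflexive (≡.cong (λ p → var (p , κ)) a-j)))

    M : Fin ∣ a ∣ → P
    M p = det (A [ p ]≔ ρ)

    minor-M : minor a v ≈ x₀ * M j
    minor-M = trans (minor≈ a v) (det-multiple A-vanishes A-j)

    -- Proportionality of the rows k and k + 1 gives z_{k+1,k} M j = 0. As F_{k+1} = E_k, this
    -- variable is not set to 0 and can be cancelled.
    minor-full : high ∈ a → minor a v ≈ 0#
    minor-full high∈a with element-surjective a high∈a
    ... | p , a-p = trans minor-M (trans (*-congˡ (cancel high level-high (trans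
        (*-congʳ (reflexive (≡.cong (λ p → var (p , κ)) (≡.sym a-p))))
        (det-proportional A-vanishes p≢j (A-multiple p (≡.trans (≡.cong level a-p) level-high)))))) (zeroʳ _))
      where
      p≢j : p ≢ j
      p≢j ≡.refl = Fin.<⇒≢ (s≤s (ℕ.≤-reflexive (Fin.toℕ-inject₁ k))) (≡.trans (≡.sym a-j) a-p)

    -- φ x is a linear combination of minors of a.  Expanded along rows
    -- instead of columns, only rows up to k contribute; these all lie in
    -- w, and row k contributes M j.

    φ : E → P
    φ x = sum λ l → ρ l * minor a (v [ l ]≔ x)

    φ-rows : ∀ x → φ x ≈ sum λ p → pairing (element a p) x * M p
    φ-rows x = trans (sum-cong λ l → *-congˡ (trans (minor≈ a (v [ l ]≔ x)) (det-cong (entry l)))) (det-replace A ρ λ p → pairing (element a p) x)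
      where
      entry : ∀ l i j → entries a (v [ l ]≔ x) i j ≈ replaceColumn A l (λ p → pairing (element a p) x) i j
      entry l i j with j Fin.≟ l
      ... | yes ≡.refl = trans (reflexive (≡.cong (pairing (element a i)) (updateAt-updates l v))) (sym (column-≡ A l (λ p → pairing (element a p) x) i))
      ... | no  j≢l    = trans (reflexive (≡.cong (pairing (element a i)) (updateAt-minimal j l v j≢l))) (sym (column-≢ A (λ p → pairing (element a p) x) j≢l i))

    module _ (into-w : ∀ {i} → i ∈ a → i Fin.≤ high → i ∈ w) (u : Fin ∣ w ∣ → E) where

      u′ : Fin (suc ∣ w⁻ ∣) → E
      u′ = u ∘ cast size

      -- A form placed on top of the rows of `w⁻`: for p = k this is the matrix of w with its last
      -- row moved to the front, and for p in `w⁻` it has a repeated row.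
      W : Fin (suc m) → Square (suc ∣ w⁻ ∣)
      W p zero    t = pairing p (u′ t)
      W p (suc i) t = pairing (element w⁻ i) (u′ t)

      W-expand : ∀ p → det (W p) ≈ sum λ t → (sgn (toℕ t) * pairing p (u′ t)) * minor w⁻ (u′ ∘ punchIn t)
      W-expand p = trans (expand-row (W p)) (sum-cong λ t → *-congˡ (sym (minor≈ w⁻ (u′ ∘ punchIn t))))

      W-low : det (W low) ≈ sgn ∣ w⁻ ∣ * minor w u
      W-low = trans (det-cong {B = lastFirst (rows (λ p t → pairing p (u′ t)) w size)} entry)
        (trans (det-lastFirst (rows (λ p t → pairing p (u′ t)) w size)) (*-congˡ (sym (minor-cast w size u))))
        where
        entry : ∀ i t → W low i t ≈ lastFirst (rows (λ p t → pairing p (u′ t)) w size) i t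
        entry zero    t = reflexive (≡.cong (λ p → pairing p (u′ t)) (≡.sym element-end))
        entry (suc i) t = reflexive (≡.cong (λ p → pairing p (u′ t)) (≡.sym (element-w⁻ i)))

      -- For p after `j` the factor `M p` vanishes, since `ρ` is also proportional to row `j`. For p
      -- before `j` the row of a lies in w and differs from k, so it is repeated in `W`.
      W-M : ∀ p → p ≢ j → det (W (element a p)) * M p ≈ 0#
      W-M p p≢j with Fin.<-cmp p j
      ... | tri≈ _ p≡j _ = contradiction p≡j p≢j
      ... | tri> _ _ j<p = trans (*-congˡ (det-replaced A-vanishes A-j j<p)) (zeroʳ _)
      ... | tri< p<j _ _ with element-surjective w⁻ (x∈p∧x≢y⇒x∈p-y (into-w (element-∈ a p) p≤high) (Fin.<⇒≢ (<-low p<j)))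
        where
        p≤high : element a p Fin.≤ high
        p≤high = ℕ.≤-trans (ℕ.<⇒≤ (<-low p<j)) (ℕ.≤-trans (ℕ.≤-reflexive (Fin.toℕ-inject₁ k)) (ℕ.n≤1+n _))
      ...   | i , eq = trans (*-congʳ (det-rows zero (suc i) (λ ()) λ t → reflexive (≡.cong (λ p → pairing p (u′ t)) (≡.sym eq)))) (zeroˡ _)

      -- The expansions of the determinants of `W` along their top rows, weighted by `M p` and
      -- summed over the rows of a. On the left each vector of `u` in turn leaves w and enters a.
      exchange-relation : sum (λ t → sgn (toℕ t) * (minor w⁻ (u′ ∘ punchIn t) * φ (u′ t))) ≈ sgn ∣ w⁻ ∣ * (minor w u * M j)
      exchange-relation = begin
        sum (λ t → sgn (toℕ t) * (minor w⁻ (u′ ∘ punchIn t) * φ (u′ t)))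
          ≈⟨ sum-cong (λ t → trans (sym (*-assoc _ _ _)) (trans (*-congˡ (φ-rows (u′ t))) (*-sum _ _))) ⟩
        sum (λ t → sum λ p → (sgn (toℕ t) * minor w⁻ (u′ ∘ punchIn t)) * (pairing (element a p) (u′ t) * M p))
          ≈⟨ sum-comm _ ⟩
        sum (λ p → sum λ t → (sgn (toℕ t) * minor w⁻ (u′ ∘ punchIn t)) * (pairing (element a p) (u′ t) * M p))
          ≈⟨ sum-cong (λ p → sum-cong λ t → trans (*.interchange _ _ _ _) (trans (sym (*-assoc _ _ _)) (*-comm _ _))) ⟩
        sum (λ p → sum λ t → M p * ((sgn (toℕ t) * pairing (element a p) (u′ t)) * minor w⁻ (u′ ∘ punchIn t)))
          ≈⟨ sum-cong (λ p → trans (sym (*-sum _ _)) (trans (*-congˡ (sym (W-expand (element a p)))) (*-comm _ _))) ⟩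
        sum (λ p → det (W (element a p)) * M p)             ≈⟨ sum-single j W-M ⟩
        det (W (element a j)) * M j                         ≈⟨ *-congʳ (trans (reflexive (≡.cong (λ p → det (W p)) a-j)) W-low) ⟩
        (sgn ∣ w⁻ ∣ * minor w u) * M j                      ≈⟨ *-assoc _ _ _ ⟩
        sgn ∣ w⁻ ∣ * (minor w u * M j)                      ∎

      ∋-exchange : (Q : Submodule) → (∀ u v → Q ∋ minor w⁻ u * minor a v) → Q ∋ minor w u * M j
      ∋-exchange Q h = Submodule.resp Q (trans (sym (*-assoc _ _ _)) (trans (*-congʳ (sgn-square ∣ w⁻ ∣)) (*-identityˡ _)))
        (Submodule.∋-sgn Q ∣ w⁻ ∣ (Submodule.resp Q exchange-relation (Submodule.∋-sum Q λ t → Submodule.∋-sgn Q (toℕ t)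
          (Submodule.∋-sum (Q ∶ minor w⁻ (u′ ∘ punchIn t)) λ l → Submodule.∋-* (Q ∶ minor w⁻ (u′ ∘ punchIn t)) (coefficient l) (h _ _)))))

  private
    regroup : ∀ x π m a → (x * π) * (m * a) ≈ x * (m * (a * π))
    regroup x π m a = trans (*-assoc _ _ _) (*-congˡ (trans (*-comm _ _) (*-assoc _ _ _)))

    minor-0 : ∀ {f g} → f ≈ 0# → Twisted ∋ f * g
    minor-0 p = Submodule.resp Twisted (sym (trans (*-congʳ p) (zeroˡ _))) (Submodule.∋-0 Twisted)

    flagged-twisted′ : ∀ t → map proj₁ t ≡ w ∷ others → Any (Flagged G) t → Twisted ∋ Π t
    flagged-twisted′ ((_ , u) ∷ t) eq f with List.∷-injective eq
    flagged-twisted′ ((_ , u) ∷ t) eq (here f) | ≡.refl , shape with flagged-G {w} {u} f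
    ... | inj₁ f-F             = minor-0 (flagged-F {w} {u} f-F)
    -- `end` is the last index of w, so it lies in the range of `above` whatever `j` is.
    ... | inj₂ (j , _ , above) = Submodule.resp Twisted
      (trans (*.x∙yz≈y∙xz _ _ _) (trans (sym (*-assoc _ _ _)) (trans (sym (*-assoc _ _ _)) (*-congʳ (sym (minor-end u (above end (≤-end j))))))))
      (Submodule.∋-* Twisted (u end κ) (twisted-product (u ∘ cast size ∘ inject₁) t (↭.↭-reflexive shape)))
    flagged-twisted′ ((_ , u) ∷ t) eq (there f) | ≡.refl , shape with pick f
    ... | (a , v) , t₃ , f-a , q = Submodule.resp Twisted (trans (*.x∙yz≈y∙xz _ _ _) (*-congˡ (sym (Π-↭ q)))) (case (flagged-G {a} {v} f-a))
      where
      shape₃ : a ∷ map proj₁ t₃ ↭ others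
      shape₃ = ↭.trans (↭.↭-sym (↭.map⁺ proj₁ q)) (↭.↭-reflexive shape)

      case : Flagged F (a , v) ⊎ (∃ λ j → element a j ≡ low × (∀ l → j Fin.≤ l → Above (v l))) → Twisted ∋ minor a v * (minor w u * Π t₃)
      case (inj₁ f-F) = minor-0 (flagged-F {a} {v} f-F)
      case (inj₂ (j , a-j , above)) with All.head (↭.All-resp-↭ (↭.↭-sym shape₃) admissible)
      ... | inj₁ a-full = minor-0 (minor-full a v j a-j above (a-full (≡.subst (_∈ a) a-j (element-∈ a j))))
      ... | inj₂ into-w = Submodule.resp Twisted
        (trans (regroup x₀ (Π t₃) (minor w u) (M a v j a-j above j)) (trans (*-congˡ (*.x∙yz≈y∙xz _ _ _)) (trans (sym (*-assoc _ _ _)) (*-congʳ (sym (minor-M a v j a-j above))))))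
        -- The colon takes up x and the factors that the exchange does not touch; what remains to be
        -- tested are products of a minor of `w⁻` and a minor of a.
        (∋-exchange a v j a-j above into-w u (Twisted ∶ x₀ * Π t₃) λ u v →
          Submodule.resp Twisted (sym (regroup x₀ (Π t₃) (minor w⁻ u) (minor a v))) (twisted-product u ((a , v) ∷ t₃) shape₃))

  flagged-twisted : ∀ t → map proj₁ t ↭ D → Any (Flagged G) t → Twisted ∋ Π t
  flagged-twisted t p f with ↭.↭-map-inv proj₁ (↭.trans p reordered)
  ... | t′ , eq , q = Submodule.resp Twisted (sym (Π-↭ q)) (flagged-twisted′ t′ (≡.sym eq) (↭.Any-resp-↭ q f))

-- From Schur modules and their kernels to polynomials

module SchurPolynomials {c ℓ} (R : CommutativeRing c ℓ) (n : ℕ) {N : ℕ}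
  (Z : Pred (FlaggedSchur.Variable R n {N}) (c ⊔ ℓ)) where

  open FlaggedSchur R n hiding (refl; sym; trans)
  open Polynomials R using (Poly; con; var; _⊕_; _⊛_; ⊝_; polynomialRing; _≈ᴾ_; substitute; substitute-cong)
  open CommutativeRing (polynomialRing Z) hiding (zero)
  open Presentation R n Z

  substitute-var : ∀ (f : Poly (Variable {N})) → substitute var f ≡ f
  substitute-var (con r) = ≡.refl
  substitute-var (var x) = ≡.refl
  substitute-var (f ⊕ g) = ≡.cong₂ _⊕_ (substitute-var f) (substitute-var g)
  substitute-var (f ⊛ g) = ≡.cong₂ _⊛_ (substitute-var f) (substitute-var g)
  substitute-var (⊝ f)   = ≡.cong ⊝_ (substitute-var f)

  -- Exchange relations hold in the full polynomial ring; substituting every variable for itself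
  -- carries them to the ring with variables set to 0.
  None⇒Z : ∀ {f g} → _≈ᴾ_ None f g → f ≈ g
  None⇒Z {f} {g} p = ≡.subst₂ _≈_ (substitute-var f) (substitute-var g) (substitute-cong var (λ ()) p)

  module _ (Φ : Flag) (D : Diagram N) where

    Schur-~ : (Q : Submodule) → (∀ t → map proj₁ t ≡ D → Any (Flagged Φ) t → Q ∋ Π t) →
              ∀ {x y} → Rep._≈ᴹ_ (Schur Φ D) x y → Q ⊢ poly Φ D x ~ poly Φ D y
    Schur-~ Q h = go
      where
      go : ∀ {x y} → Rep._≈ᴹ_ (Schur Φ D) x y → Q ⊢ poly Φ D x ~ poly Φ D y
      go (base p)            = TF-~ Φ D Q h p
      go (kill (exchange e p)) = ~-≈ Q (trans (reflexive (poly-projection Φ D e)) (trans (None⇒Z p) (sym (poly-0 Φ D))))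
      go (~sym p)            = ~-sym Q (go p)
      go (~trans p q)        = ~-trans Q (go p) (go q)
      go (~+ p q)            = ~-trans Q (~-≈ Q (poly-+ Φ D _ _)) (~-trans Q (~-+ Q (go p) (go q)) (~-≈ Q (sym (poly-+ Φ D _ _))))
      go (~- p)              = ~-trans Q (~-≈ Q (poly-neg Φ D _)) (~-trans Q (~-neg Q (go p)) (~-≈ Q (sym (poly-neg Φ D _))))
      go (~* r p)            = ~-trans Q (~-≈ Q (poly-* Φ D r _)) (~-trans Q (~-* Q r (go p)) (~-≈ Q (sym (poly-* Φ D r _))))

  module _ {Φ Ψ : Flag} (f : Φ ⟶ Ψ) where

    TF-map-pure : ∀ t → RepHom.to (TF-map f (map proj₁ t)) (pure Φ t) ≡ pure Ψ t
    TF-map-pure []            = ≡.refl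
    TF-map-pure ((a , v) ∷ t) = ≡.cong (λ y → gen (gen v , y)) (TF-map-pure t)

    poly-TF-map : ∀ D x → poly Ψ D (RepHom.to (TF-map f D) x) ≡ poly Φ D x
    poly-TF-map []      x = ≡.refl
    poly-TF-map (a ∷ D) (gen (x , y)) = ≡.cong (extend (minor a) x ⊛_) (poly-TF-map D y)
    poly-TF-map (a ∷ D) 𝟘       = ≡.refl
    poly-TF-map (a ∷ D) (t ⊞ u) = ≡.cong₂ _⊕_ (poly-TF-map (a ∷ D) t) (poly-TF-map (a ∷ D) u)
    poly-TF-map (a ∷ D) (⊟ t)   = ≡.cong ⊝_ (poly-TF-map (a ∷ D) t)
    poly-TF-map (a ∷ D) (r ⊡ t) = ≡.cong (con r ⊛_) (poly-TF-map (a ∷ D) t)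

    kernel-product : ∀ D t → map proj₁ t ≡ D → Any (Flagged Ψ) t →
                     ∃ λ (x : Rep.Carrierᴹ (Kernel (Schur-map f D))) → poly Φ D (proj₁ x) ≈ Π t
    kernel-product _ t ≡.refl p = (pure Φ t , base (Rep.≈ᴹ-trans (TF Ψ (map proj₁ t))
      (Rep.≈ᴹ-reflexive (TF Ψ (map proj₁ t)) (TF-map-pure t)) (pure-flagged Ψ p))) , reflexive (poly-pure Φ t)

-- The isomorphism of B-modules

module Isomorphism {c ℓ} (R : CommutativeRing c ℓ) (n : ℕ) {m : ℕ} (k : Fin m) (κ : Fin n) (κ≡k : toℕ κ ≡ toℕ k)
  {D : Diagram (suc m)} (d : Descent k D) where

  private module R = CommutativeRing R
  open FlaggedSchur R n hiding (refl; sym; trans)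
  open FreeModule R n
  open StandardFlag R n
  open TwoRows R n k κ κ≡k
  open DescentAt R n k κ κ≡k d
  open Polynomials R using (Poly; con; polynomialRing; con-cong; con-+; con-*; substitute; substitute-cong)
  open CommutativeRing (polynomialRing Z) hiding (zero; _-_)
  open RingProperties ring using (-‿distribʳ-*)
  private
    module * = CommutativeSemigroupProperties *-commutativeSemigroup
  open Determinants R Z
  open Presentation R n Z
  open SchurPolynomials R n Z
  open ≈-Reasoning setoid
  open Descent d renaming (witness to w)

  private
    E : Set c
    E = Rep.Carrierᴹ 𝔼
    _•ᴱ_ : Borel → E → E
    _•ᴱ_ = Rep._•_ 𝔼

  f : F ⟶ G
  f = 𝖱-map (row k) standard

  Ker : Rep _ _
  Ker = Kernel (Schur-map f D)

  -- The image of the kernel in the polynomial ring.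

  Kernels : Submodule
  Kernels = record
    { _∋_  = λ g → ∃ λ (x : Rep.Carrierᴹ Ker) → poly F D (proj₁ x) ≈ g
    ; resp = λ p (x , q) → x , trans q p
    ; ∋-0  = Rep.0ᴹ Ker , poly-0 F D
    ; ∋-+  = λ (x , p) (y , q) → Rep._+ᴹ_ Ker x y , trans (poly-+ F D _ _) (+-cong p q)
    ; ∋-*  = λ r (x , p) → Rep._*ₗ_ Ker r x , trans (poly-* F D r _) (*-congˡ p)
    }

  kernel-flagged : ∀ t → map proj₁ t ↭ D → Any (Flagged G) t → Kernels ∋ Π t
  kernel-flagged t p fl with ↭.↭-map-inv proj₁ p
  ... | t′ , eq , q = Submodule.resp Kernels (sym (Π-↭ q)) (kernel-product f D t′ (≡.sym eq) (↭.Any-resp-↭ q fl))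

  -- The preimage of `Kernels` under g ↦ x τ(g) is a submodule, so products of minors suffice. For
  -- these, undoing the swap and appending z_k to the vectors of `w⁻` gives a product for D that is
  -- flagged for G.
  twisted-kernel : ∀ y → Kernels ∋ x₀ * τ (poly F sD y)
  twisted-kernel = poly-∋ F sD Pulled product
    where
    Pulled : Submodule
    Pulled = record
      { _∋_  = λ g → Kernels ∋ x₀ * τ g
      ; resp = λ p → Submodule.resp Kernels (*-congˡ (τ-cong p))
      ; ∋-0  = Submodule.resp Kernels (sym (zeroʳ _)) (Submodule.∋-0 Kernels)
      ; ∋-+  = λ p q → Submodule.resp Kernels (sym (distribˡ _ _ _)) (Submodule.∋-+ Kernels p q)
      ; ∋-*  = λ r p → Submodule.resp Kernels (*.x∙yz≈y∙xz _ _ _) (Submodule.∋-* Kernels r p)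
      }

    unswapped : ∀ t → map proj₁ t ≡ w⁻ ∷ others → Kernels ∋ x₀ * Π t
    unswapped ((_ , v) ∷ t) eq with List.∷-injective eq
    ... | ≡.refl , shape = Submodule.resp Kernels (trans (*-congʳ (minor-append-z v)) (*-assoc _ _ _))
      (kernel-flagged ((w , append-z v) ∷ t) (↭.trans (↭.↭-reflexive (≡.cong (w ∷_) shape)) (↭.↭-sym reordered)) (here (append-z-flagged v)))

    product : ∀ t → map proj₁ t ≡ sD → Kernels ∋ x₀ * τ (Π t)
    product t eq with ↭.↭-map-inv proj₁ (↭.trans (↭.↭-reflexive eq) (↭.↭-sym reordered-s))
    ... | t₀ , eq₀ , q with unswap-product (w⁻ ∷ others) t₀ (≡.sym eq₀)
    ... | u , i , shape , p = Submodule.resp Kernels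
      (trans (*.x∙yz≈y∙xz _ _ _) (*-congˡ (sym (trans (τ-cong (Π-↭ q)) p))))
      (Submodule.∋-sgn Kernels i (unswapped u shape))

  -- The map to `Schur G D` does not change the polynomial, and equality with 0 there becomes
  -- congruence with 0 modulo `Twisted`.
  kernel-twisted : ∀ (x : Rep.Carrierᴹ Ker) → Twisted ∋ poly F D (proj₁ x)
  kernel-twisted (x , p) = Submodule.resp Twisted (reflexive (poly-TF-map f D x))
    (~-0 Twisted (~-trans Twisted (Schur-~ G D Twisted (λ t eq → flagged-twisted t (↭.↭-reflexive eq)) p) (~-≈ Twisted (poly-0 G D))))

  Schur-poly : ∀ D {x y} → Rep._≈ᴹ_ (Schur F D) x y → poly F D x ≈ poly F D y
  Schur-poly D {x} {y} p = x-y≈0⇒x≈y (Schur-~ F D Zero (λ t _ → flagged-0 t) p)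
    where
    x-y≈0⇒x≈y : ∀ {f g} → f + - g ≈ 0# → f ≈ g
    x-y≈0⇒x≈y {f} {g} = GroupProperties.x∙y⁻¹≈ε⇒x≈y +-group f g
    flagged-0 : ∀ t → Any (Flagged F) t → Π t ≈ 0#
    flagged-0 ((a , v) ∷ t) (here q)  = trans (*-congʳ (flagged-F {a} {v} q)) (zeroˡ _)
    flagged-0 ((a , v) ∷ t) (there q) = trans (*-congˡ (flagged-0 t q)) (zeroʳ _)

  -- The embedding hypothesis is about elements of `T D` with polynomial 0; it is applied to a lift
  -- of the difference.
  poly-injective : ∀ D → IsSubmoduleOfPolynomials F D → ∀ {x y} → poly F D x ≈ poly F D y → Rep._≈ᴹ_ (Schur F D) x y
  poly-injective D sub {x} {y} p = GroupProperties.x∙y⁻¹≈ε⇒x≈y (Rep.+ᴹ-group (Schur F D)) x y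
    (≡.subst (λ e → Rep._≈ᴹ_ (Schur F D) e (Rep.0ᴹ (Schur F D))) (projection-lift F D e) (sub (lift F D e) (begin
      Δ D (lift F D e)                           ≈⟨ reflexive (poly-projection F D (lift F D e)) ⟨
      poly F D (RepHom.to (projection F D) (lift F D e)) ≈⟨ reflexive (≡.cong (poly F D) (projection-lift F D e)) ⟩
      poly F D e                                 ≈⟨ poly-+ F D x _ ⟩
      poly F D x + poly F D (Rep.-ᴹ_ (TF F D) y) ≈⟨ +-cong p (poly-neg F D y) ⟩
      poly F D y + - poly F D y                  ≈⟨ -‿inverseʳ _ ⟩
      0#                                         ∎)))
    where e = Rep._+ᴹ_ (TF F D) x (Rep.-ᴹ_ (TF F D) y)

  twist-injective : ∀ {g h} → x₀ * τ g ≈ x₀ * τ h → g ≈ h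
  twist-injective {g} {h} p = begin
    g         ≈⟨ reflexive (τ-involutive g) ⟨
    τ (τ g)   ≈⟨ τ-cong (GroupProperties.x∙y⁻¹≈ε⇒x≈y +-group (τ g) (τ h) (cancel low level-low (begin
      x₀ * (τ g + - τ h)         ≈⟨ distribˡ _ _ _ ⟩
      x₀ * τ g + x₀ * (- τ h)    ≈⟨ +-cong p (sym (-‿distribʳ-* _ _)) ⟩
      x₀ * τ h + - (x₀ * τ h)    ≈⟨ -‿inverseʳ _ ⟩
      0#                         ∎))) ⟩
    τ (τ h)   ≈⟨ reflexive (τ-involutive h) ⟩
    h         ∎

  Line : Rep _ _
  Line = Kernel (component f (row k))

  skip-row : skip (suc (row k)) (row k) ≡ row k
  skip-row = skip-< ℕ.≤-refl

  line-z : Rep.Carrierᴹ Line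
  line-z = z κ , ≈/-coordinates λ q q≤ → above-z q (≡.subst (row q ℕ.≤_) (skip-≥ {row k} ℕ.≤-refl) q≤)

  line-coordinate : ∀ (v : Rep.Carrierᴹ Line) → Rep._≈ᴹ_ Line v (Rep._*ₗ_ Line (proj₁ v κ) line-z)
  line-coordinate (v , p) = ≈/-coordinates λ q q≤ → coordinate′ q (≡.subst (row q ℕ.≤_) skip-row q≤)
    where
    coordinate′ : ∀ q → row q ℕ.≤ row k → v q R.≈ v κ R.* z κ q
    coordinate′ q q≤ with q Fin.≟ κ
    ... | yes ≡.refl = R.sym (R.*-identityʳ _)
    ... | no  q≢κ    = R.trans (coordinate p q (ℕ.≤-trans (ℕ.≤-pred (ℕ.≤∧≢⇒< q≤ λ eq → q≢κ (Fin.toℕ-injective (≡.trans (ℕ.suc-injective eq) (≡.sym κ≡k)))))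
                                                           (ℕ.≤-reflexive (≡.sym (skip-≥ {row k} ℕ.≤-refl)))))
                               (R.sym (R.zeroʳ _))

  module _ (subD : IsSubmoduleOfPolynomials F D) (subS : IsSubmoduleOfPolynomials F sD) where

    S : Rep c (c ⊔ ℓ)
    S = Schur F sD
    Target : Rep _ _
    Target = Line ⊗ S
    module Ker = Rep Ker
    module S = Rep S
    module Target = Rep Target

    untwist : Ker.Carrierᴹ → S.Carrierᴹ
    untwist x = proj₁ (kernel-twisted x)

    untwist-≈ : ∀ x → x₀ * τ (poly F sD (untwist x)) ≈ poly F D (proj₁ x)
    untwist-≈ x = proj₂ (kernel-twisted x)

    -- `untwist` takes the preimage out of a membership proof, so nothing about it is linear by
    -- construction. Its laws all follow from this uniqueness, which rests on cancelling x, on τ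
    -- being an involution and on the embedding for sD.
    untwist-unique : ∀ x y → x₀ * τ (poly F sD y) ≈ poly F D (proj₁ x) → untwist x S.≈ᴹ y
    untwist-unique x y p = poly-injective sD subS (twist-injective (trans (untwist-≈ x) (sym p)))

    line-⊗ : ∀ v y → gen (v , y) Target.≈ᴹ gen (line-z , (proj₁ v κ S.*ₗ y))
    line-⊗ v y = Target.≈ᴹ-trans (rel (⊗-cong {y = y} (line-coordinate v) S.≈ᴹ-refl))
      (Target.≈ᴹ-trans (rel (⊗-*ˡ (proj₁ v κ) line-z y)) (Target.≈ᴹ-sym (rel (⊗-*ʳ (proj₁ v κ) line-z y))))

    to : Ker.Carrierᴹ → Target.Carrierᴹ
    to x = gen (line-z , untwist x)

    to-≈ : ∀ x y → untwist x S.≈ᴹ y → to x Target.≈ᴹ gen (line-z , y)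
    to-≈ x y p = rel (⊗-cong (Rep.≈ᴹ-refl Line {line-z}) p)

    to-cong : ∀ {x y} → x Ker.≈ᴹ y → to x Target.≈ᴹ to y
    to-cong {x} {y} p = to-≈ x _ (untwist-unique x (untwist y) (trans (untwist-≈ y) (sym (Schur-poly D p))))

    to-+ : ∀ x y → to (x Ker.+ᴹ y) Target.≈ᴹ to x Target.+ᴹ to y
    to-+ x y = Target.≈ᴹ-trans (to-≈ (x Ker.+ᴹ y) _ (untwist-unique (x Ker.+ᴹ y) (untwist x S.+ᴹ untwist y) (begin
      x₀ * τ (poly F sD (untwist x S.+ᴹ untwist y))                         ≈⟨ *-congˡ (τ-cong (poly-+ F sD (untwist x) (untwist y))) ⟩
      x₀ * (τ (poly F sD (untwist x)) + τ (poly F sD (untwist y)))          ≈⟨ distribˡ _ _ _ ⟩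
      x₀ * τ (poly F sD (untwist x)) + x₀ * τ (poly F sD (untwist y))       ≈⟨ +-cong (untwist-≈ x) (untwist-≈ y) ⟩
      poly F D (proj₁ x) + poly F D (proj₁ y)                               ≈⟨ poly-+ F D (proj₁ x) (proj₁ y) ⟨
      poly F D (proj₁ (x Ker.+ᴹ y))                                         ∎)))
      (rel (⊗-+ʳ line-z (untwist x) (untwist y)))

    to-* : ∀ r x → to (r Ker.*ₗ x) Target.≈ᴹ r Target.*ₗ to x
    to-* r x = Target.≈ᴹ-trans (to-≈ (r Ker.*ₗ x) _ (untwist-unique (r Ker.*ₗ x) (r S.*ₗ untwist x) (begin
      x₀ * τ (poly F sD (r S.*ₗ untwist x))           ≈⟨ *-congˡ (τ-cong (poly-* F sD r (untwist x))) ⟩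
      x₀ * (con r * τ (poly F sD (untwist x)))        ≈⟨ *.x∙yz≈y∙xz _ _ _ ⟩
      con r * (x₀ * τ (poly F sD (untwist x)))        ≈⟨ *-congˡ (untwist-≈ x) ⟩
      con r * poly F D (proj₁ x)                      ≈⟨ poly-* F D r (proj₁ x) ⟨
      poly F D (proj₁ (r Ker.*ₗ x))                   ∎)))
      (rel (⊗-*ʳ r line-z (untwist x)))

    -- The kernels of E → F_p are stable under B, so a variable set to 0 is sent to a form that
    -- vanishes as well.
    σ-cong : ∀ g {f h} → f ≈ h → substitute (σ Z g) f ≈ substitute (σ Z g) h
    σ-cong g = substitute-cong (σ Z g) λ {(p , q)} z∈ker → pairing-vanish p
      (coordinate (Rep.≈ᴹ-trans (Flag.at F (row p)) (Rep.•-cong (Flag.at F (row p)) {g} {g} (λ _ _ → R.refl) z∈ker) (Rep.•-0 (Flag.at F (row p)) g)))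

    action-above : ∀ g → Above (g •ᴱ z κ)
    action-above g q q≤k = R.trans (action-z g κ q) (Borel.lower g (ℕ.≤-trans q≤k (ℕ.≤-reflexive (≡.sym κ≡k))))

    -- `g` multiplies x by γ, its diagonal entry at k. The same scalar appears when `g` acts on the
    -- factor z_k of the tensor, and there it is moved across to the other factor.
    to-• : ∀ g x → to (g Ker.• x) Target.≈ᴹ g Target.• to x
    to-• g x = Target.≈ᴹ-trans (to-≈ (g Ker.• x) _ (untwist-unique (g Ker.• x) (γ S.*ₗ (g S.• y)) (begin
      x₀ * τ (poly F sD (γ S.*ₗ (g S.• y)))                         ≈⟨ *-congˡ (τ-cong (poly-* F sD γ (g S.• y))) ⟩
      x₀ * (con γ * τ (poly F sD (g S.• y)))                        ≈⟨ *-assoc _ _ _ ⟨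
      (x₀ * con γ) * τ (poly F sD (g S.• y))                        ≈⟨ *-cong (pairing-at level-low (action-above g)) (τ-cong (σ-poly Z F sD g y)) ⟨
      pairing low (g •ᴱ z κ) * τ (substitute (σ Z g) (poly F sD y)) ≈⟨ *-congˡ (τ-σ g (poly F sD y)) ⟩
      substitute (σ Z g) (x₀ * τ (poly F sD y))                     ≈⟨ σ-cong g (untwist-≈ x) ⟩
      substitute (σ Z g) (poly F D (proj₁ x))                       ≈⟨ σ-poly Z F D g (proj₁ x) ⟩
      poly F D (proj₁ (g Ker.• x))                                  ∎)))
      (Target.≈ᴹ-sym (line-⊗ (Rep._•_ Line g line-z) (g S.• y)))
      where
      y = untwist x
      γ = (g •ᴱ z κ) κ

    -- Line ⊗ S is S, through the coefficient of z_k; to-injective reads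
    -- the polynomial of untwist x off to x in this way.

    contract : Target.Carrierᴹ → Poly (Variable {suc m})
    contract = extend λ (v , y) → con (proj₁ v κ) * poly F sD y

    contract-cong : ∀ {t u} → t Target.≈ᴹ u → contract t ≈ contract u
    contract-cong {t} {u} p = GroupProperties.x∙y⁻¹≈ε⇒x≈y +-group (contract t) (contract u) (extend-~ Zero bilinear p)
      where
      bilinear : ∀ {t u} → Bilinear Line S t u → Zero ⊢ contract t ~ contract u
      bilinear (⊗-cong p q)    = ~-≈ Zero (*-cong (con-cong (coordinate p κ (ℕ.≤-reflexive (≡.trans row-κ (≡.sym skip-row))))) (Schur-poly sD q))
      bilinear (⊗-+ˡ v v′ y)   = ~-≈ Zero (trans (*-congʳ (con-+ _ _)) (distribʳ _ _ _))
      bilinear (⊗-+ʳ v y y′)   = ~-≈ Zero (trans (*-congˡ (poly-+ F sD y y′)) (distribˡ _ _ _))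
      bilinear (⊗-*ˡ r v y)    = ~-≈ Zero (trans (*-congʳ (con-* _ _)) (*-assoc _ _ _))
      bilinear (⊗-*ʳ r v y)    = ~-≈ Zero (trans (*-congˡ (poly-* F sD r y)) (*.x∙yz≈y∙xz _ _ _))

    to-injective : ∀ {x y} → to x Target.≈ᴹ to y → x Ker.≈ᴹ y
    to-injective {x} {y} p = poly-injective D subD (begin
      poly F D (proj₁ x)                         ≈⟨ untwist-≈ x ⟨
      x₀ * τ (poly F sD (untwist x))             ≈⟨ *-congˡ (τ-cong (trans (sym (contract-z x)) (trans (contract-cong p) (contract-z y)))) ⟩
      x₀ * τ (poly F sD (untwist y))             ≈⟨ untwist-≈ y ⟩
      poly F D (proj₁ y)                         ∎)
      where
      contract-z : ∀ x → contract (to x) ≈ poly F sD (untwist x)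
      contract-z x = trans (*-congʳ (con-cong (z-≡ κ))) (*-identityˡ _)

    z-⊗-0 : gen (line-z , S.0ᴹ) Target.≈ᴹ 𝟘
    z-⊗-0 = Target.≈ᴹ-trans (rel (⊗-cong (Rep.≈ᴹ-refl Line {line-z}) (S.≈ᴹ-sym (S.*ₗ-zeroˡ S.0ᴹ))))
      (Target.≈ᴹ-trans (rel (⊗-*ʳ R.0# line-z S.0ᴹ)) (⊡-zeroˡ _))

    -- K_k is spanned by z_k, so every coefficient can be moved into the second factor, where sums
    -- of tensors are collected.
    z-⊗ : ∀ t → ∃ λ y → gen (line-z , y) Target.≈ᴹ t
    z-⊗ (gen (v , y)) = _ , Target.≈ᴹ-sym (line-⊗ v y)
    z-⊗ 𝟘             = S.0ᴹ , z-⊗-0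
    z-⊗ (t ⊞ u)       = let x , p = z-⊗ t ; y , q = z-⊗ u in
      x S.+ᴹ y , Target.≈ᴹ-trans (rel (⊗-+ʳ line-z x y)) (⊞-cong p q)
    z-⊗ (⊟ t)         = let x , p = z-⊗ t in
      S.-ᴹ x , Target.≈ᴹ-trans (AbelianGroupProperties.inverseˡ-unique Target.+ᴹ-abelianGroup _ _
        (Target.≈ᴹ-trans (Target.≈ᴹ-sym (rel (⊗-+ʳ line-z (S.-ᴹ x) x)))
        (Target.≈ᴹ-trans (rel (⊗-cong (Rep.≈ᴹ-refl Line {line-z}) (S.-ᴹ‿inverseˡ x))) z-⊗-0))) (⊟-cong p)
    z-⊗ (r ⊡ t)       = let x , p = z-⊗ t in
      r S.*ₗ x , Target.≈ᴹ-trans (rel (⊗-*ʳ r line-z x)) (⊡-cong R.refl p)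

    to-surjective : ∀ t → ∃ λ x → ∀ {x′} → x′ Ker.≈ᴹ x → to x′ Target.≈ᴹ t
    to-surjective t with z-⊗ t
    ... | y , y≈t with twisted-kernel y
    ... | x , p = x , λ {x′} q → Target.≈ᴹ-trans (to-cong {x′} {x} q)
      (Target.≈ᴹ-trans (to-≈ x y (untwist-unique x y (sym p))) y≈t)

    isomorphism : Ker ≅ Target
    isomorphism = record
      { to = to
      ; isIso = record
        { isLeftModuleMonomorphism = record
          { isLeftModuleHomomorphism = RepHom.isHom (mkHom Ker Target to (λ {x} {y} → to-cong {x} {y}) to-+ to-* to-•)
          ; injective = λ {x} {y} → to-injective {x} {y}
          }
        ; surjective = to-surjective
        }
      ; equivariant = to-•
      }

lemma4p10 : ∀ {c ℓ} (R : CommutativeRing c ℓ) (n : ℕ) →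
    let open FlaggedSchur R n in
    ∀ {m} (k : Fin m) (D : Diagram (suc m)) (d : Descent k D) →
    InRows n D → InRows n (s k d) →
    IsSubmoduleOfPolynomials (𝖱 (suc (row k)) standard) D →
    IsSubmoduleOfPolynomials (𝖱 (suc (row k)) standard) (s k d) →
    Kernel (Schur-map (𝖱-map (row k) standard) D) ≅
    (Kernel (component (𝖱-map (row k) standard) (row k)) ⊗ Schur (𝖱 (suc (row k)) standard) (s k d))
lemma4p10 R n k D d inRows _ subD subS = Isomorphism.isomorphism R n k (fromℕ< k<n) (≡.trans (Fin.toℕ-fromℕ< k<n) (Fin.toℕ-inject₁ k)) d subD subS
  where
  open Descent d
  -- z_k exists because the witness contains k and its boxes lie in the rows up to n.
  k<n : row (inject₁ k) ℕ.≤ n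
  k<n = All.head (All.++⁻ʳ left (↭.All-resp-↭ reorder inRows)) member
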